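{- Let $\mathfrak{S}(d)$ denote the symmetric group on $\{1,\dots,d\}$. For partitions $\alpha,\beta \vdash d$ and an integer $g \geq 0$, let $\vec{H}_g(\alpha,\beta)$ be the monotone double Hurwitz number defined in the context below, and define the formal power series $$\vec{\mathbf{F}}_g(z) = \sum_{d=1}^\infty \Big( \sum_{\alpha,\beta \vdash d} \vec{H}_g(\alpha,\beta)\Big) \frac{z^d}{d!}.$$ Then for every $g \geq 0$, the radius of convergence of $\vec{\mathbf{F}}_g(z)$ is at least $1/54$ and at most $2/27$.
   Context: For $\rho,\sigma \in \mathfrak{S}(d)$ and $r \geq 0$, an $r$-step walk from $\rho$ to $\sigma$ is an $r$-tuple of transpositions $((s_1\ t_1),\dots,(s_r\ t_r))$ with $s_i<t_i$ for all $i$ and $\sigma = \rho (s_1\ t_1)\cdots(s_r\ t_r)$. The list $(t_1,\dots,t_r)$ is its spectrum and its entries are called colours. The walk is monotone if $t_1 \leq t_2 \leq \dots \leq t_r$, and transitive if the subgroup of $\mathfrak{S}(d)$ generated by $\rho$, $\sigma$ and the transpositions $(s_1\ t_1),\dots,(s_r\ t_r)$ acts transitively on $\{1,\dots,d\}$. For partitions $\alpha,\beta\vdash d$ with $\ell(\alpha),\ell(\beta)$ their numbers of parts, set $r_g(\alpha,\beta)=2g-2+\ell(\alpha)+\ell(\beta)$. The monotone double Hurwitz number $\vec{H}_g(\alpha,\beta)$ is the total number of monotone transitive $r_g(\alpha,\beta)$-step walks (over all choices of endpoints) which begin at a permutation $\rho$ of cycle type $\alpha$ and end at a permutation $\sigma$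 of cycle type $\beta$ (it is $0$ if $r_g(\alpha,\beta)<0$). -}

module Defs where

open import Data.Nat using (ℕ; zero; suc; _+_; _*_; _^_; _≤_; _<_; _≤ᵇ_; _≡ᵇ_; _!)
open import Data.Nat.ListAction using (sum)
open import Data.Bool.ListAction using (all; any)
open import Data.Fin using (Fin; toℕ; _≟_)
open import Data.Bool using (Bool; true; false; _∧_; _∨_; not; if_then_else_)
open import Data.List using (List; []; _∷_; map; concatMap; allFin; upTo; foldr; length)
open import Data.Vec using (Vec; []; _∷_; lookup)
open import Data.Product using (_×_; _,_; proj₁; proj₂; ∃)
open import Relation.Nullary using (does)
open import Function using (_∘_)

eqF : ∀ {d} → Fin d → Fin d → Bool
eqF i j = does (i ≟ j)

vecsOver : ∀ {A : Set} → List A → (n : ℕ) → List (Vec A n)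
vecsOver xs zero    = [] ∷ []
vecsOver xs (suc n) = concatMap (λ x → map (x ∷_) (vecsOver xs n)) xs

isInjVec : ∀ {d} → Vec (Fin d) d → Bool
isInjVec {d} v =
  all (λ i → all (λ j → not (eqF (lookup v i) (lookup v j)) ∨ eqF i j) (allFin d)) (allFin d)

perms : (d : ℕ) → List (Fin d → Fin d)
perms d = map lookup (filterB isInjVec (vecsOver (allFin d) d))
  where
  filterB : ∀ {A : Set} → (A → Bool) → List A → List A
  filterB p []       = []
  filterB p (x ∷ xs) = if p x then x ∷ filterB p xs else filterB p xs

iter : ∀ {A : Set} → ℕ → (A → A) → A → A
iter zero    f x = x
iter (suc k) f x = f (iter k f x)

-- number of cycles ℓ of a permutation: number of points that are the
-- smallest element of their cycle
countB : ∀ {A : Set} → (A → Bool) → List A → ℕ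
countB p = foldr (λ x n → if p x then suc n else n) 0

numCycles : ∀ {d} → (Fin d → Fin d) → ℕ
numCycles {d} f =
  countB (λ x → all (λ k → toℕ x ≤ᵇ toℕ (iter k f x)) (upTo (suc d))) (allFin d)

-- a transposition (s t) with s < t, stored as the pair (s , t)
Transp : ℕ → Set
Transp d = Fin d × Fin d

allTransp : (d : ℕ) → List (Transp d)
allTransp d = concatMap (λ s → concatMap (λ t →
  if suc (toℕ s) ≤ᵇ toℕ t then (s , t) ∷ [] else []) (allFin d)) (allFin d)

swap : ∀ {d} → Transp d → Fin d → Fin d
swap (s , t) x = if eqF x s then t else (if eqF x t then s else x)

walkEnd : ∀ {d} → (Fin d → Fin d) → List (Transp d) → (Fin d → Fin d)
walkEnd ρ []       = ρ
walkEnd ρ (τ ∷ w)  = walkEnd (ρ ∘ swap τ) w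

walks : (d r : ℕ) → List (List (Transp d))
walks d zero    = [] ∷ []
walks d (suc r) = concatMap (λ τ → map (τ ∷_) (walks d r)) (allTransp d)

monotone : ∀ {d} → List (Transp d) → Bool
monotone []                 = true
monotone (τ ∷ [])           = true
monotone (τ ∷ (τ' ∷ w))     = (toℕ (proj₂ τ) ≤ᵇ toℕ (proj₂ τ')) ∧ monotone (τ' ∷ w)

-- transitivity: the orbit of every point under the subgroup generated by
-- a list of permutations is everything. For permutations of a finite set
-- the orbit of x is the closure of {x} under applying the generators; the
-- closure is reached after d closure steps.
closeStep : ∀ {d} → List (Fin d → Fin d) → (Fin d → Bool) → (Fin d → Bool)
closeStep {d} gs S y = S y ∨ any (λ g → any (λ x → S x ∧ eqF (g x) y) (allFin d)) gs

transitiveB : ∀ {d} → List (Fin d → Fin d) → Bool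
transitiveB {d} gs =
  all (λ x → all (λ y → iter d (closeStep gs) (eqF x) y) (allFin d)) (allFin d)

isTransitiveWalk : ∀ {d} → (Fin d → Fin d) → List (Transp d) → Bool
isTransitiveWalk ρ w = transitiveB (ρ ∷ walkEnd ρ w ∷ map swap w)

-- Σ_{α,β ⊢ d} H⃗_g(α,β): the number of pairs (ρ , walk) with the walk
-- monotone, transitive and of length r = r_g(α,β) = 2g-2+ℓ(α)+ℓ(β), where
-- α, β are the cycle types of ρ and of the endpoint σ.  (Since
-- ℓ ≤ d, such r is < 2g+2d; the condition r + 2 = 2g + ℓ(α) + ℓ(β) is the
-- exact integer equation r = r_g(α,β).)
sumH : (g d : ℕ) → ℕ
sumH g d = sum (map (λ ρ → sum (map (λ r →
    countB (λ w → monotone w ∧ isTransitiveWalk ρ w ∧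
                  ((r + 2) ≡ᵇ (2 * g + numCycles ρ + numCycles (walkEnd ρ w))))
           (walks d r))
    (upTo (2 * g + 2 * d)))) (perms d))

-- coefficient a_d of  F⃗_g(z) = Σ_{d ≥ 1} a_d z^d / d!   (a_0 = 0)
coeffF : ℕ → ℕ → ℕ
coeffF g zero    = 0
coeffF g (suc d) = sumH g (suc d)

-- Radius of convergence R of Σ_d (a d) z^d / d!  (a d ≥ 0), via
-- R = sup { s ≥ 0 : (a_d s^d / d!)_d is bounded }, tested on rationals
-- s = p / q.

RadiusAtLeast : (ℕ → ℕ) → ℕ → ℕ → Set
RadiusAtLeast a n m =
  ∀ (p q : ℕ) → 0 < q → p * m < n * q →
  ∃ λ (B : ℕ) → ∀ (d : ℕ) → a d * p ^ d ≤ B * (d !) * q ^ d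

RadiusAtMost : (ℕ → ℕ) → ℕ → ℕ → Set
RadiusAtMost a n m =
  ∀ (p q : ℕ) → 0 < q → n * q < p * m →
  ∀ (B : ℕ) → ∃ λ (d : ℕ) → B * (d !) * q ^ d < a d * p ^ d

{-# OPTIONS --safe #-}

-- Write the ends ρ and σ of a walk as products of transpositions with strictly increasing colours. The walk then closes
-- up to a loop at the identity with 2g - 2 + 2d steps, and Hurwitz moves (the Jucys-Murphy elements commute) sort the
-- steps by colour. At most 4^d walks lead to the same monotone loop, and conversely such loops are walks, so the
-- coefficients lie between the number of transitive monotone loops and 4^d times this number. It remains to see that
-- the loops have growth rate 27/2 for every g.
--
-- The walks from the identity are conjugation invariant, and removing the last step yields a cut-and-join recursion on
-- cycle types. In genus zero the cycle types (a, 1, ..., 1) are closed under it, and the quadratic method expresses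
-- their generating function by U = 1 + 2yU^3, which is singular at y = 2/27. A handle costs only a polynomial factor:
-- if two cycles of lengths a and b are merged, the genus zero count decreases by a factor of at most b times the number
-- of steps, because both sides satisfy a linearised recursion.

module Submission where

open import Data.Nat hiding (_≟_)
open import Data.Nat.Properties hiding (_≟_)
open import Algebra.Properties.CommutativeSemigroup +-commutativeSemigroup using ()
  renaming (x∙yz≈y∙xz to +-left-comm; interchange to +-interchange)
open import Algebra.Properties.CommutativeSemigroup *-commutativeSemigroup using ()
  renaming (x∙yz≈y∙xz to *-left-comm; interchange to *-interchange)
open import Data.Nat.Tactic.RingSolver using (solve-∀)
open import Data.List using (List; []; [_]; _++_; _∷_; _∷ʳ_; allFin; cartesianProductWith; concatMap; filter; filterᵇ; length; map; replicate; reverse; upTo)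
open import Data.Product using (_,_; _×_; map₁; map₂; proj₁; proj₂; Σ; ∃)
open import Data.List.Relation.Binary.Permutation.Propositional as ↭ using (_↭_; ↭-refl; ↭-sym; ↭-trans)
open import Function using (_∘_; id)
open import Relation.Binary.PropositionalEquality using (_≡_; _≢_; refl; sym; trans; cong; cong₂; subst; module ≡-Reasoning)
open import Relation.Nullary using (Dec; yes; no; does; ¬_; ¬?; _×-dec_; _⊎-dec_)
open import Data.List.Relation.Unary.All as All using (All; []; _∷_; all?)
open import Data.List.Relation.Unary.All.Properties using (++⁺; ++⁻ʳ; ++⁻ˡ; concat⁺; map⁺)
open import Data.List.Properties using (++-assoc; ++-identityʳ; concatMap-++; length-++; length-map; length-replicate; length-tabulate; reverse-involutive; unfold-reverse)
open import Data.Unit using (tt; ⊤)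
open import Defs
open import Data.Fin using (Fin; _≟_; fromℕ<; punchOut; toℕ)
open import Data.List.Membership.Propositional using (_∈_; _∉_)
open import Data.List.Relation.Unary.Any using (here; there)
open import Data.List.Relation.Unary.Unique.Propositional using (Unique; []; _∷_)
open import Data.List.Relation.Binary.Permutation.Propositional.Properties using (++-comm; ++-commutativeMonoid; ++⁺ʳ; ++⁺ˡ; All-resp-↭; shift; ↭-length; ↭-reverse; ∈-resp-↭)
open import Data.Sum using (_⊎_; inj₁; inj₂)
open import Data.Empty using (⊥; ⊥-elim)
open import Data.Bool using (Bool; _∧_; _∨_; false; if_then_else_; not; true)
open import Data.List.Membership.Propositional.Properties using (∈-++⁺ʳ; ∈-++⁺ˡ; ∈-++⁻; ∈-allFin; ∈-cartesianProductWith⁺; ∈-concat⁺′; ∈-concat⁻′; ∈-filter⁺; ∈-filter⁻; ∈-map⁺; ∈-map⁻; ∈-upTo⁺; ∈-∃++)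
open import Data.Maybe using (Maybe; just; nothing)
open import Data.Maybe.Properties using (just-injective)
open import Relation.Nullary.Decidable using (dec-false; dec-true; decidable-stable)
import Data.Nat as ℕ
open import Data.Nat.ListAction using (sum)
open import Data.Bool.ListAction using (all; any)
open import Data.Fin.Properties using (any?; injective⇒≤; punchOut-injective; toℕ-fromℕ<; toℕ-injective; toℕ<n)
import Data.List.Relation.Unary.Unique.Propositional.Properties as Unique
open import Relation.Binary.Definitions using (tri<; tri>; tri≈)
open import Data.Vec as Vec using (Vec; lookup; tabulate)
open import Data.Vec.Properties using (lookup∘tabulate; tabulate-cong; tabulate∘lookup) renaming (∷-injective to ∷-injectiveᵛ)
import Data.Bool as Bool
open import Data.Bool.Properties using (T?; ∨-zeroʳ)
import Algebra.Solver.CommutativeMonoid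
import Data.List.Membership.DecPropositional as DecMembership

-- The gap between the two bounds is exactly the cost of closing up: 54 = 4 * 27/2, with a factor
-- 2^d for each end of the walk. In terms of Jucys-Murphy elements, monotone words are the complete
-- symmetric functions h and strict words the elementary ones e, and the sum of all e_m h_(R-m) is
-- at most 2^d h_R coefficientwise. No group algebra is built. A Jucys-Murphy element acts as the
-- operator `step` on functions of words, and identities are claimed for functions invariant under
-- `≈`, which remembers both the end of a word and the components of its steps: the end alone does
-- not decide transitivity. Higher genus is not solved exactly, because a handle cuts (a, 1, ..., 1)
-- into two long cycles and so leaves the family that is closed in genus zero. Only bounds by the
-- genus zero counts are needed: from below by performing a step twice, from above by charging each
-- handle a polynomial in d. For fixed g the charges stay polynomial and do not move the radius. All
-- generating function identities live in ℕ, so negative terms are carried to the other side and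
-- cancelled.

private variable
  A B : Set
  d : ℕ

-- Sums and convolutions

^-distribʳ-* : ∀ n a b → (a * b) ^ n ≡ a ^ n * b ^ n
^-distribʳ-* zero    a b = refl
^-distribʳ-* (suc n) a b = trans (cong (a * b *_) (^-distribʳ-* n a b)) (*-interchange a b (a ^ n) (b ^ n))

∑ : List A → (A → ℕ) → ℕ
∑ []       f = 0
∑ (x ∷ xs) f = f x + ∑ xs f

∑-cong : ∀ (xs : List A) {f g : A → ℕ} → (∀ x → f x ≡ g x) → ∑ xs f ≡ ∑ xs g
∑-cong []       e = refl
∑-cong (x ∷ xs) e = cong₂ _+_ (e x) (∑-cong xs e)

∑-congᴬ : ∀ {xs : List A} {f g : A → ℕ} → All (λ x → f x ≡ g x) xs → ∑ xs f ≡ ∑ xs g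
∑-congᴬ []       = refl
∑-congᴬ (e ∷ es) = cong₂ _+_ e (∑-congᴬ es)

∑-mono : ∀ (xs : List A) {f g : A → ℕ} → (∀ x → f x ≤ g x) → ∑ xs f ≤ ∑ xs g
∑-mono []       e = z≤n
∑-mono (x ∷ xs) e = +-mono-≤ (e x) (∑-mono xs e)

∑-monoᴬ : ∀ {xs : List A} {f g : A → ℕ} → All (λ x → f x ≤ g x) xs → ∑ xs f ≤ ∑ xs g
∑-monoᴬ []       = z≤n
∑-monoᴬ (e ∷ es) = +-mono-≤ e (∑-monoᴬ es)

∑-zero : ∀ (xs : List A) → ∑ xs (λ _ → 0) ≡ 0
∑-zero []       = refl
∑-zero (x ∷ xs) = ∑-zero xs

∑-+ : ∀ (xs : List A) (f g : A → ℕ) → ∑ xs (λ x → f x + g x) ≡ ∑ xs f + ∑ xs g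
∑-+ []       f g = refl
∑-+ (x ∷ xs) f g = trans (cong (f x + g x +_) (∑-+ xs f g)) (+-interchange (f x) (g x) (∑ xs f) (∑ xs g))

∑-*ˡ : ∀ (xs : List A) c (f : A → ℕ) → ∑ xs (λ x → c * f x) ≡ c * ∑ xs f
∑-*ˡ []       c f = sym (*-zeroʳ c)
∑-*ˡ (x ∷ xs) c f rewrite ∑-*ˡ xs c f = sym (*-distribˡ-+ c (f x) (∑ xs f))

∑-*ʳ : ∀ (xs : List A) c (f : A → ℕ) → ∑ xs (λ x → f x * c) ≡ ∑ xs f * c
∑-*ʳ []       c f = refl
∑-*ʳ (x ∷ xs) c f rewrite ∑-*ʳ xs c f = sym (*-distribʳ-+ c (f x) (∑ xs f))

∑-++ : ∀ (xs ys : List A) (f : A → ℕ) → ∑ (xs ++ ys) f ≡ ∑ xs f + ∑ ys f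
∑-++ []       ys f = refl
∑-++ (x ∷ xs) ys f rewrite ∑-++ xs ys f = sym (+-assoc (f x) (∑ xs f) (∑ ys f))

∑-map : ∀ (h : A → B) xs (f : B → ℕ) → ∑ (map h xs) f ≡ ∑ xs (f ∘ h)
∑-map h []       f = refl
∑-map h (x ∷ xs) f = cong (f (h x) +_) (∑-map h xs f)

∑-concatMap : ∀ (h : A → List B) xs (f : B → ℕ) → ∑ (concatMap h xs) f ≡ ∑ xs (λ x → ∑ (h x) f)
∑-concatMap h []       f = refl
∑-concatMap h (x ∷ xs) f rewrite ∑-++ (h x) (concatMap h xs) f = cong (∑ (h x) f +_) (∑-concatMap h xs f)

∑-swap : ∀ (xs : List A) (ys : List B) (f : A → B → ℕ) →
         ∑ xs (λ x → ∑ ys (f x)) ≡ ∑ ys (λ y → ∑ xs (λ x → f x y))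
∑-swap []       ys f = sym (∑-zero ys)
∑-swap (x ∷ xs) ys f rewrite ∑-swap xs ys f = sym (∑-+ ys (f x) (λ y → ∑ xs (λ x → f x y)))

∑-↭ : ∀ {xs ys : List A} → xs ↭ ys → (f : A → ℕ) → ∑ xs f ≡ ∑ ys f
∑-↭ ↭.refl        f = refl
∑-↭ (↭.prep x p)    f = cong (f x +_) (∑-↭ p f)
∑-↭ (↭.swap {xs} {ys} x y p)  f rewrite ∑-↭ p f = +-left-comm (f x) (f y) (∑ ys f)
∑-↭ (↭.trans p q) f = trans (∑-↭ p f) (∑-↭ q f)

conv : ℕ → (ℕ → ℕ → ℕ) → ℕ
conv zero    Φ = Φ 0 0
conv (suc n) Φ = Φ 0 (suc n) + conv n (λ i j → Φ (suc i) j)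

conv-congᴺ : ∀ n {Φ Ψ : ℕ → ℕ → ℕ} → (∀ i j → i + j ≡ n → Φ i j ≡ Ψ i j) → conv n Φ ≡ conv n Ψ
conv-congᴺ zero    e = e 0 0 refl
conv-congᴺ (suc n) e = cong₂ _+_ (e 0 (suc n) refl) (conv-congᴺ n (λ i j p → e (suc i) j (cong suc p)))

conv-cong : ∀ n {Φ Ψ : ℕ → ℕ → ℕ} → (∀ i j → Φ i j ≡ Ψ i j) → conv n Φ ≡ conv n Ψ
conv-cong n e = conv-congᴺ n (λ i j _ → e i j)

conv-monoᴺ : ∀ n {Φ Ψ : ℕ → ℕ → ℕ} → (∀ i j → i + j ≡ n → Φ i j ≤ Ψ i j) → conv n Φ ≤ conv n Ψ
conv-monoᴺ zero    e = e 0 0 refl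
conv-monoᴺ (suc n) e = +-mono-≤ (e 0 (suc n) refl) (conv-monoᴺ n (λ i j p → e (suc i) j (cong suc p)))

conv-mono : ∀ n {Φ Ψ : ℕ → ℕ → ℕ} → (∀ i j → Φ i j ≤ Ψ i j) → conv n Φ ≤ conv n Ψ
conv-mono n e = conv-monoᴺ n (λ i j _ → e i j)

conv-+ : ∀ n (Φ Ψ : ℕ → ℕ → ℕ) → conv n (λ i j → Φ i j + Ψ i j) ≡ conv n Φ + conv n Ψ
conv-+ zero    Φ Ψ = refl
conv-+ (suc n) Φ Ψ = trans (cong (Φ 0 (suc n) + Ψ 0 (suc n) +_) (conv-+ n (λ i → Φ (suc i)) (λ i → Ψ (suc i))))
                      (+-interchange (Φ 0 (suc n)) _ _ _)

conv-*ˡ : ∀ n c (Φ : ℕ → ℕ → ℕ) → conv n (λ i j → c * Φ i j) ≡ c * conv n Φ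
conv-*ˡ zero    c Φ = refl
conv-*ˡ (suc n) c Φ rewrite conv-*ˡ n c (λ i → Φ (suc i)) = sym (*-distribˡ-+ c (Φ 0 (suc n)) _)

conv-*ʳ : ∀ n c (Φ : ℕ → ℕ → ℕ) → conv n (λ i j → Φ i j * c) ≡ conv n Φ * c
conv-*ʳ n c Φ = trans (conv-cong n (λ i j → *-comm (Φ i j) c)) (trans (conv-*ˡ n c Φ) (*-comm c _))

conv-zero : ∀ n → conv n (λ _ _ → 0) ≡ 0
conv-zero zero    = refl
conv-zero (suc n) = conv-zero n

conv-last : ∀ n (Φ : ℕ → ℕ → ℕ) → conv (suc n) Φ ≡ conv n (λ i j → Φ i (suc j)) + Φ (suc n) 0
conv-last zero    Φ = refl
conv-last (suc n) Φ = trans (cong (Φ 0 (suc (suc n)) +_) (conv-last n (λ i → Φ (suc i)))) (sym (+-assoc (Φ 0 (suc (suc n))) _ _))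

conv-comm : ∀ n (Φ : ℕ → ℕ → ℕ) → conv n Φ ≡ conv n (λ i j → Φ j i)
conv-comm zero    Φ = refl
conv-comm (suc n) Φ = trans (conv-last n Φ) (trans (+-comm _ (Φ (suc n) 0)) (cong (Φ (suc n) 0 +_) (conv-comm n (λ i j → Φ i (suc j)))))

conv-term : ∀ i j (Φ : ℕ → ℕ → ℕ) → Φ i j ≤ conv (i + j) Φ
conv-term zero    zero    Φ = ≤-refl
conv-term zero    (suc j) Φ = m≤m+n _ _
conv-term (suc i) j       Φ = ≤-trans (conv-term i j (λ i → Φ (suc i))) (m≤n+m _ _)

⟦_⟧ : ∀ {P : Set} → Dec P → ℕ
⟦ yes _ ⟧ = 1
⟦ no _ ⟧  = 0

⟦⟧-yes : ∀ {P : Set} (d : Dec P) → P → ⟦ d ⟧ ≡ 1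
⟦⟧-yes (yes _) p = refl
⟦⟧-yes (no ¬p) p with () ← ¬p p

⟦⟧-no : ∀ {P : Set} (d : Dec P) → ¬ P → ⟦ d ⟧ ≡ 0
⟦⟧-no (yes p) ¬p with () ← ¬p p
⟦⟧-no (no _)  ¬p = refl

⟦⟧-cong : ∀ {P Q : Set} (d : Dec P) (e : Dec Q) → (P → Q) → (Q → P) → ⟦ d ⟧ ≡ ⟦ e ⟧
⟦⟧-cong (yes p) e f g = sym (⟦⟧-yes e (f p))
⟦⟧-cong (no ¬p) e f g = sym (⟦⟧-no e (¬p ∘ g))

⟦⟧-× : ∀ {P Q : Set} (d : Dec P) (e : Dec Q) → ⟦ d ×-dec e ⟧ ≡ ⟦ d ⟧ * ⟦ e ⟧
⟦⟧-× (yes p) (yes q) = refl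
⟦⟧-× (yes p) (no _)  = refl
⟦⟧-× (no _)  e       = refl

splits : List A → List (List A × List A)
splits []       = ([] , []) ∷ []
splits (x ∷ xs) = map (map₁ (x ∷_)) (splits xs) ++ map (map₂ (x ∷_)) (splits xs)

∑splits-∷ : ∀ (x : A) xs (f : List A × List A → ℕ) →
            ∑ (splits (x ∷ xs)) f ≡ ∑ (splits xs) (f ∘ map₁ (x ∷_)) + ∑ (splits xs) (f ∘ map₂ (x ∷_))
∑splits-∷ x xs f = trans (∑-++ (map (map₁ (x ∷_)) (splits xs)) _ f) (cong₂ _+_ (∑-map _ (splits xs) f) (∑-map _ (splits xs) f))

picks : List A → List (A × List A)
picks []       = []
picks (x ∷ xs) = (x , xs) ∷ map (map₂ (x ∷_)) (picks xs)

∑picks-∷ : ∀ (x : A) xs (f : A × List A → ℕ) → ∑ (picks (x ∷ xs)) f ≡ f (x , xs) + ∑ (picks xs) (f ∘ map₂ (x ∷_))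
∑picks-∷ x xs f = cong (f (x , xs) +_) (∑-map _ (picks xs) f)

∑splits-map : ∀ (h : A → B) xs (f : List B × List B → ℕ) →
              ∑ (splits (map h xs)) f ≡ ∑ (splits xs) (λ (B , C) → f (map h B , map h C))
∑splits-map h []       f = refl
∑splits-map h (x ∷ xs) f rewrite ∑splits-∷ (h x) (map h xs) f | ∑splits-∷ x xs (λ (B , C) → f (map h B , map h C))
  = cong₂ _+_ (∑splits-map h xs _) (∑splits-map h xs _)

∑picks-map : ∀ (h : A → B) xs (f : B × List B → ℕ) →
             ∑ (picks (map h xs)) f ≡ ∑ (picks xs) (λ (B , C) → f (h B , map h C))
∑picks-map h []       f = refl
∑picks-map h (x ∷ xs) f rewrite ∑picks-∷ (h x) (map h xs) f | ∑picks-∷ x xs (λ (B , C) → f (h B , map h C))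
  = cong (f (h x , map h xs) +_) (∑picks-map h xs _)

∑-const : ∀ (xs : List A) c → ∑ xs (λ _ → c) ≡ length xs * c
∑-const []       c = refl
∑-const (x ∷ xs) c = cong (c +_) (∑-const xs c)

-- The cut-and-join recursion

conv-shiftˡ : ∀ m n (Φ : ℕ → ℕ → ℕ) → conv n (λ i j → Φ (m + i) j) ≤ conv (m + n) Φ
conv-shiftˡ zero    n Φ = ≤-refl
conv-shiftˡ (suc m) n Φ = ≤-trans (conv-shiftˡ m n (λ i → Φ (suc i))) (m≤n+m _ _)

conv-shiftʳ : ∀ m n (Φ : ℕ → ℕ → ℕ) → conv n (λ i j → Φ i (m + j)) ≤ conv (m + n) Φ
conv-shiftʳ m n Φ = begin
  conv n (λ i j → Φ i (m + j))   ≡⟨ conv-comm n _ ⟩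
  conv n (λ i j → Φ j (m + i))   ≤⟨ conv-shiftˡ m n (λ i j → Φ j i) ⟩
  conv (m + n) (λ i j → Φ j i)   ≡⟨ conv-comm (m + n) Φ ⟨
  conv (m + n) Φ                 ∎
  where open ≤-Reasoning

conv-const : ∀ n c → conv n (λ _ _ → c) ≡ suc n * c
conv-const zero    c = sym (+-identityʳ c)
conv-const (suc n) c = cong (c +_) (conv-const n c)

splits-∑ : ∀ (g : A → ℕ) xs → All (λ (B , C) → ∑ B g + ∑ C g ≡ ∑ xs g) (splits xs)
splits-∑ g []       = refl ∷ []
splits-∑ g (x ∷ xs) = ++⁺
  (map⁺ (All.map (λ {p} e → trans (+-assoc (g x) (∑ (proj₁ p) g) _) (cong (g x +_) e)) (splits-∑ g xs)))
  (map⁺ (All.map (λ {p} e → trans (+-left-comm (∑ (proj₁ p) g) (g x) _) (cong (g x +_) e)) (splits-∑ g xs)))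

picks-∑ : ∀ (g : A → ℕ) xs → All (λ (B , C) → g B + ∑ C g ≡ ∑ xs g) (picks xs)
picks-∑ g []       = []
picks-∑ g (x ∷ xs) = refl ∷ map⁺ (All.map (λ {p} e → trans (+-left-comm (g (proj₁ p)) (g x) _) (cong (g x +_) e)) (picks-∑ g xs))

-- With cycle lengths stored minus one, cutting a cycle into two means i + j = a - 1; a fixed point
-- (a = 0) cannot be cut.
cut : ℕ → (ℕ → ℕ → ℕ) → ℕ
cut zero    Φ = 0
cut (suc a) Φ = conv a Φ

base : ℕ → List ℕ → ℕ
base zero [] = 1
base _    _  = 0

-- Cycle lengths are stored minus one: Hf n r a A counts (when r < n) the connected monotone
-- r-step walks from the identity to a permutation with cycle lengths a + 1 and b + 1 for b in A.
-- The fuel n only serves the termination checker.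
Hf : ℕ → ℕ → ℕ → List ℕ → ℕ
Hf zero    r       a A = 0
Hf (suc n) zero    a A = base a A
Hf (suc n) (suc r) a A =
    -- The last step is (s x) with x in the first cycle. If s lies in the same cycle, removing the
    -- step cuts that cycle, and the shorter walk is either still connected or falls into two
    -- components that share the remaining cycles and steps. If s lies in another cycle, of length b
    -- + 1, there are b + 1 choices of s and the two cycles are joined.
    cut a (λ i j → Hf n r i (j ∷ A)
                   + ∑ (splits A) (λ (B , C) → conv r (λ r₁ r₂ → Hf n r₁ i B * Hf n r₂ j C)))
  + ∑ (picks A) (λ (b , C) → suc b * Hf n r (suc (a + b)) C)

-- Genus zero: the handle term Hf n r i (j ∷ A) is dropped.
Xf : ℕ → ℕ → List ℕ → ℕ
Xf zero    a A = 0
Xf (suc n) a A =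
  base a A + (cut a (λ i j → ∑ (splits A) (λ (B , C) → Xf n i B * Xf n j C))
              + ∑ (picks A) (λ (b , C) → suc b * Xf n (suc (a + b)) C))

-- The number of steps of a genus zero walk.
wt : ℕ → List ℕ → ℕ
wt a A = a + ∑ A (2 +_)

cut-cong : ∀ a {Φ Ψ : ℕ → ℕ → ℕ} → (∀ i j → suc (i + j) ≡ a → Φ i j ≡ Ψ i j) → cut a Φ ≡ cut a Ψ
cut-cong zero    e = refl
cut-cong (suc a) e = conv-congᴺ a (λ i j p → e i j (cong suc p))

-- In genus zero a cut and a join (`wt-picks`) each account for exactly one step, so `wt` drops by
-- one and serves as the recursion measure.
wt-splits : ∀ i j {a} A → suc (i + j) ≡ a →
            All (λ (B , C) → suc (wt i B + wt j C) ≡ wt a A) (splits A)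
wt-splits i j A refl = All.map
  (λ {p} e → cong suc (trans (+-interchange i (∑ (proj₁ p) (2 +_)) j _) (cong ((i + j) +_) e))) (splits-∑ (2 +_) A)

wt-picks : ∀ a A → All (λ (B , C) → suc (wt (suc (a + B)) C) ≡ wt a A) (picks A)
wt-picks a A = All.map (λ {p} e → trans (lem a (proj₁ p) _) (cong (a +_) e)) (picks-∑ (2 +_) A)
  where
  lem : ∀ a b s → suc (suc (a + b) + s) ≡ a + (2 + b + s)
  lem = solve-∀

Xf-stable : ∀ n m a A → wt a A < n → wt a A < m → Xf n a A ≡ Xf m a A
Xf-stable (suc n) (suc m) a A (s≤s p) (s≤s q) = cong (base a A +_) (cong₂ _+_
  (cut-cong a (λ i j e → ∑-congᴬ (All.map (λ {x} s → cong₂ _*_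
     (Xf-stable n m i (proj₁ x) (left s p) (left s q))
     (Xf-stable n m j (proj₂ x) (right (wt i (proj₁ x)) s p) (right (wt i (proj₁ x)) s q))) (wt-splits i j A e))))
  (∑-congᴬ (All.map (λ {x} s → cong (suc (proj₁ x) *_)
     (Xf-stable n m _ _ (≤-trans (≤-reflexive s) p) (≤-trans (≤-reflexive s) q))) (wt-picks a A))))
  where
  left : ∀ {u v t n} → suc (u + v) ≡ t → t ≤ n → u < n
  left {u} {v} refl p = ≤-trans (s≤s (m≤m+n u v)) p
  right : ∀ u {v t n} → suc (u + v) ≡ t → t ≤ n → v < n
  right u {v} refl p = ≤-trans (s≤s (m≤n+m v u)) p

abstract
  X : ℕ → List ℕ → ℕ
  X a A = Xf (suc (wt a A)) a A

cutX : ℕ → List ℕ → ℕ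
cutX a A = cut a (λ i j → ∑ (splits A) (λ (B , C) → X i B * X j C))

joinX : ℕ → List ℕ → ℕ
joinX a A = ∑ (picks A) (λ (b , C) → suc b * X (suc (a + b)) C)

abstract
  X-unfold : ∀ a A → X a A ≡ base a A + (cutX a A + joinX a A)
  X-unfold a A = cong (base a A +_) (cong₂ _+_
    (cut-cong a (λ i j e → ∑-congᴬ (All.map (λ {x} s → cong₂ _*_
       (Xf-stable _ _ i (proj₁ x) (subst (wt i (proj₁ x) <_) s (s≤s (m≤m+n (wt i (proj₁ x)) _))) ≤-refl)
       (Xf-stable _ _ j (proj₂ x) (subst (wt j (proj₂ x) <_) s (s≤s (m≤n+m (wt j (proj₂ x)) (wt i (proj₁ x))))) ≤-refl)) (wt-splits i j A e))))
    (∑-congᴬ (All.map (λ {x} s → cong (suc (proj₁ x) *_)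
       (Xf-stable _ _ _ (proj₂ x) (≤-reflexive s) ≤-refl)) (wt-picks a A))))

-- wt * X satisfies the recursion of X linearised at X, with the extra source X: weights add up along a cut
-- and drop by one.
wtX-expand : ∀ a A → wt (suc a) A * X (suc a) A ≡
    X (suc a) A
  + ((conv a (λ i j → ∑ (splits A) (λ (B , C) → (wt i B * X i B) * X j C))
    + conv a (λ i j → ∑ (splits A) (λ (B , C) → X i B * (wt j C * X j C))))
  + ∑ (picks A) (λ (b , C) → suc b * (wt (suc (suc a + b)) C * X (suc (suc a + b)) C)))
wtX-expand a A = cong (X (suc a) A +_) (begin
  w * X (suc a) A                                  ≡⟨ cong (w *_) (X-unfold (suc a) A) ⟩
  w * (cutX (suc a) A + joinX (suc a) A)           ≡⟨ *-distribˡ-+ w (cutX (suc a) A) _ ⟩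
  w * cutX (suc a) A + w * joinX (suc a) A         ≡⟨ cong₂ _+_ cutpart joinpart ⟩
  _ ∎)
  where
  open ≡-Reasoning
  w = wt a A
  distr : ∀ u v x y → (u + v) * (x * y) ≡ (u * x) * y + x * (v * y)
  distr = solve-∀
  cutpart = begin
    w * cutX (suc a) A ≡⟨ conv-*ˡ a w _ ⟨
    conv a (λ i j → w * ∑ (splits A) (λ (B , C) → X i B * X j C))
      ≡⟨ conv-congᴺ a (λ i j e → trans (sym (∑-*ˡ (splits A) w _)) (trans
          (∑-congᴬ (All.map (λ {x} s → trans (cong (_* (X i (proj₁ x) * X j (proj₂ x))) (sym (suc-injective s)))
             (distr (wt i (proj₁ x)) (wt j (proj₂ x)) (X i (proj₁ x)) (X j (proj₂ x)))) (wt-splits i j A (cong suc e))))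
          (∑-+ (splits A) _ _))) ⟩
    conv a (λ i j → ∑ (splits A) (λ (B , C) → (wt i B * X i B) * X j C)
                  + ∑ (splits A) (λ (B , C) → X i B * (wt j C * X j C)))
      ≡⟨ conv-+ a _ _ ⟩
    _ ∎
  joinpart = trans (sym (∑-*ˡ (picks A) w _)) (∑-congᴬ (All.map
    (λ {x} s → trans (cong (_* (suc (proj₁ x) * X (suc (suc a + proj₁ x)) (proj₂ x))) (sym (suc-injective s)))
       (*-left-comm (wt (suc (suc a + proj₁ x)) (proj₂ x)) (suc (proj₁ x)) (X (suc (suc a + proj₁ x)) (proj₂ x)))) (wt-picks (suc a) A)))

-- A piece left by a cut or join still weighs less than the whole after the cycle b, of weight 2 +
-- b, is attached to it. For a join there is no second piece and v is 0.
merge-wt : ∀ n b a S i s v → suc (i + s + v) ≡ a + S → a + (2 + b + S) ≤ suc n → i + (2 + b + s) ≤ n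
merge-wt n b a S i s v e p = s≤s⁻¹ (begin
  suc (i + (2 + b + s))                 ≤⟨ m≤m+n _ v ⟩
  suc (i + (2 + b + s)) + v             ≡⟨ lem₁ i b s v ⟩
  (2 + b) + suc (i + s + v)             ≡⟨ cong (2 + b +_) e ⟩
  (2 + b) + (a + S)                     ≡⟨ lem₂ b a S ⟩
  a + (2 + b + S)                       ≤⟨ p ⟩
  suc n                                 ∎)
  where
  open ≤-Reasoning
  lem₁ : ∀ i b s v → suc (i + (2 + b + s)) + v ≡ (2 + b) + suc (i + s + v)
  lem₁ = solve-∀
  lem₂ : ∀ b a S → (2 + b) + (a + S) ≡ a + (2 + b + S)
  lem₂ = solve-∀

-- Both sides satisfy the recursion of X linearised at X. Joining b to a is the source on the left, and the source
-- suc b * X (suc (a + b)) A on the right pays for it.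
X-merge-fuel : ∀ n a b A → wt a (b ∷ A) ≤ n → X a (b ∷ A) ≤ suc b * (wt (suc (a + b)) A * X (suc (a + b)) A)
X-merge-fuel zero a b A p with () ← subst (_≤ 0) (+-comm a _) p
X-merge-fuel (suc n) a b A p = begin
  X a (b ∷ A)                                    ≡⟨ X-unfold a (b ∷ A) ⟩
  base a (b ∷ A) + (cutX a (b ∷ A) + joinX a (b ∷ A)) ≡⟨ cong (_+ (cutX a (b ∷ A) + joinX a (b ∷ A))) (base0 a) ⟩
  cutX a (b ∷ A) + joinX a (b ∷ A)               ≤⟨ +-mono-≤ (cut-bound a p) join-bound ⟩
  suc b * (L + R) + (suc b * Xe + suc b * J)     ≡⟨ rearrange (suc b) (L + R) Xe J ⟩
  suc b * (Xe + ((L + R) + J))                   ≡⟨ cong (suc b *_) (wtX-expand (a + b) A) ⟨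
  suc b * (wt (suc (a + b)) A * X (suc (a + b)) A) ∎
  where
  open ≤-Reasoning
  base0 : ∀ a → base a (b ∷ A) ≡ 0
  base0 zero    = refl
  base0 (suc a) = refl
  FL FR : ℕ → ℕ → ℕ
  FL i j = ∑ (splits A) (λ (B , C) → (wt i B * X i B) * X j C)
  FR i j = ∑ (splits A) (λ (B , C) → X i B * (wt j C * X j C))
  L = conv (a + b) FL
  R = conv (a + b) FR
  Xe = X (suc (a + b)) A
  J = ∑ (picks A) (λ (b′ , C′) → suc b′ * (wt (suc (suc (a + b) + b′)) C′ * X (suc (suc (a + b) + b′)) C′))
  rearrange : ∀ s u x j → s * u + (s * x + s * j) ≡ s * (x + (u + j))
  rearrange = solve-∀
  index : ∀ i → suc (i + b) ≡ suc b + i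
  index i = cong suc (+-comm i b)
  cut-bound : ∀ a′ → wt a′ (b ∷ A) ≤ suc n → cutX a′ (b ∷ A) ≤
    suc b * (conv (a′ + b) FL
           + conv (a′ + b) FR)
  cut-bound zero     _ = z≤n
  cut-bound (suc a′) p′ = begin
    conv a′ (λ i j → ∑ (splits (b ∷ A)) (λ (B , C) → X i B * X j C))
      ≡⟨ conv-cong a′ (λ i j → ∑splits-∷ b A _) ⟩
    conv a′ (λ i j → ∑ (splits A) (λ (B , C) → X i (b ∷ B) * X j C)
                   + ∑ (splits A) (λ (B , C) → X i B * X j (b ∷ C)))
      ≡⟨ conv-+ a′ _ _ ⟩
    conv a′ (λ i j → ∑ (splits A) (λ (B , C) → X i (b ∷ B) * X j C))
    + conv a′ (λ i j → ∑ (splits A) (λ (B , C) → X i B * X j (b ∷ C)))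
      ≤⟨ +-mono-≤
        (conv-monoᴺ a′ (λ i j e → ≤-trans (∑-monoᴬ (All.map (λ {x} s → ≤-trans
            (*-monoˡ-≤ (X j (proj₂ x)) (X-merge-fuel n i b (proj₁ x) (merge-wt n b (suc a′) (∑ A (2 +_)) i (∑ (proj₁ x) (2 +_)) (wt j (proj₂ x)) s p′)))
            (≤-reflexive (*-assoc (suc b) (wt (suc (i + b)) (proj₁ x) * X (suc (i + b)) (proj₁ x)) (X j (proj₂ x))))) (wt-splits i j A (cong suc e))))
          (≤-reflexive (trans (∑-*ˡ (splits A) (suc b) _) (cong (suc b *_) (Lcong i j))))))
        (conv-monoᴺ a′ (λ i j e → ≤-trans (∑-monoᴬ (All.map (λ {x} s → ≤-trans
            (*-monoʳ-≤ (X i (proj₁ x)) (X-merge-fuel n j b (proj₂ x) (merge-wt n b (suc a′) (∑ A (2 +_)) j (∑ (proj₂ x) (2 +_)) (wt i (proj₁ x)) (trans (cong suc (+-comm (wt j (proj₂ x)) (wt i (proj₁ x)))) s) p′)))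
            (≤-reflexive (*-left-comm (X i (proj₁ x)) (suc b) (wt (suc (j + b)) (proj₂ x) * X (suc (j + b)) (proj₂ x))))) (wt-splits i j A (cong suc e))))
          (≤-reflexive (trans (∑-*ˡ (splits A) (suc b) _) (cong (suc b *_) (Rcong i j)))))) ⟩
    conv a′ (λ i j → suc b * FL (suc b + i) j)
    + conv a′ (λ i j → suc b * FR i (suc b + j))
      ≡⟨ cong₂ _+_ (conv-*ˡ a′ (suc b) _) (conv-*ˡ a′ (suc b) _) ⟩
    suc b * conv a′ (λ i j → FL (suc b + i) j)
    + suc b * conv a′ (λ i j → FR i (suc b + j))
      -- Merging b into a piece raises its index by `suc b`, so the merged cuts are those terms of
      -- the longer convolution whose raised index is at least `suc b`.
      ≤⟨ +-mono-≤ (*-monoʳ-≤ (suc b) (conv-shiftˡ (suc b) a′ FL)) (*-monoʳ-≤ (suc b) (conv-shiftʳ (suc b) a′ FR)) ⟩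
    suc b * conv (suc b + a′) FL
    + suc b * conv (suc b + a′) FR
      ≡⟨ *-distribˡ-+ (suc b) (conv (suc b + a′) FL) (conv (suc b + a′) FR) ⟨
    suc b * (conv (suc b + a′) FL + conv (suc b + a′) FR)
      ≡⟨ cong (λ z → suc b * (conv z FL + conv z FR)) (cong suc (+-comm b a′)) ⟩
    suc b * (conv (suc a′ + b) FL + conv (suc a′ + b) FR) ∎
    where
    Lcong : ∀ i j → FL (suc (i + b)) j ≡ FL (suc b + i) j
    Lcong i j = cong (λ z → FL z j) (index i)
    Rcong : ∀ i j → FR i (suc (j + b)) ≡ FR i (suc b + j)
    Rcong i j = cong (FR i) (index j)
  join-bound : joinX a (b ∷ A) ≤ suc b * Xe + suc b * J
  join-bound = begin
    joinX a (b ∷ A) ≡⟨ ∑picks-∷ b A _ ⟩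
    suc b * Xe + ∑ (picks A) (λ (b′ , C′) → suc b′ * X (suc (a + b′)) (b ∷ C′))
      ≤⟨ +-monoʳ-≤ (suc b * Xe) (∑-monoᴬ (All.map (λ {x} s → ≤-trans
           (*-monoʳ-≤ (suc (proj₁ x)) (X-merge-fuel n (suc (a + proj₁ x)) b (proj₂ x) (merge-wt n b a (∑ A (2 +_)) (suc (a + proj₁ x)) (∑ (proj₂ x) (2 +_)) 0 (trans (cong suc (+-identityʳ _)) s) p)))
           (≤-reflexive (trans (*-left-comm (suc (proj₁ x)) (suc b) _) (cong (suc b *_) (cong (λ z → suc (proj₁ x) * (wt z (proj₂ x) * X z (proj₂ x))) (ix (proj₁ x)))))))
           (wt-picks a A))) ⟩
    suc b * Xe + ∑ (picks A) (λ (b′ , C′) → suc b * (suc b′ * (wt (suc (suc (a + b) + b′)) C′ * X (suc (suc (a + b) + b′)) C′)))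
      ≡⟨ cong (suc b * Xe +_) (∑-*ˡ (picks A) (suc b) _) ⟩
    suc b * Xe + suc b * J ∎
    where
    ix₀ : ∀ a b c → suc (suc (a + c) + b) ≡ suc (suc (a + b) + c)
    ix₀ = solve-∀
    ix : ∀ c → suc (suc (a + c) + b) ≡ suc (suc (a + b) + c)
    ix = ix₀ a b

X-merge : ∀ a b A → X a (b ∷ A) ≤ suc b * (wt (suc (a + b)) A * X (suc (a + b)) A)
X-merge a b A = X-merge-fuel _ a b A ≤-refl

-- The cost of a handle

size : ℕ → List ℕ → ℕ
size a A = suc a + ∑ A suc

wt≤2size : ∀ a A → wt a A ≤ 2 * size a A
wt≤2size a A = begin
  a + ∑ A (2 +_)          ≤⟨ +-mono-≤ (≤-trans (n≤1+n a) (m≤n+m (suc a) (suc a + 0))) (∑-mono A (λ b → ≤-trans (s≤s (s≤s (m≤m+n b b))) (≤-reflexive (lem b)))) ⟩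
  ((suc a + 0) + suc a) + ∑ A (λ b → 2 * suc b) ≡⟨ cong₂ _+_ (+-comm (suc a + 0) (suc a)) (∑-*ˡ A 2 suc) ⟩
  2 * suc a + 2 * ∑ A suc  ≡⟨ *-distribˡ-+ 2 (suc a) _ ⟨
  2 * size a A ∎
  where
  open ≤-Reasoning
  lem : ∀ b → suc (suc (b + b)) ≡ 2 * suc b
  lem = solve-∀

-- Merging the two pieces of any cut gives back the cycle that was cut. By `X-merge` this costs a
-- factor j + 1 ≤ D and a weight of at most 2D, and there are a + 1 ≤ D cuts.
handle-bound : ∀ D a A → size (suc a) A ≤ D → conv a (λ i j → X i (j ∷ A)) ≤ (D * (D * (2 * D))) * X (suc a) A
handle-bound D a A p = begin
  conv a (λ i j → X i (j ∷ A))  ≤⟨ conv-monoᴺ a (λ i j e → ≤-trans (X-merge i j A)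
       (≤-trans (≤-reflexive (cong (λ z → suc j * (wt (suc z) A * X (suc z) A)) e))
        (*-mono-≤ (≤-trans (s≤s (≤-trans (m≤n+m j i) (≤-reflexive e))) a≤D)
           (*-monoˡ-≤ (X (suc a) A) (≤-trans (wt≤2size (suc a) A) (*-monoʳ-≤ 2 p)))))) ⟩
  conv a (λ _ _ → D * ((2 * D) * X (suc a) A)) ≡⟨ conv-const a _ ⟩
  suc a * (D * ((2 * D) * X (suc a) A)) ≤⟨ *-monoˡ-≤ (D * ((2 * D) * X (suc a) A)) a≤D ⟩
  D * (D * ((2 * D) * X (suc a) A)) ≡⟨ lem D (X (suc a) A) ⟩
  (D * (D * (2 * D))) * X (suc a) A ∎
  where
  open ≤-Reasoning
  a≤D : suc a ≤ D
  a≤D = ≤-trans (≤-trans (n≤1+n (suc a)) (m≤m+n (suc (suc a)) _)) p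
  lem : ∀ D x → D * (D * ((2 * D) * x)) ≡ (D * (D * (2 * D))) * x
  lem = solve-∀

-- Lattice paths from height w to 0 with r unit steps, up-steps having weight P.
φ : ℕ → ℕ → ℕ → ℕ
φ P zero    zero    = 1
φ P zero    (suc w) = 0
φ P (suc r) zero    = 0
φ P (suc r) (suc w) = φ P r w + P * φ P r (suc (suc w))

-- The paths stop on reaching 0, so a path from u + v splits uniquely at its first visit to height
-- v.
φ-conv : ∀ P r u v → conv r (λ r₁ r₂ → φ P r₁ u * φ P r₂ v) ≡ φ P r (u + v)
φ-conv P zero    zero    v = *-identityˡ _
φ-conv P zero    (suc u) v = refl
φ-conv P (suc r) zero    v = trans (cong₂ _+_ (*-identityˡ _) (conv-zero r)) (+-identityʳ _)
φ-conv P (suc r) (suc u) v = begin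
  conv r (λ r₁ r₂ → (φ P r₁ u + P * φ P r₁ (2 + u)) * φ P r₂ v)
    ≡⟨ conv-cong r (λ r₁ r₂ → distr (φ P r₁ u) P (φ P r₁ (2 + u)) (φ P r₂ v)) ⟩
  conv r (λ r₁ r₂ → φ P r₁ u * φ P r₂ v + P * (φ P r₁ (2 + u) * φ P r₂ v))
    ≡⟨ conv-+ r _ _ ⟩
  conv r (λ r₁ r₂ → φ P r₁ u * φ P r₂ v) + conv r (λ r₁ r₂ → P * (φ P r₁ (2 + u) * φ P r₂ v))
    ≡⟨ cong₂ _+_ (φ-conv P r u v) (trans (conv-*ˡ r P _) (cong (P *_) (φ-conv P r (2 + u) v))) ⟩
  φ P r (u + v) + P * φ P r (2 + (u + v)) ∎
  where
  open ≡-Reasoning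
  distr : ∀ a P b c → (a + P * b) * c ≡ a * c + P * (b * c)
  distr = solve-∀

-- A path with 2g surplus steps has g up-steps, which leaves polynomially many paths for fixed g.
-- With t = w + g + 2, the induction closes since (t - 1)^(g+1) + t^g ≤ t^(g+1).
φ-bound : ∀ P g w → φ P (g + g + w) w ≤ P ^ g * (w + g) ^ g
φ-bound P zero    zero    = ≤-refl
φ-bound P zero    (suc w) = begin
  φ P w w + P * φ P w (2 + w) ≡⟨ cong (λ z → φ P w w + P * z) (vanish w 1) ⟩
  φ P w w + P * 0             ≡⟨ trans (cong (φ P w w +_) (*-zeroʳ P)) (+-identityʳ _) ⟩
  φ P w w                     ≤⟨ φ-bound P zero w ⟩
  1 ∎
  where
  open ≤-Reasoning
  vanish : ∀ r k → φ P r (suc k + r) ≡ 0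
  vanish zero    k = cong (φ P 0) (+-identityʳ (suc k))
  vanish (suc r) k rewrite +-suc k r = trans (cong₂ _+_ (vanish r k) (trans (cong (P *_) (vanish r (2 + k))) (*-zeroʳ P))) refl
φ-bound P (suc g) zero    = z≤n
φ-bound P (suc g) (suc w) = begin
  φ P (suc g + suc g + suc w) (suc w)    ≡⟨ cong (λ z → φ P z (suc w)) (ix₀ g w) ⟩
  φ P (suc g + suc g + w) w + P * φ P (suc g + suc g + w) (2 + w)
     ≡⟨ cong (λ z → φ P (suc g + suc g + w) w + P * φ P z (2 + w)) (ix g w) ⟩
  φ P (suc g + suc g + w) w + P * φ P (g + g + (2 + w)) (2 + w)
     ≤⟨ +-mono-≤ (φ-bound P (suc g) w) (*-monoʳ-≤ P (φ-bound P g (2 + w))) ⟩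
  P ^ suc g * (w + suc g) ^ suc g + P * (P ^ g * (2 + w + g) ^ g)
     ≤⟨ +-monoˡ-≤ _ (*-monoʳ-≤ (P ^ suc g) (*-monoʳ-≤ (w + suc g) (^-monoˡ-≤ g (n≤1+n (w + suc g))))) ⟩
  P ^ suc g * ((w + suc g) * suc (w + suc g) ^ g) + P * (P ^ g * (2 + w + g) ^ g)
     ≡⟨ cong (λ z → P ^ suc g * ((w + suc g) * suc (w + suc g) ^ g) + P * (P ^ g * z ^ g)) (cong suc (sym (+-suc w g))) ⟩
  P * P ^ g * ((w + suc g) * suc (w + suc g) ^ g) + P * (P ^ g * suc (w + suc g) ^ g)
     ≡⟨ lem P (P ^ g) (w + suc g) (suc (w + suc g) ^ g) ⟩
  P ^ suc g * (suc w + suc g) ^ suc g ∎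
  where
  open ≤-Reasoning
  ix₀ : ∀ g w → suc g + suc g + suc w ≡ suc (suc g + suc g + w)
  ix₀ = solve-∀
  ix : ∀ g w → suc g + suc g + w ≡ g + g + (2 + w)
  ix = solve-∀
  lem : ∀ P Q s t → P * Q * (s * t) + P * (Q * t) ≡ P * Q * (suc s * t)
  lem = solve-∀

module _ (D : ℕ) where
  private
    P = D * (D * (2 * D))

  -- φ is multiplicative along a cut (φ-conv), and an up-step pays for the handle term.
  Hf≤φX : ∀ n r a A → size a A ≤ D → Hf n r a A ≤ φ P r (wt a A) * X a A
  Hf≤φX zero    r       a       A        p = z≤n
  Hf≤φX (suc n) zero    zero    []       p = ≤-reflexive (sym (trans (*-identityˡ (X 0 [])) (X-unfold 0 [])))
  Hf≤φX (suc n) zero    zero    (b ∷ A)  p = z≤n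
  Hf≤φX (suc n) zero    (suc a) A        p = z≤n
  Hf≤φX (suc n) (suc r) a       A        p with wt a A in eq
  Hf≤φX (suc n) (suc r) zero [] p | zero  = z≤n
  ... | suc w = begin
    cut a (λ i j → Hf n r i (j ∷ A) + ∑ (splits A) (λ (B , C) → conv r (λ r₁ r₂ → Hf n r₁ i B * Hf n r₂ j C)))
      + ∑ (picks A) (λ (b , C) → suc b * Hf n r (suc (a + b)) C)
      ≤⟨ +-mono-≤ (cut-bound a eq p) join-bound ⟩
    (φ P r (2 + w) * (P * X a A) + φ P r w * cutX a A) + φ P r w * joinX a A
      ≡⟨ +-assoc (φ P r (2 + w) * (P * X a A)) _ _ ⟩
    φ P r (2 + w) * (P * X a A) + (φ P r w * cutX a A + φ P r w * joinX a A)
      ≡⟨ cong (φ P r (2 + w) * (P * X a A) +_) (*-distribˡ-+ (φ P r w) _ _) ⟨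
    φ P r (2 + w) * (P * X a A) + φ P r w * (cutX a A + joinX a A)
      ≤⟨ +-monoʳ-≤ (φ P r (2 + w) * (P * X a A)) (*-monoʳ-≤ (φ P r w) (m≤n+m _ (base a A))) ⟩
    φ P r (2 + w) * (P * X a A) + φ P r w * (base a A + (cutX a A + joinX a A))
      ≡⟨ cong (λ z → φ P r (2 + w) * (P * X a A) + φ P r w * z) (X-unfold a A) ⟨
    φ P r (2 + w) * (P * X a A) + φ P r w * X a A
      ≡⟨ lem (φ P r (2 + w)) P (X a A) (φ P r w) ⟩
    (φ P r w + P * φ P r (2 + w)) * X a A ∎
    where
    open ≤-Reasoning
    lem : ∀ s P x t → s * (P * x) + t * x ≡ (t + P * s) * x
    lem = solve-∀
    join-bound : ∑ (picks A) (λ (b , C) → suc b * Hf n r (suc (a + b)) C) ≤ φ P r w * joinX a A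
    join-bound = ≤-trans
      (∑-monoᴬ (All.zipWith (λ {x} (s , t) → ≤-trans
         (*-monoʳ-≤ (suc (proj₁ x)) (Hf≤φX n r _ (proj₂ x) (≤-trans (≤-reflexive (trans (lem₂ a (proj₁ x) _) (cong (suc a +_) t))) p)))
         (≤-reflexive (trans (*-left-comm (suc (proj₁ x)) (φ P r (wt (suc (a + proj₁ x)) (proj₂ x))) _)
            (cong (λ z → φ P r z * (suc (proj₁ x) * X (suc (a + proj₁ x)) (proj₂ x))) (suc-injective (trans s eq))))))
         (wt-picks a A , picks-∑ suc A)))
      (≤-reflexive (∑-*ˡ (picks A) (φ P r w) _))
      where
      lem₂ : ∀ a b s → suc (suc (a + b)) + s ≡ suc a + (suc b + s)
      lem₂ = solve-∀
    cut-bound : ∀ a → wt a A ≡ suc w → size a A ≤ D →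
      cut a (λ i j → Hf n r i (j ∷ A) + ∑ (splits A) (λ (B , C) → conv r (λ r₁ r₂ → Hf n r₁ i B * Hf n r₂ j C)))
      ≤ φ P r (2 + w) * (P * X a A) + φ P r w * cutX a A
    cut-bound zero    eq p = z≤n
    cut-bound (suc a) eq p = begin
      _ ≡⟨ conv-+ a _ _ ⟩
      conv a (λ i j → Hf n r i (j ∷ A)) + conv a (λ i j → ∑ (splits A) (λ (B , C) → conv r (λ r₁ r₂ → Hf n r₁ i B * Hf n r₂ j C)))
        ≤⟨ +-mono-≤
          (conv-monoᴺ a (λ i j e → ≤-trans (Hf≤φX n r i (j ∷ A) (≤-trans (≤-reflexive (trans (lem₃ i j _) (cong (λ z → 2 + z + ∑ A suc) e))) p))
             (≤-reflexive (cong (λ z → φ P r z * X i (j ∷ A)) (trans (lem₄ i j _) (cong (2 +_) (trans (cong (_+ ∑ A (2 +_)) e) (suc-injective eq))))))))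
          (conv-monoᴺ a (λ i j e → ∑-monoᴬ (All.zipWith (λ {x} (s , t) → ≤-trans
             (conv-mono r (λ r₁ r₂ → ≤-trans (*-mono-≤ (Hf≤φX n r₁ i (proj₁ x) (≤-trans (smallˡ i j e _ _ _ t) p)) (Hf≤φX n r₂ j (proj₂ x) (≤-trans (smallʳ i j e _ _ _ t) p)))
                (≤-reflexive (*-interchange (φ P r₁ (wt i (proj₁ x))) (X i (proj₁ x)) (φ P r₂ (wt j (proj₂ x))) (X j (proj₂ x))))))
             (≤-reflexive (trans (conv-*ʳ r _ _) (cong (_* (X i (proj₁ x) * X j (proj₂ x)))
                (trans (φ-conv P r (wt i (proj₁ x)) (wt j (proj₂ x))) (cong (φ P r) (suc-injective (trans s eq))))))))
             (wt-splits i j A (cong suc e) , splits-∑ suc A)))) ⟩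
      conv a (λ i j → φ P r (2 + w) * X i (j ∷ A)) + conv a (λ i j → ∑ (splits A) (λ (B , C) → φ P r w * (X i B * X j C)))
        ≡⟨ cong₂ _+_ (conv-*ˡ a (φ P r (2 + w)) _) (trans (conv-cong a (λ i j → ∑-*ˡ (splits A) (φ P r w) _)) (conv-*ˡ a (φ P r w) _)) ⟩
      φ P r (2 + w) * conv a (λ i j → X i (j ∷ A)) + φ P r w * cutX (suc a) A
        ≤⟨ +-monoˡ-≤ _ (*-monoʳ-≤ (φ P r (2 + w)) (handle-bound D a A p)) ⟩
      φ P r (2 + w) * (P * X (suc a) A) + φ P r w * cutX (suc a) A ∎
      where
      lem₃ : ∀ i j s → suc i + (suc j + s) ≡ 2 + (i + j) + s
      lem₃ = solve-∀
      lem₄ : ∀ i j s → i + (2 + j + s) ≡ 2 + (i + j + s)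
      lem₄ = solve-∀
      smallˡ : ∀ i j → i + j ≡ a → ∀ s t u → s + t ≡ u → suc i + s ≤ suc (suc a) + u
      smallˡ i j refl s t u refl = s≤s (+-mono-≤ (≤-trans (m≤m+n i j) (n≤1+n _)) (m≤m+n s t))
      smallʳ : ∀ i j → i + j ≡ a → ∀ s t u → s + t ≡ u → suc j + t ≤ suc (suc a) + u
      smallʳ i j refl s t u refl = s≤s (+-mono-≤ (≤-trans (m≤n+m j i) (n≤1+n _)) (m≤n+m t s))

-- The handle terms are dropped, and from the distributions of the steps over two components only
-- the one with genus zero on both sides is kept.
X≤Hf : ∀ n w a A → wt a A ≡ w → w < n → X a A ≤ Hf n w a A
X≤Hf (suc n) zero    zero    []      eq p = ≤-reflexive (X-unfold 0 [])
X≤Hf (suc n) zero    zero    (x ∷ A) () p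
X≤Hf (suc n) zero    (suc a) A       () p
X≤Hf (suc n) (suc w) a A eq (s≤s p) = begin
  X a A                           ≡⟨ X-unfold a A ⟩
  base a A + (cutX a A + joinX a A) ≡⟨ cong (_+ (cutX a A + joinX a A)) (base0 a A eq) ⟩
  cutX a A + joinX a A            ≤⟨ +-mono-≤ (cut-bound a eq)
     (∑-monoᴬ (All.map (λ {x} s → *-monoʳ-≤ (suc (proj₁ x))
         (X≤Hf n w (suc (a + proj₁ x)) (proj₂ x) (suc-injective (trans s eq)) p)) (wt-picks a A))) ⟩
  _ ∎
  where
  open ≤-Reasoning
  base0 : ∀ a A → wt a A ≡ suc w → base a A ≡ 0
  base0 zero    (x ∷ A) e = refl
  base0 (suc a) A       e = refl
  cut-bound : ∀ a → wt a A ≡ suc w → cutX a A ≤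
     cut a (λ i j → Hf n w i (j ∷ A) + ∑ (splits A) (λ (B , C) → conv w (λ r₁ r₂ → Hf n r₁ i B * Hf n r₂ j C)))
  cut-bound zero    eq = z≤n
  cut-bound (suc a) eq = conv-monoᴺ a (λ i j e → ≤-trans (∑-monoᴬ (All.map (λ {x} s →
    let s′ = suc-injective (trans s eq) in ≤-trans
      (*-mono-≤ (X≤Hf n _ i (proj₁ x) refl (≤-trans (s≤s (≤-trans (m≤m+n _ _) (≤-reflexive s′))) p))
                (X≤Hf n _ j (proj₂ x) refl (≤-trans (s≤s (≤-trans (m≤n+m (wt j (proj₂ x)) (wt i (proj₁ x))) (≤-reflexive s′))) p)))
      (≤-trans (conv-term (wt i (proj₁ x)) (wt j (proj₂ x)) (λ r₁ r₂ → Hf n r₁ i (proj₁ x) * Hf n r₂ j (proj₂ x)))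
        (≤-reflexive (cong (λ z → conv z _) s′)))) (wt-splits i j A (cong suc e)))) (m≤n+m _ (Hf n w i (j ∷ A))))

-- Performing the same transposition of two fixed points twice changes no end and raises the genus
-- by one: a join followed by a handle cut. This is why a second fixed point has to be present.
Hf-genus-step : ∀ n r A → Hf n r 0 (0 ∷ A) ≤ Hf (2 + n) (2 + r) 0 (0 ∷ A)
Hf-genus-step n r A = begin
  Hf n r 0 (0 ∷ A)                      ≤⟨ m≤m+n _ _ ⟩
  Hf n r 0 (0 ∷ A) + _                  ≤⟨ m≤m+n _ _ ⟩
  Hf (suc n) (suc r) 1 A                ≡⟨ +-identityʳ _ ⟨
  1 * Hf (suc n) (suc r) 1 A            ≤⟨ m≤m+n _ _ ⟩
  1 * Hf (suc n) (suc r) 1 A + _        ∎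
  where open ≤-Reasoning

Hf-genus : ∀ g n r A → Hf n r 0 (0 ∷ A) ≤ Hf (g + g + n) (g + g + r) 0 (0 ∷ A)
Hf-genus zero    n r A = ≤-refl
Hf-genus (suc g) n r A rewrite +-suc g g = ≤-trans (Hf-genus g n r A) (Hf-genus-step (g + g + n) (g + g + r) A)

-- Closed form in genus zero

-- Multiplication by y on coefficient sequences.
sh : (ℕ → ℕ) → ℕ → ℕ
sh f zero    = 0
sh f (suc k) = f k

-- γ m k is the coefficient of y^k in U^m, where U = 1 + 2 y U³.
γ : ℕ → ℕ → ℕ
γ zero    zero    = 1
γ zero    (suc k) = 0
γ (suc m) zero    = 1
γ (suc m) (suc k) = γ m (suc k) + 2 * γ (3 + m) k

γ0 : ∀ m → γ m 0 ≡ 1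
γ0 zero    = refl
γ0 (suc m) = refl

γ-step : ∀ m k → γ (suc m) k ≡ γ m k + 2 * sh (γ (3 + m)) k
γ-step m zero    = sym (trans (+-identityʳ (γ m 0)) (γ0 m))
γ-step m (suc k) = refl

shγ-step : ∀ m k → sh (γ (suc m)) k ≡ sh (γ m) k + 2 * sh (sh (γ (3 + m))) k
shγ-step m zero    = refl
shγ-step m (suc k) = γ-step m k

γ-conv : ∀ m n k → conv k (λ i j → γ m i * γ n j) ≡ γ (m + n) k
γ-conv zero    n zero    = *-identityˡ _
γ-conv zero    n (suc k) = trans (cong₂ _+_ (*-identityˡ _) (conv-zero k)) (+-identityʳ _)
γ-conv (suc m) n zero    = trans (*-identityˡ _) (γ0 n)
γ-conv (suc m) n (suc k) = begin
  1 * γ n (suc k) + conv k (λ i j → (γ m (suc i) + 2 * γ (3 + m) i) * γ n j)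
    ≡⟨ cong₂ _+_ (cong (_* γ n (suc k)) (sym (γ0 m))) (trans (conv-cong k (λ i j → distr (γ m (suc i)) (γ (3 + m) i) (γ n j)))
        (trans (conv-+ k _ _) (cong (conv k (λ i j → γ m (suc i) * γ n j) +_) (conv-*ˡ k 2 _)))) ⟩
  γ m 0 * γ n (suc k) + (conv k (λ i j → γ m (suc i) * γ n j) + 2 * conv k (λ i j → γ (3 + m) i * γ n j))
    ≡⟨ +-assoc (γ m 0 * γ n (suc k)) _ _ ⟨
  conv (suc k) (λ i j → γ m i * γ n j) + 2 * conv k (λ i j → γ (3 + m) i * γ n j)
    ≡⟨ cong₂ (λ u v → u + 2 * v) (γ-conv m n (suc k)) (γ-conv (3 + m) n k) ⟩
  γ (m + n) (suc k) + 2 * γ (3 + m + n) k ∎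
  where
  open ≡-Reasoning
  distr : ∀ a b c → (a + 2 * b) * c ≡ a * c + 2 * (b * c)
  distr = solve-∀

conv-shʳ : ∀ k (F G : ℕ → ℕ) → conv k (λ i j → F i * sh G j) ≡ sh (λ k → conv k (λ i j → F i * G j)) k
conv-shʳ zero    F G = *-zeroʳ (F 0)
conv-shʳ (suc k) F G = trans (conv-last k (λ i j → F i * sh G j)) (trans (cong (conv k (λ i j → F i * G j) +_) (*-zeroʳ (F (suc k)))) (+-identityʳ _))

conv-shˡ : ∀ k (F G : ℕ → ℕ) → conv k (λ i j → sh F i * G j) ≡ sh (λ k → conv k (λ i j → F i * G j)) k
conv-shˡ zero    F G = refl
conv-shˡ (suc k) F G = refl

sh-cong : ∀ {f g : ℕ → ℕ} → (∀ k → f k ≡ g k) → ∀ k → sh f k ≡ sh g k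
sh-cong e zero    = refl
sh-cong e (suc k) = e k

catalan : ℕ → ℕ
catalan a = X a []

catalan-zero : catalan 0 ≡ 1
catalan-zero = X-unfold 0 []

catalan-suc : ∀ a → conv a (λ i j → catalan i * catalan j) ≡ catalan (suc a)
catalan-suc a = sym (trans (X-unfold (suc a) []) (trans (+-identityʳ _) (conv-cong a (λ i j → +-identityʳ _))))

catalan-one : catalan 1 ≡ 1
catalan-one = trans (sym (catalan-suc 0)) (cong₂ _*_ catalan-zero catalan-zero)

catalan-two : catalan 2 ≡ 2
catalan-two = trans (sym (catalan-suc 1)) (cong₂ _+_ (cong₂ _*_ catalan-zero catalan-one) (cong₂ _*_ catalan-one catalan-zero))

catalan-convʳ : ∀ a → conv a (λ i j → catalan i * catalan (suc j)) + catalan (suc a) ≡ catalan (2 + a)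
catalan-convʳ a = trans (cong (conv a _ +_) (sym (trans (cong (catalan (suc a) *_) catalan-zero) (*-identityʳ _))))
            (trans (sym (conv-last a (λ i j → catalan i * catalan j))) (catalan-suc (suc a)))

catalan-convˡ : ∀ a → conv a (λ i j → catalan (suc i) * catalan j) + catalan (suc a) ≡ catalan (2 + a)
catalan-convˡ a = trans (+-comm _ (catalan (suc a)))
            (trans (cong (_+ conv a (λ i j → catalan (suc i) * catalan j)) (sym (trans (cong (_* catalan (suc a)) catalan-zero) (*-identityˡ _)))) (catalan-suc (suc a)))

catalan-conv₂ : ∀ a → conv a (λ i j → catalan (suc i) * catalan (suc j)) + 2 * catalan (2 + a) ≡ catalan (3 + a)
catalan-conv₂ a = begin
  T + 2 * catalan (2 + a)                           ≡⟨ lem T (catalan (2 + a)) ⟩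
  1 * catalan (2 + a) + (T + catalan (2 + a) * 1)         ≡⟨ cong₂ (λ u v → u * catalan (2 + a) + (T + catalan (2 + a) * v)) catalan-zero catalan-zero ⟨
  catalan 0 * catalan (2 + a) + (T + catalan (2 + a) * catalan 0)     ≡⟨ cong (catalan 0 * catalan (2 + a) +_) (conv-last a (λ i j → catalan (suc i) * catalan j)) ⟨
  conv (2 + a) (λ i j → catalan i * catalan j)            ≡⟨ catalan-suc (2 + a) ⟩
  catalan (3 + a)                                   ∎
  where
  open ≡-Reasoning
  T = conv a (λ i j → catalan (suc i) * catalan (suc j))
  lem : ∀ t u → t + 2 * u ≡ 1 * u + (t + u * 1)
  lem = solve-∀

∑splits-replicate-cong : ∀ (z : A) k {F G : List A → List A → ℕ} →
  (∀ i j → i + j ≡ k → F (replicate i z) (replicate j z) ≡ G (replicate i z) (replicate j z)) →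
  ∑ (splits (replicate k z)) (λ (B , C) → F B C) ≡ ∑ (splits (replicate k z)) (λ (B , C) → G B C)
∑splits-replicate-cong z zero    e = cong (_+ 0) (e 0 0 refl)
∑splits-replicate-cong z (suc k) {F} {G} e = begin
  ∑ (splits (replicate (suc k) z)) (λ (B , C) → F B C) ≡⟨ ∑splits-∷ z (replicate k z) _ ⟩
  _ ≡⟨ cong₂ _+_ (∑splits-replicate-cong z k {λ B C → F (z ∷ B) C} {λ B C → G (z ∷ B) C} (λ i j p → e (suc i) j (cong suc p)))
                 (∑splits-replicate-cong z k {λ B C → F B (z ∷ C)} {λ B C → G B (z ∷ C)} (λ i j p → e i (suc j) (trans (+-suc i j) (cong suc p)))) ⟩
  _ ≡⟨ ∑splits-∷ z (replicate k z) _ ⟨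
  ∑ (splits (replicate (suc k) z)) (λ (B , C) → G B C) ∎
  where open ≡-Reasoning

-- Exponential generating functions multiply: there are k choose i splits with i entries on the
-- left, and (k choose i) i! j! = k!. In the induction the first entry goes left or right, and the
-- two contributions recombine through i ψ + j ψ = (k + 1) ψ.
∑splits-replicate : ∀ (z : A) k (F : List A → List A → ℕ) (ψ : ℕ → ℕ → ℕ) →
  (∀ i j → F (replicate i z) (replicate j z) ≡ i ! * j ! * ψ i j) →
  ∑ (splits (replicate k z)) (λ (B , C) → F B C) ≡ k ! * conv k ψ
∑splits-replicate z zero    F ψ e = trans (+-identityʳ _) (e 0 0)
∑splits-replicate z (suc k) F ψ e = begin
  ∑ (splits (replicate (suc k) z)) (λ (B , C) → F B C) ≡⟨ ∑splits-∷ z (replicate k z) _ ⟩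
  _ ≡⟨ cong₂ _+_ (∑splits-replicate z k (λ B C → F (z ∷ B) C) (λ i j → suc i * ψ (suc i) j) (λ i j → trans (e (suc i) j) (lem₁ (suc i) (i !) (j !) (ψ (suc i) j))))
                 (∑splits-replicate z k (λ B C → F B (z ∷ C)) (λ i j → suc j * ψ i (suc j)) (λ i j → trans (e i (suc j)) (lem₂ (suc j) (i !) (j !) (ψ i (suc j))))) ⟩
  k ! * S + k ! * T ≡⟨ *-distribˡ-+ (k !) S T ⟨
  k ! * (S + T) ≡⟨ cong (k ! *_) sum-eq ⟩
  k ! * (suc k * conv (suc k) ψ) ≡⟨ lem₃ (k !) (suc k) (conv (suc k) ψ) ⟩
  suc k ! * conv (suc k) ψ ∎
  where
  open ≡-Reasoning
  S = conv k (λ i j → suc i * ψ (suc i) j)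
  T = conv k (λ i j → suc j * ψ i (suc j))
  lem₁ : ∀ s a b x → s * a * b * x ≡ a * b * (s * x)
  lem₁ = solve-∀
  lem₂ : ∀ s a b x → a * (s * b) * x ≡ a * b * (s * x)
  lem₂ = solve-∀
  lem₃ : ∀ a b x → a * (b * x) ≡ b * a * x
  lem₃ = solve-∀
  sum-eq : S + T ≡ suc k * conv (suc k) ψ
  sum-eq = begin
    S + T ≡⟨ cong (S +_) (trans (conv-last k (λ i j → j * ψ i j)) (+-identityʳ T)) ⟨
    conv (suc k) (λ i j → i * ψ i j) + conv (suc k) (λ i j → j * ψ i j) ≡⟨ conv-+ (suc k) (λ i j → i * ψ i j) (λ i j → j * ψ i j) ⟨
    conv (suc k) (λ i j → i * ψ i j + j * ψ i j)
      ≡⟨ conv-congᴺ (suc k) (λ i j p → trans (sym (*-distribʳ-+ (ψ i j) i j)) (cong (_* ψ i j) p)) ⟩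
    conv (suc k) (λ i j → suc k * ψ i j) ≡⟨ conv-*ˡ (suc k) (suc k) ψ ⟩
    suc k * conv (suc k) ψ ∎

∑picks-replicate : ∀ (z : A) k (f : A × List A → ℕ) → ∑ (picks (replicate (suc k) z)) f ≡ suc k * f (z , replicate k z)
∑picks-replicate z zero    f = refl
∑picks-replicate z (suc k) f = trans (∑picks-∷ z (replicate (suc k) z) f) (cong (f (z , replicate (suc k) z) +_) (∑picks-replicate z k _))

-- With F = Σ ξ a k x^a y^k / k!, the recursion of X reads F = 1 + x F² + y (F - F(0)) / x; the quadratic method gives
-- F = Σ_a x^a (c_a U^(2a+1) - y c_(a+1) U^(2a+4)).
ξ : ℕ → ℕ → ℕ
ξ a k = X a (replicate k 0)

lead corr : ℕ → ℕ → ℕ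
lead a k = catalan a * γ (1 + (a + a)) k
corr a k = catalan (suc a) * sh (γ (4 + (a + a))) k

lead! corr! : ℕ → List ℕ → ℕ
lead! a B = length B ! * lead a (length B)
corr! a B = length B ! * corr a (length B)

-- The exponents of U are affine in the index, so the y-part of a product depends on i + j only and
-- can be pulled out of the convolution in x.
conv-conv : ∀ (α β : ℕ → ℕ) (f g : ℕ → ℕ → ℕ) (h : ℕ → ℕ → ℕ) →
  (∀ i j k → conv k (λ k₁ k₂ → f i k₁ * g j k₂) ≡ h (i + j) k) →
  ∀ a k → conv a (λ i j → conv k (λ k₁ k₂ → α i * f i k₁ * (β j * g j k₂))) ≡ conv a (λ i j → α i * β j) * h a k
conv-conv α β f g h e a k = trans
  (conv-congᴺ a (λ i j q → trans (conv-cong k (λ k₁ k₂ → *-interchange (α i) (f i k₁) (β j) (g j k₂)))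
    (trans (conv-*ˡ k (α i * β j) _) (cong ((α i * β j) *_) (trans (e i j k) (cong (λ z → h z k) q))))))
  (conv-*ʳ a (h a k) _)

index-+ : ∀ m n i j → (m + (i + i)) + (n + (j + j)) ≡ (m + n) + ((i + j) + (i + j))
index-+ = solve-∀

conv-lead-lead : ∀ a k → conv a (λ i j → conv k (λ k₁ k₂ → lead i k₁ * lead j k₂)) ≡ catalan (suc a) * γ (2 + (a + a)) k
conv-lead-lead a k = trans
  (conv-conv catalan catalan (λ i → γ (1 + (i + i))) (λ j → γ (1 + (j + j))) (λ a → γ (2 + (a + a)))
    (λ i j k → trans (γ-conv (1 + (i + i)) (1 + (j + j)) k) (cong (λ z → γ z k) (index-+ 1 1 i j))) a k)
  (cong (_* γ (2 + (a + a)) k) (catalan-suc a))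

conv-lead-corr : ∀ a k → conv a (λ i j → conv k (λ k₁ k₂ → lead i k₁ * corr j k₂)) ≡ conv a (λ i j → catalan i * catalan (suc j)) * sh (γ (5 + (a + a))) k
conv-lead-corr = conv-conv catalan (catalan ∘ suc) (λ i → γ (1 + (i + i))) (λ j → sh (γ (4 + (j + j)))) (λ a → sh (γ (5 + (a + a))))
  (λ i j k → trans (conv-shʳ k (γ (1 + (i + i))) (γ (4 + (j + j))))
    (sh-cong (λ k → trans (γ-conv (1 + (i + i)) (4 + (j + j)) k) (cong (λ z → γ z k) (index-+ 1 4 i j))) k))

conv-corr-lead : ∀ a k → conv a (λ i j → conv k (λ k₁ k₂ → corr i k₁ * lead j k₂)) ≡ conv a (λ i j → catalan (suc i) * catalan j) * sh (γ (5 + (a + a))) k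
conv-corr-lead = conv-conv (catalan ∘ suc) catalan (λ i → sh (γ (4 + (i + i)))) (λ j → γ (1 + (j + j))) (λ a → sh (γ (5 + (a + a))))
  (λ i j k → trans (conv-shˡ k (γ (4 + (i + i))) (γ (1 + (j + j))))
    (sh-cong (λ k → trans (γ-conv (4 + (i + i)) (1 + (j + j)) k) (cong (λ z → γ z k) (index-+ 4 1 i j))) k))

conv-corr-corr : ∀ a k → conv a (λ i j → conv k (λ k₁ k₂ → corr i k₁ * corr j k₂)) ≡ conv a (λ i j → catalan (suc i) * catalan (suc j)) * sh (sh (γ (8 + (a + a)))) k
conv-corr-corr = conv-conv (catalan ∘ suc) (catalan ∘ suc) (λ i → sh (γ (4 + (i + i)))) (λ j → sh (γ (4 + (j + j)))) (λ a → sh (sh (γ (8 + (a + a)))))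
  (λ i j k → trans (conv-shˡ k (γ (4 + (i + i))) (sh (γ (4 + (j + j)))))
    (sh-cong (λ k → trans (conv-shʳ k (γ (4 + (i + i))) (γ (4 + (j + j))))
      (sh-cong (λ k → trans (γ-conv (4 + (i + i)) (4 + (j + j)) k) (cong (λ z → γ z k) (index-+ 4 4 i j))) k)) k))

-- The measure a + 2k is the weight `wt`: a join raises a by one but uses up a fixed point. The
-- subtracted part of the closed form stands on the left.
ξ-closed-fuel : ∀ n a k → a + (k + k) ≤ n → ξ a k + k ! * corr a k ≡ k ! * lead a k
joinX-closed : ∀ n a k → a + (k + k) ≤ suc n → joinX a (replicate k 0) + k ! * (catalan (2 + a) * sh (sh (γ (6 + (a + a)))) k) ≡ k ! * (catalan (suc a) * sh (γ (3 + (a + a))) k)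
joinX-closed n a zero    le = cong (_+ 0) (trans (*-zeroʳ (catalan (2 + a))) (sym (*-zeroʳ (catalan (suc a)))))
joinX-closed n a (suc k) le = begin
  joinX a (replicate (suc k) 0) + suc k ! * (catalan (2 + a) * sh (γ (6 + (a + a))) k)
    ≡⟨ cong (_+ suc k ! * (catalan (2 + a) * sh (γ (6 + (a + a))) k)) (∑picks-replicate 0 k _) ⟩
  suc k * (1 * X (suc (a + 0)) (replicate k 0)) + suc k ! * (catalan (2 + a) * sh (γ (6 + (a + a))) k)
    ≡⟨ cong₂ (λ u v → suc k * (1 * X (suc u) (replicate k 0)) + suc k ! * (catalan (2 + a) * sh (γ v) k)) (+-identityʳ a) (ix a) ⟩
  suc k * (1 * ξ (suc a) k) + suc k ! * corr (suc a) k ≡⟨ lem (suc k) (ξ (suc a) k) (k !) (corr (suc a) k) ⟩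
  suc k * (ξ (suc a) k + k ! * corr (suc a) k) ≡⟨ cong (suc k *_) (ξ-closed-fuel n (suc a) k (s≤s⁻¹ (≤-trans (≤-reflexive (ix′ a k)) le))) ⟩
  suc k * (k ! * lead (suc a) k) ≡⟨ *-assoc (suc k) (k !) _ ⟨
  suc k ! * lead (suc a) k ≡⟨ cong (λ z → suc k ! * (catalan (suc a) * γ z k)) (cong (2 +_) (+-suc a a)) ⟩
  suc k ! * (catalan (suc a) * γ (3 + (a + a)) k) ∎
  where
  open ≡-Reasoning
  ix : ∀ a → 6 + (a + a) ≡ 4 + (suc a + suc a)
  ix = solve-∀
  ix′ : ∀ a k → suc (suc a + (k + k)) ≡ a + (suc k + suc k)
  ix′ = solve-∀
  lem : ∀ s y f z → s * (1 * y) + s * f * z ≡ s * (y + f * z)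
  lem = solve-∀
ξ-closed-fuel n zero k le = begin
  ξ 0 k + k ! * (catalan 1 * sh (γ 4) k)
    ≡⟨ cong₂ (λ u v → u + k ! * v) (X-unfold 0 (replicate k 0)) (cong₂ _*_ catalan-one (shγ-step 3 k)) ⟩
  base 0 (replicate k 0) + Jk + k ! * (1 * (s₁ + 2 * s₂))
    ≡⟨ cong (λ z → z + Jk + k ! * (1 * (s₁ + 2 * s₂))) (base-eq k) ⟩
  k ! * γ 0 k + Jk + k ! * (1 * (s₁ + 2 * s₂)) ≡⟨ lem (k ! * γ 0 k) Jk (k !) s₁ s₂ ⟩
  k ! * γ 0 k + (Jk + k ! * (2 * s₂)) + k ! * s₁ ≡⟨ cong (λ z → k ! * γ 0 k + (Jk + k ! * (z * s₂)) + k ! * s₁) catalan-two ⟨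
  k ! * γ 0 k + (Jk + k ! * (catalan 2 * s₂)) + k ! * s₁ ≡⟨ cong (λ z → k ! * γ 0 k + z + k ! * s₁) (joinX-closed′ n k le) ⟩
  k ! * γ 0 k + k ! * (catalan 1 * s₁) + k ! * s₁ ≡⟨ cong (λ z → k ! * γ 0 k + k ! * (z * s₁) + k ! * s₁) catalan-one ⟩
  k ! * γ 0 k + k ! * (1 * s₁) + k ! * s₁ ≡⟨ lem₂ (k !) (γ 0 k) s₁ ⟩
  k ! * (1 * (γ 0 k + 2 * s₁)) ≡⟨ cong₂ (λ u v → k ! * (u * v)) catalan-zero (γ-step 0 k) ⟨
  k ! * (catalan 0 * γ 1 k) ∎
  where
  open ≡-Reasoning
  s₁ = sh (γ 3) k
  s₂ = sh (sh (γ 6)) k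
  Jk = joinX 0 (replicate k 0)
  base-eq : ∀ k → base 0 (replicate k 0) ≡ k ! * γ 0 k
  base-eq zero    = refl
  base-eq (suc k) = sym (*-zeroʳ (suc k !))
  joinX-closed′ : ∀ n k → k + k ≤ n → joinX 0 (replicate k 0) + k ! * (catalan 2 * sh (sh (γ 6)) k) ≡ k ! * (catalan 1 * sh (γ 3) k)
  joinX-closed′ zero    zero    _  = joinX-closed 0 0 0 z≤n
  joinX-closed′ (suc n) k       le = joinX-closed n 0 k le
  lem : ∀ b j f s t → b + j + f * (1 * (s + 2 * t)) ≡ b + (j + f * (2 * t)) + f * s
  lem = solve-∀
  lem₂ : ∀ f g s → f * g + f * (1 * s) + f * s ≡ f * (1 * (g + 2 * s))
  lem₂ = solve-∀
-- `Z` consists of the negative terms: the mixed products of `lead` and `corr` in the square F², and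
-- the correction of the join term. Once it is added, `E₁` and `E₂` evaluate the cut and the join;
-- what remains is Catalan convolutions and U = 1 + 2yU³.
ξ-closed-fuel (suc n) (suc a) k le = +-cancelʳ-≡ Z _ _ (begin
  ξ (suc a) k + K * (C₂ * sh (γ (4 + (suc a + suc a))) k) + Z
    ≡⟨ cong₂ (λ u v → u + K * (C₂ * v) + Z) (X-unfold (suc a) (replicate k 0)) (trans (shγ-step (3 + (suc a + suc a)) k) (cong₂ (λ u v → sh (γ u) k + 2 * sh (sh (γ v)) k) ix₅ ix₈)) ⟩
  (cv + Jk) + K * (C₂ * (s₁ + 2 * s₂)) + Z
    ≡⟨ lem₁ cv Jk K C₂ s₁ s₂ S S′ C₃ ⟩
  (cv + (K * (S * s₁) + K * (S′ * s₁))) + (Jk + K * (C₃ * s₂)) + K * (C₂ * (s₁ + 2 * s₂))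
    ≡⟨ cong₂ (λ u v → u + v + K * (C₂ * (s₁ + 2 * s₂))) E₁ E₂ ⟩
  (K * (C₁ * G₀) + K * (T * s₂)) + K * (C₂ * s₁) + K * (C₂ * (s₁ + 2 * s₂))
    ≡⟨ lem₂ K C₁ G₀ T s₂ C₂ s₁ ⟩
  K * (C₁ * G₀) + K * ((T + 2 * C₂) * s₂) + K * (C₂ * s₁) + K * (C₂ * s₁)
    ≡⟨ cong (λ u → K * (C₁ * G₀) + K * (u * s₂) + K * (C₂ * s₁) + K * (C₂ * s₁)) (catalan-conv₂ a) ⟩
  K * (C₁ * G₀) + K * (C₃ * s₂) + K * (C₂ * s₁) + K * (C₂ * s₁)
    ≡⟨ cong₂ (λ u v → K * (C₁ * G₀) + K * (C₃ * s₂) + K * (u * s₁) + K * (v * s₁)) (catalan-convʳ a) (catalan-convˡ a) ⟨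
  K * (C₁ * G₀) + K * (C₃ * s₂) + K * ((S + C₁) * s₁) + K * ((S′ + C₁) * s₁)
    ≡⟨ lem₃ K C₁ G₀ C₃ s₂ S S′ s₁ ⟩
  K * (C₁ * (G₀ + 2 * s₁)) + Z
    ≡⟨ cong (λ z → K * (C₁ * z) + Z) (trans (γ-step (suc a + suc a) k) (cong₂ (λ u v → γ u k + 2 * sh (γ v) k) ix₂ ix₅)) ⟨
  K * lead (suc a) k + Z ∎)
  where
  open ≡-Reasoning
  K = k !
  C₁ = catalan (suc a)
  C₂ = catalan (2 + a)
  C₃ = catalan (3 + a)
  S  = conv a (λ i j → catalan i * catalan (suc j))
  S′ = conv a (λ i j → catalan (suc i) * catalan j)
  T  = conv a (λ i j → catalan (suc i) * catalan (suc j))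
  G₀ = γ (2 + (a + a)) k
  s₁ = sh (γ (5 + (a + a))) k
  s₂ = sh (sh (γ (8 + (a + a)))) k
  cv = cutX (suc a) (replicate k 0)
  Jk = joinX (suc a) (replicate k 0)
  Z  = (K * (S * s₁) + K * (S′ * s₁)) + K * (C₃ * s₂)
  ix₂ : suc a + suc a ≡ 2 + (a + a)
  ix₂ = cong suc (+-suc a a)
  ix₅ : 3 + (suc a + suc a) ≡ 5 + (a + a)
  ix₅ = cong (3 +_) ix₂
  ix₈ : 6 + (suc a + suc a) ≡ 8 + (a + a)
  ix₈ = cong (6 +_) ix₂
  lem₁ : ∀ cv j K C₂ s t S S′ C₃ → (cv + j) + K * (C₂ * (s + 2 * t)) + ((K * (S * s) + K * (S′ * s)) + K * (C₃ * t))
       ≡ (cv + (K * (S * s) + K * (S′ * s))) + (j + K * (C₃ * t)) + K * (C₂ * (s + 2 * t))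
  lem₁ = solve-∀
  lem₂ : ∀ K C₁ G T t C₂ s → (K * (C₁ * G) + K * (T * t)) + K * (C₂ * s) + K * (C₂ * (s + 2 * t))
       ≡ K * (C₁ * G) + K * ((T + 2 * C₂) * t) + K * (C₂ * s) + K * (C₂ * s)
  lem₂ = solve-∀
  lem₃ : ∀ K C₁ G C₃ t S S′ s → K * (C₁ * G) + K * (C₃ * t) + K * ((S + C₁) * s) + K * ((S′ + C₁) * s)
       ≡ K * (C₁ * (G + 2 * s)) + ((K * (S * s) + K * (S′ * s)) + K * (C₃ * t))
  lem₃ = solve-∀
  E₂ : Jk + K * (C₃ * s₂) ≡ K * (C₂ * s₁)
  E₂ = trans (cong (λ z → Jk + K * (C₃ * sh (sh (γ z)) k)) (sym ix₈)) (trans (joinX-closed n (suc a) k le) (cong (λ z → K * (C₂ * sh (γ z) k)) ix₅))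
  splitsum : (F G : ℕ → List ℕ → ℕ) → ℕ
  splitsum F G = conv a (λ i j → ∑ (splits (replicate k 0)) (λ s → F i (proj₁ s) * G j (proj₂ s)))
  fact : ∀ (f g : ℕ → ℕ → ℕ) → splitsum (λ i B → length B ! * f i (length B)) (λ i B → length B ! * g i (length B))
       ≡ K * conv a (λ i j → conv k (λ k₁ k₂ → f i k₁ * g j k₂))
  fact f g = trans (conv-cong a (λ i j → ∑splits-replicate 0 k _ (λ k₁ k₂ → f i k₁ * g j k₂)
    (λ k₁ k₂ → trans (cong₂ (λ u v → u ! * f i u * (v ! * g j v)) (length-replicate k₁) (length-replicate k₂)) (four (k₁ !) (f i k₁) (k₂ !) (g j k₂)))))
    (conv-*ˡ a K _)
    where four : ∀ a b c d → (a * b) * (c * d) ≡ a * c * (b * d)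
          four = solve-∀
  E₁ : cv + (K * (S * s₁) + K * (S′ * s₁)) ≡ K * (C₁ * G₀) + K * (T * s₂)
  E₁ = begin
    cv + (K * (S * s₁) + K * (S′ * s₁))
      ≡⟨ cong₂ (λ u v → cv + (K * u + K * v)) (conv-lead-corr a k) (conv-corr-lead a k) ⟨
    cv + (K * conv a (λ i j → conv k (λ k₁ k₂ → lead i k₁ * corr j k₂)) + K * conv a (λ i j → conv k (λ k₁ k₂ → corr i k₁ * lead j k₂)))
      ≡⟨ cong₂ (λ u v → cv + (u + v)) (fact lead corr) (fact corr lead) ⟨
    splitsum X X + (splitsum lead! corr! + splitsum corr! lead!)
      ≡⟨ trans (conv-+ a _ _) (cong (splitsum X X +_) (conv-+ a _ _)) ⟨
    conv a (λ i j → ∑ (splits (replicate k 0)) (λ s → X i (proj₁ s) * X j (proj₂ s))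
       + (∑ (splits (replicate k 0)) (λ s → lead! i (proj₁ s) * corr! j (proj₂ s)) + ∑ (splits (replicate k 0)) (λ s → corr! i (proj₁ s) * lead! j (proj₂ s))))
      ≡⟨ conv-cong a (λ i j → trans (∑-+ (splits (replicate k 0)) _ _) (cong (∑ (splits (replicate k 0)) (λ s → X i (proj₁ s) * X j (proj₂ s)) +_) (∑-+ (splits (replicate k 0)) (λ s → lead! i (proj₁ s) * corr! j (proj₂ s)) (λ s → corr! i (proj₁ s) * lead! j (proj₂ s))))) ⟨
    conv a (λ i j → ∑ (splits (replicate k 0)) (λ s → X i (proj₁ s) * X j (proj₂ s) + (lead! i (proj₁ s) * corr! j (proj₂ s) + corr! i (proj₁ s) * lead! j (proj₂ s))))
      ≡⟨ conv-congᴺ a (λ i j e → ∑splits-replicate-cong 0 k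
           {λ B C → X i B * X j C + (lead! i B * corr! j C + corr! i B * lead! j C)} {λ B C → lead! i B * lead! j C + corr! i B * corr! j C}
           (λ k₁ k₂ e′ → quad (ξ i k₁) (ξ j k₂) (lead! i (replicate k₁ 0)) (corr! i (replicate k₁ 0)) (lead! j (replicate k₂ 0)) (corr! j (replicate k₂ 0))
              (IH i k₁ (bound i j k₁ k₂ e e′)) (IH j k₂ (bound′ i j k₁ k₂ e e′)))) ⟩
    conv a (λ i j → ∑ (splits (replicate k 0)) (λ s → lead! i (proj₁ s) * lead! j (proj₂ s) + corr! i (proj₁ s) * corr! j (proj₂ s)))
      ≡⟨ trans (conv-cong a (λ i j → ∑-+ (splits (replicate k 0)) _ _)) (conv-+ a _ _) ⟩
    splitsum lead! lead! + splitsum corr! corr!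
      ≡⟨ cong₂ _+_ (trans (fact lead lead) (cong (K *_) (conv-lead-lead a k))) (trans (fact corr corr) (cong (K *_) (conv-corr-corr a k))) ⟩
    K * (C₁ * G₀) + K * (T * s₂) ∎
    where
    IH : ∀ i k₁ → i + (k₁ + k₁) ≤ n → ξ i k₁ + corr! i (replicate k₁ 0) ≡ lead! i (replicate k₁ 0)
    IH i k₁ le′ = trans (cong (λ z → ξ i k₁ + z ! * corr i z) (length-replicate k₁)) (trans (ξ-closed-fuel n i k₁ le′) (cong (λ z → z ! * lead i z) (sym (length-replicate k₁))))
    bound : ∀ i j k₁ k₂ → i + j ≡ a → k₁ + k₂ ≡ k → i + (k₁ + k₁) ≤ n
    bound i j k₁ k₂ refl refl = ≤-trans (+-mono-≤ (m≤m+n i j) (+-mono-≤ (m≤m+n k₁ k₂) (m≤m+n k₁ k₂))) (s≤s⁻¹ le)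
    bound′ : ∀ i j k₁ k₂ → i + j ≡ a → k₁ + k₂ ≡ k → j + (k₂ + k₂) ≤ n
    bound′ i j k₁ k₂ refl refl = ≤-trans (+-mono-≤ (m≤n+m j i) (+-mono-≤ (m≤n+m k₂ k₁) (m≤n+m k₂ k₁))) (s≤s⁻¹ le)
    -- The expansion of (p - q)(p′ - q′) without subtraction.
    quad : ∀ x x′ p q p′ q′ → x + q ≡ p → x′ + q′ ≡ p′ → x * x′ + (p * q′ + q * p′) ≡ p * p′ + q * q′
    quad x x′ _ q _ q′ refl refl = ring x x′ q q′
      where ring : ∀ x x′ q q′ → x * x′ + ((x + q) * q′ + q * (x′ + q′)) ≡ (x + q) * (x′ + q′) + q * q′
            ring = solve-∀

ξ-closed : ∀ a k → ξ a k + k ! * corr a k ≡ k ! * lead a k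
ξ-closed a k = ξ-closed-fuel _ a k ≤-refl

-- Growth in genus zero

-- U = 3/2 at the critical point y = 2/27.
γ-upper : ∀ m k → γ m k * (2 ^ k * 2 ^ m) ≤ 27 ^ k * 3 ^ m
γ-upper zero    zero    = ≤-refl
γ-upper zero    (suc k) = z≤n
γ-upper (suc m) zero    = ≤-trans (≤-reflexive (lem (2 ^ m))) (≤-trans (*-mono-≤ (s≤s (s≤s (z≤n {1}))) (^-monoˡ-≤ m (s≤s (s≤s (z≤n {1})))))
                                  (≤-reflexive (sym (+-identityʳ _))))
  where
  lem : ∀ a → 1 * (1 * (2 * a)) ≡ 2 * a
  lem = solve-∀
γ-upper (suc m) (suc k) = begin
  (γ m (suc k) + 2 * γ (3 + m) k) * (2 * 2 ^ k * (2 * 2 ^ m)) ≡⟨ lem₁ (γ m (suc k)) (γ (3 + m) k) (2 ^ k) (2 ^ m) ⟩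
  2 * (γ m (suc k) * (2 * 2 ^ k * 2 ^ m)) + γ (3 + m) k * (2 ^ k * (2 * (2 * (2 * 2 ^ m))))
     ≤⟨ +-mono-≤ (*-monoʳ-≤ 2 (γ-upper m (suc k))) (γ-upper (3 + m) k) ⟩
  2 * (27 * 27 ^ k * 3 ^ m) + 27 ^ k * (3 * (3 * (3 * 3 ^ m)))  ≡⟨ lem₂ (27 ^ k) (3 ^ m) ⟩
  27 * 27 ^ k * (3 * 3 ^ m) ∎
  where
  open ≤-Reasoning
  lem₁ : ∀ a b u v → (a + 2 * b) * (2 * u * (2 * v)) ≡ 2 * (a * (2 * u * v)) + b * (u * (2 * (2 * (2 * v))))
  lem₁ = solve-∀
  lem₂ : ∀ u v → 2 * (27 * u * v) + u * (3 * (3 * (3 * v))) ≡ 27 * u * (3 * v)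
  lem₂ = solve-∀

ξ-upper : ∀ k → ξ 0 k * 2 ^ k * 2 ≤ k ! * (27 ^ k * 3)
ξ-upper k = begin
  ξ 0 k * 2 ^ k * 2               ≡⟨ *-assoc (ξ 0 k) (2 ^ k) 2 ⟩
  ξ 0 k * (2 ^ k * 2)             ≤⟨ *-monoˡ-≤ (2 ^ k * 2) (≤-trans (m≤m+n (ξ 0 k) _) (≤-reflexive (ξ-closed 0 k))) ⟩
  k ! * (catalan 0 * γ 1 k) * (2 ^ k * 2) ≡⟨ cong (λ z → k ! * (z * γ 1 k) * (2 ^ k * 2)) catalan-zero ⟩
  k ! * (1 * γ 1 k) * (2 ^ k * 2) ≡⟨ lem (k !) (γ 1 k) (2 ^ k * 2) ⟩
  k ! * (γ 1 k * (2 ^ k * 2))     ≤⟨ *-monoʳ-≤ (k !) (γ-upper 1 k) ⟩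
  k ! * (27 ^ k * 3)              ∎
  where
  open ≤-Reasoning
  lem : ∀ f g t → f * (1 * g) * t ≡ f * (g * t)
  lem = solve-∀

-- The closed form at exponent m instead of m + 1. The recursion descends to exponent 0, which has
-- to be covered, and there the factorial (3k + m - 1)! makes sense only for a positive power of y.
γ-part : ℕ → ℕ → Set
γ-part m zero    = ⊤
γ-part m (suc k) = γ m (suc k) * (suc k ! * (2 + (k + k + m)) !) ≡ 2 ^ suc k * (m * (2 + (k + k + k + m)) !)

γ-closed-part : ∀ m k → γ-part m k
-- What Lagrange inversion gives for U = 1 + 2yU³: 2^k times a Fuss-Catalan (Raney) number. It is
-- checked against the recursion of `γ` instead.
γ-closed : ∀ m k → γ (suc m) k * (k ! * (k + k + suc m) !) ≡ 2 ^ k * (suc m * (k + k + k + m) !)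
γ-closed m zero = lem (suc m) (m !)
  where
  lem : ∀ s f → 1 * (1 * (s * f)) ≡ 1 * (s * f)
  lem = solve-∀
γ-closed m (suc k) = begin
  (γ m (suc k) + 2 * γ (3 + m) k) * (suc k ! * (suc k + suc k + suc m) !)
    ≡⟨ cong (λ z → (γ m (suc k) + 2 * γ (3 + m) k) * (suc k ! * z !)) (ix₁ k m) ⟩
  (γ m (suc k) + 2 * γ (3 + m) k) * (suc k * k ! * (3 + (k + k + m)) !)
    ≡⟨ lem₁ (γ m (suc k)) (γ (3 + m) k) (suc k) (k !) ((3 + (k + k + m)) !) ⟩
  γ m (suc k) * (suc k * k ! * ((3 + (k + k + m)) * (2 + (k + k + m)) !)) + 2 * suc k * (γ (3 + m) k * (k ! * (3 + (k + k + m)) !))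
    ≡⟨ cong₂ _+_ (trans (lem₂ (γ m (suc k)) (suc k) (k !) (3 + (k + k + m)) ((2 + (k + k + m)) !)) (cong ((3 + (k + k + m)) *_) (γ-closed-part m (suc k))))
                 (cong (2 * suc k *_) (trans (cong (λ z → γ (3 + m) k * (k ! * z !)) (ix₂ k m)) (trans (γ-closed (2 + m) k) (cong (λ z → 2 ^ k * ((3 + m) * z !)) (ix₃ k m))))) ⟩
  (3 + (k + k + m)) * (2 ^ suc k * (m * t !)) + 2 * suc k * (2 ^ k * ((3 + m) * t !))
    ≡⟨ lem₃ k m (2 ^ k) (t !) ⟩
  2 * 2 ^ k * (suc m * (suc t * t !))
    ≡⟨ cong (λ z → 2 * 2 ^ k * (suc m * z !)) (ix₄ k m) ⟨
  2 ^ suc k * (suc m * (suc k + suc k + suc k + m) !) ∎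
  where
  open ≡-Reasoning
  t = 2 + (k + k + k + m)
  ix₁ : ∀ k m → suc k + suc k + suc m ≡ 3 + (k + k + m)
  ix₁ = solve-∀
  ix₂ : ∀ k m → 3 + (k + k + m) ≡ k + k + suc (2 + m)
  ix₂ = solve-∀
  ix₃ : ∀ k m → k + k + k + (2 + m) ≡ 2 + (k + k + k + m)
  ix₃ = solve-∀
  ix₄ : ∀ k m → suc k + suc k + suc k + m ≡ suc (2 + (k + k + k + m))
  ix₄ = solve-∀
  lem₁ : ∀ a b s f g → (a + 2 * b) * (s * f * g) ≡ a * (s * f * g) + 2 * s * (b * (f * g))
  lem₁ = solve-∀
  lem₂ : ∀ a s f u g → a * (s * f * (u * g)) ≡ u * (a * (s * f * g))
  lem₂ = solve-∀
  lem₃ : ∀ k m P T → (3 + (k + k + m)) * (2 * P * (m * T)) + 2 * suc k * (P * ((3 + m) * T)) ≡ 2 * P * (suc m * (suc (2 + (k + k + k + m)) * T))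
  lem₃ = solve-∀

γ-closed-part m       zero    = tt
γ-closed-part zero    (suc k) = sym (*-zeroʳ (2 ^ suc k))
γ-closed-part (suc m) (suc k) = trans (cong (λ z → γ (suc m) (suc k) * (suc k ! * z !)) (ix₅ k m)) (trans (γ-closed m (suc k)) (cong (λ z → 2 ^ suc k * (suc m * z !)) (ix₆ k m)))
  where
  ix₅ : ∀ k m → 2 + (k + k + suc m) ≡ suc k + suc k + suc m
  ix₅ = solve-∀
  ix₆ : ∀ k m → suc k + suc k + suc k + m ≡ 2 + (k + k + k + suc m)
  ix₆ = solve-∀

-- At x = 0 the closed form is U - yU⁴ = 1 + yU³ - 2y²U⁶. Both powers have factorial coefficients
-- over a common denominator, and 12 = 3(2j + 4) - 6j.
ξ-factorial : ∀ j → ξ 0 (suc j) * (j ! * (4 + (j + j)) !) ≡ suc j ! * (12 * (2 ^ j * (2 + (j + j + j)) !))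
ξ-factorial j = +-cancelʳ-≡ (suc j ! * (2 ^ j * (6 * j * t !))) _ _ (begin
  ξ 0 (suc j) * F + suc j ! * (2 ^ j * (6 * j * t !)) ≡⟨ cong (λ z → ξ 0 (suc j) * F + suc j ! * z) (γ6 j) ⟨
  ξ 0 (suc j) * F + suc j ! * (2 * sh (γ 6) j * F)    ≡⟨ lem₁ (ξ 0 (suc j)) F (suc j !) (sh (γ 6) j) ⟩
  (ξ 0 (suc j) + suc j ! * (2 * sh (γ 6) j)) * F      ≡⟨ cong (_* F) ξ-γ ⟩
  suc j ! * γ 3 j * F                                 ≡⟨ lem₂ (suc j !) (γ 3 j) (j !) (4 + (j + j)) ((3 + (j + j)) !) ⟩
  suc j ! * ((4 + (j + j)) * (γ 3 j * (j ! * (3 + (j + j)) !))) ≡⟨ cong (λ z → suc j ! * ((4 + (j + j)) * z)) γ3 ⟩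
  suc j ! * ((4 + (j + j)) * (2 ^ j * (3 * t !)))     ≡⟨ lem₃ (suc j !) j (2 ^ j) (t !) ⟩
  suc j ! * (12 * (2 ^ j * t !)) + suc j ! * (2 ^ j * (6 * j * t !)) ∎)
  where
  open ≡-Reasoning
  t = 2 + (j + j + j)
  F = j ! * (4 + (j + j)) !
  lem₁ : ∀ x F s g → x * F + s * (2 * g * F) ≡ (x + s * (2 * g)) * F
  lem₁ = solve-∀
  lem₂ : ∀ s g f u v → s * g * (f * (u * v)) ≡ s * (u * (g * (f * v)))
  lem₂ = solve-∀
  lem₃ : ∀ s j P T → s * ((4 + (j + j)) * (P * (3 * T))) ≡ s * (12 * (P * T)) + s * (P * (6 * j * T))
  lem₃ = solve-∀
  γ3 : γ 3 j * (j ! * (3 + (j + j)) !) ≡ 2 ^ j * (3 * t !)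
  γ3 = trans (cong (λ z → γ 3 j * (j ! * z !)) (+-comm 3 (j + j))) (trans (γ-closed 2 j) (cong (λ z → 2 ^ j * (3 * z !)) (+-comm (j + j + j) 2)))
  γ6 : ∀ j → 2 * sh (γ 6) j * (j ! * (4 + (j + j)) !) ≡ 2 ^ j * (6 * j * (2 + (j + j + j)) !)
  γ6 zero    = refl
  γ6 (suc i) = begin
    2 * γ 6 i * (suc i * i ! * (4 + (suc i + suc i)) !) ≡⟨ lem (γ 6 i) (suc i) (i !) ((4 + (suc i + suc i)) !) ⟩
    2 * suc i * (γ 6 i * (i ! * (4 + (suc i + suc i)) !)) ≡⟨ cong (λ z → 2 * suc i * (γ 6 i * (i ! * z !))) (ix i) ⟩
    2 * suc i * (γ 6 i * (i ! * (i + i + 6) !)) ≡⟨ cong (2 * suc i *_) (γ-closed 5 i) ⟩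
    2 * suc i * (2 ^ i * (6 * (i + i + i + 5) !)) ≡⟨ cong (λ z → 2 * suc i * (2 ^ i * (6 * z !))) (ix′ i) ⟩
    2 * suc i * (2 ^ i * (6 * (2 + (suc i + suc i + suc i)) !)) ≡⟨ lem′ (suc i) (2 ^ i) ((2 + (suc i + suc i + suc i)) !) ⟩
    2 * 2 ^ i * (6 * suc i * (2 + (suc i + suc i + suc i)) !) ∎
    where
    lem : ∀ g s f u → 2 * g * (s * f * u) ≡ 2 * s * (g * (f * u))
    lem = solve-∀
    lem′ : ∀ s P T → 2 * s * (P * (6 * T)) ≡ 2 * P * (6 * s * T)
    lem′ = solve-∀
    ix : ∀ i → 4 + (suc i + suc i) ≡ i + i + 6
    ix = solve-∀
    ix′ : ∀ i → i + i + i + 5 ≡ 2 + (suc i + suc i + suc i)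
    ix′ = solve-∀
  ξ-γ : ξ 0 (suc j) + suc j ! * (2 * sh (γ 6) j) ≡ suc j ! * γ 3 j
  ξ-γ = +-cancelʳ-≡ (suc j ! * γ 3 j) _ _ (begin
    ξ 0 (suc j) + suc j ! * (2 * sh (γ 6) j) + suc j ! * γ 3 j ≡⟨ l₁ (ξ 0 (suc j)) (suc j !) (sh (γ 6) j) (γ 3 j) ⟩
    ξ 0 (suc j) + suc j ! * (1 * (γ 3 j + 2 * sh (γ 6) j)) ≡⟨ cong₂ (λ u v → ξ 0 (suc j) + suc j ! * (u * v)) catalan-one (γ-step 3 j) ⟨
    ξ 0 (suc j) + suc j ! * (catalan 1 * γ 4 j) ≡⟨ ξ-closed 0 (suc j) ⟩
    suc j ! * (catalan 0 * γ 1 (suc j)) ≡⟨ cong (λ z → suc j ! * (z * γ 1 (suc j))) catalan-zero ⟩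
    suc j ! * (1 * (0 + 2 * γ 3 j)) ≡⟨ l₂ (suc j !) (γ 3 j) ⟩
    suc j ! * γ 3 j + suc j ! * γ 3 j ∎)
    where
    l₁ : ∀ x s g h → x + s * (2 * g) + s * h ≡ x + s * (1 * (h + 2 * g))
    l₁ = solve-∀
    l₂ : ∀ s h → s * (1 * (0 + 2 * h)) ≡ s * h + s * h
    l₂ = solve-∀

-- This compares the growth of the two sides of `factorial-lower` from j to j + 1, with the common
-- factor 6(j + 1) removed. The difference is a polynomial with nonnegative coefficients.
ratio-poly : ∀ j → 9 * ((3 + j) * (5 + (j + j))) * (suc j * (suc j * suc j))
    ≤ 2 * ((5 + (j + j + j)) * (4 + (j + j + j))) * ((2 + j) * ((2 + j) * (2 + j)))
ratio-poly j = ≤-trans (m≤m+n _ _) (≤-reflexive (poly j))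
  where
  poly : ∀ j → 9 * ((3 + j) * (5 + (j + j))) * (suc j * (suc j * suc j)) + (185 + j * (408 + j * (312 + j * (94 + j * 9))))
    ≡ 2 * ((5 + (j + j + j)) * (4 + (j + j + j))) * ((2 + j) * ((2 + j) * (2 + j)))
  poly = solve-∀

cube : ℕ → ℕ
cube n = n * (n * n)

-- The quotient (3j + 2)! / (j! (2j + 4)!) has order (27/4)^j j^(-5/2), so a cube more than
-- compensates the polynomial loss.
factorial-lower : ∀ j → 27 ^ j * (j ! * (4 + (j + j)) !) ≤ 12 * (4 ^ j * (2 + (j + j + j)) !) * cube (suc j)
factorial-lower zero    = ≤-refl
factorial-lower (suc j) = begin
  27 ^ suc j * (suc j ! * (4 + (suc j + suc j)) !) ≡⟨ cong (λ z → 27 ^ suc j * (suc j ! * z !)) (ix j) ⟩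
  27 ^ suc j * (suc j ! * (6 + (j + j)) !) ≡⟨ lem₁ j 27 (27 ^ j) (j !) (5 + (j + j)) ((4 + (j + j)) !) ⟩
  27 * (suc j * (2 * ((3 + j) * (5 + (j + j))))) * (27 ^ j * (j ! * (4 + (j + j)) !)) ≤⟨ *-monoʳ-≤ (27 * (suc j * (2 * ((3 + j) * (5 + (j + j)))))) (factorial-lower j) ⟩
  27 * (suc j * (2 * ((3 + j) * (5 + (j + j))))) * (12 * (4 ^ j * (2 + (j + j + j)) !) * cube (suc j)) ≡⟨ lem₂ (suc j) ((3 + j) * (5 + (j + j))) 12 (4 ^ j * (2 + (j + j + j)) !) (cube (suc j)) ⟩
  12 * (4 ^ j * (2 + (j + j + j)) !) * (6 * suc j) * (9 * ((3 + j) * (5 + (j + j))) * cube (suc j)) ≤⟨ *-monoʳ-≤ (12 * (4 ^ j * (2 + (j + j + j)) !) * (6 * suc j)) (ratio-poly j) ⟩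
  12 * (4 ^ j * (2 + (j + j + j)) !) * (6 * suc j) * (2 * ((5 + (j + j + j)) * (4 + (j + j + j))) * cube (2 + j)) ≡⟨ lem₃ j 12 (4 ^ j) ((2 + (j + j + j)) !) (5 + (j + j + j)) (4 + (j + j + j)) (cube (2 + j)) ⟩
  12 * (4 ^ suc j * (5 + (j + j + j)) !) * cube (2 + j) ≡⟨ cong (λ z → 12 * (4 ^ suc j * z !) * cube (2 + j)) (ix′ j) ⟨
  12 * (4 ^ suc j * (2 + (suc j + suc j + suc j)) !) * cube (2 + j) ∎
  where
  open ≤-Reasoning
  ix : ∀ j → 4 + (suc j + suc j) ≡ 6 + (j + j)
  ix = solve-∀
  ix′ : ∀ j → 2 + (suc j + suc j + suc j) ≡ 5 + (j + j + j)
  ix′ = solve-∀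
  lem₁ : ∀ j n P f u g → n * P * (suc j * f * ((6 + (j + j)) * (u * g))) ≡ n * (suc j * (2 * ((3 + j) * u))) * (P * (f * g))
  lem₁ = solve-∀
  lem₂ : ∀ s u n v w → 27 * (s * (2 * u)) * (n * v * w) ≡ n * v * (6 * s) * (9 * u * w)
  lem₂ = solve-∀
  lem₃ : ∀ j n P T u v w → n * (P * T) * (6 * suc j) * (2 * (u * v) * w) ≡ n * (4 * P * (u * (v * ((3 + (j + j + j)) * T)))) * w
  lem₃ = solve-∀

ξ-lower : ∀ j → 27 ^ j * suc j ! ≤ ξ 0 (suc j) * 2 ^ j * cube (suc j)
ξ-lower j = *-cancelʳ-≤ (27 ^ j * suc j !) (ξ 0 (suc j) * 2 ^ j * cube (suc j)) F {{m*n≢0 (j !) ((4 + (j + j)) !) {{j !≢0}} {{(4 + (j + j)) !≢0}}}} (begin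
  27 ^ j * suc j ! * F  ≡⟨ lem₁ (27 ^ j) (suc j !) F ⟩
  suc j ! * (27 ^ j * F) ≤⟨ *-monoʳ-≤ (suc j !) (factorial-lower j) ⟩
  suc j ! * (12 * (4 ^ j * T) * cube (suc j)) ≡⟨ cong (λ z → suc j ! * (12 * (z * T) * cube (suc j))) (pow j) ⟩
  suc j ! * (12 * (2 ^ j * 2 ^ j * T) * cube (suc j)) ≡⟨ lem₂ (suc j !) (2 ^ j) T (cube (suc j)) ⟩
  suc j ! * (12 * (2 ^ j * T)) * (2 ^ j * cube (suc j)) ≡⟨ cong (_* (2 ^ j * cube (suc j))) (ξ-factorial j) ⟨
  ξ 0 (suc j) * F * (2 ^ j * cube (suc j)) ≡⟨ lem₃ (ξ 0 (suc j)) F (2 ^ j) (cube (suc j)) ⟩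
  ξ 0 (suc j) * 2 ^ j * cube (suc j) * F ∎)
  where
  open ≤-Reasoning
  F = j ! * (4 + (j + j)) !
  T = (2 + (j + j + j)) !
  pow : ∀ j → 4 ^ j ≡ 2 ^ j * 2 ^ j
  pow zero    = refl
  pow (suc j) = trans (cong (4 *_) (pow j)) (l (2 ^ j))
    where l : ∀ a → 4 * (a * a) ≡ 2 * a * (2 * a)
          l = solve-∀
  lem₁ : ∀ a b c → a * b * c ≡ b * (a * c)
  lem₁ = solve-∀
  lem₂ : ∀ s P T c → s * (12 * (P * P * T) * c) ≡ s * (12 * (P * T)) * (P * c)
  lem₂ = solve-∀
  lem₃ : ∀ x F P c → x * F * (P * c) ≡ x * P * c * F
  lem₃ = solve-∀

-- Monotone words

Unique-resp-↭ : ∀ {xs ys : List A} → xs ↭ ys → Unique xs → Unique ys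
Unique-resp-↭ ↭.refl          u                  = u
Unique-resp-↭ (↭.prep x p)    (a ∷ u)            = All-resp-↭ p a ∷ Unique-resp-↭ p u
Unique-resp-↭ (↭.swap x y p)  ((x≢y ∷ a) ∷ b ∷ u) = ((x≢y ∘ sym) ∷ All-resp-↭ p b) ∷ All-resp-↭ p a ∷ Unique-resp-↭ p u
Unique-resp-↭ (↭.trans p q)   u                  = Unique-resp-↭ q (Unique-resp-↭ p u)

-- A word lists the steps of a walk with the last step first.
Word : ℕ → Set
Word d = List (Transp d)

end : Word d → Fin d → Fin d
end []      y = y
end (τ ∷ w) y = end w (swap τ y)

swap-left : ∀ (s t : Fin d) → swap (s , t) s ≡ t
swap-left s t with s ≟ s
... | yes _   = refl
... | no  s≢s = ⊥-elim (s≢s refl)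

swap-right : ∀ (s t : Fin d) → swap (s , t) t ≡ s
swap-right s t with t ≟ s
... | yes t≡s = t≡s
... | no  _ with t ≟ t
...   | yes _   = refl
...   | no  t≢t = ⊥-elim (t≢t refl)

swap-other : ∀ {s t y : Fin d} → y ≢ s → y ≢ t → swap (s , t) y ≡ y
swap-other {s = s} {t} {y} y≢s y≢t with y ≟ s
... | yes y≡s = ⊥-elim (y≢s y≡s)
... | no  _ with y ≟ t
...   | yes y≡t = ⊥-elim (y≢t y≡t)
...   | no  _   = refl

swap-cases : ∀ (s t y : Fin d) → (y ≡ s × swap (s , t) y ≡ t) ⊎ ((y ≡ t × swap (s , t) y ≡ s) ⊎ (y ≢ s × y ≢ t × swap (s , t) y ≡ y))
swap-cases s t y with y ≟ s
... | yes y≡s = inj₁ (y≡s , refl)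
... | no  y≢s with y ≟ t
...   | yes y≡t = inj₂ (inj₁ (y≡t , refl))
...   | no  y≢t = inj₂ (inj₂ (y≢s , y≢t , refl))

swap-sym : ∀ (s t y : Fin d) → swap (s , t) y ≡ swap (t , s) y
swap-sym s t y with swap-cases s t y
... | inj₁ (refl , e)               = trans e (sym (swap-right t s))
... | inj₂ (inj₁ (refl , e))        = trans e (sym (swap-left t s))
... | inj₂ (inj₂ (y≢s , y≢t , e)) = trans e (sym (swap-other y≢t y≢s))

swap-involutive : ∀ (τ : Transp d) y → swap τ (swap τ y) ≡ y
swap-involutive (s , t) y with swap-cases s t y
... | inj₁ (refl , e)               = trans (cong (swap (s , t)) e) (swap-right s t)
... | inj₂ (inj₁ (refl , e))        = trans (cong (swap (s , t)) e) (swap-left s t)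
... | inj₂ (inj₂ (y≢s , y≢t , e)) = trans (cong (swap (s , t)) e) e

swap-injective : ∀ (τ : Transp d) {y z} → swap τ y ≡ swap τ z → y ≡ z
swap-injective τ {y} {z} e = trans (sym (swap-involutive τ y)) (trans (cong (swap τ) e) (swap-involutive τ z))

swap-conj : ∀ (g : Fin d → Fin d) → (∀ {y z} → g y ≡ g z → y ≡ z) → ∀ u v y → g (swap (u , v) y) ≡ swap (g u , g v) (g y)
swap-conj g inj u v y with swap-cases u v y
... | inj₁ (refl , e)               = trans (cong g e) (sym (swap-left (g u) (g v)))
... | inj₂ (inj₁ (refl , e))        = trans (cong g e) (sym (swap-right (g u) (g v)))
... | inj₂ (inj₂ (y≢u , y≢v , e)) = trans (cong g e) (sym (swap-other (y≢u ∘ inj) (y≢v ∘ inj)))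

-- A representative of the connected component of y in the graph with the steps of w as edges.
merge : Fin d → Fin d → Fin d → Fin d
merge u v z with z ≟ u
... | yes _ = v
... | no  _ = z

comp : Word d → Fin d → Fin d
comp []            y = y
comp ((s , t) ∷ w) y = merge (comp w s) (comp w t) (comp w y)

Joined : (Fin d → B) → Word d → Set
Joined f = All (λ τ → f (proj₁ τ) ≡ f (proj₂ τ))

merge-left : ∀ (u v : Fin d) → merge u v u ≡ v
merge-left u v with u ≟ u
... | yes _   = refl
... | no  u≢u = ⊥-elim (u≢u refl)

merge-right : ∀ (u v : Fin d) → merge u v v ≡ v
merge-right u v with v ≟ u
... | yes _ = refl
... | no  _ = refl

comp-coarsen : ∀ (τ : Transp d) w {y z} → comp w y ≡ comp w z → comp (τ ∷ w) y ≡ comp (τ ∷ w) z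
comp-coarsen (s , t) w = cong (merge (comp w s) (comp w t))

comp-joined : ∀ (w : Word d) → Joined (comp w) w
comp-joined []            = []
comp-joined ((s , t) ∷ w) = trans (merge-left (comp w s) (comp w t)) (sym (merge-right (comp w s) (comp w t)))
                          ∷ All.map (comp-coarsen (s , t) w) (comp-joined w)

-- Together with `comp-joined` this is the universal property of the components: `comp w` is the
-- finest function that is constant along the steps. Later arguments about components choose a
-- suitable f.
comp-least : ∀ (f : Fin d → B) w → Joined f w → ∀ {y z} → comp w y ≡ comp w z → f y ≡ f z
comp-least f []            _       e = cong f e
comp-least f ((s , t) ∷ w) (j ∷ js) {y} {z} e with comp w y ≟ comp w s | comp w z ≟ comp w s
... | yes p | yes q = comp-least f w js (trans p (sym q))
... | yes p | no  q = trans (comp-least f w js p) (trans j (comp-least f w js e))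
... | no  p | yes q = trans (comp-least f w js e) (trans (sym j) (sym (comp-least f w js q)))
... | no  p | no  q = comp-least f w js e

infix 4 _≈_
-- The two data that Hurwitz moves preserve. Components are compared through equality of `comp`
-- values, because the representatives themselves may change.
record _≈_ (w w′ : Word d) : Set where
  constructor mk≈
  field
    end≈ : ∀ y → end w y ≡ end w′ y
    to≈  : ∀ {y z} → comp w y ≡ comp w z → comp w′ y ≡ comp w′ z
    from≈ : ∀ {y z} → comp w′ y ≡ comp w′ z → comp w y ≡ comp w z
open _≈_ public

≈-intro : ∀ {w w′ : Word d} → (∀ y → end w y ≡ end w′ y) → Joined (comp w′) w → Joined (comp w) w′ → w ≈ w′
≈-intro {w = w} {w′} e j j′ = mk≈ e (comp-least (comp w′) w j) (comp-least (comp w) w′ j′)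

≈-sym : ∀ {w w′ : Word d} → w ≈ w′ → w′ ≈ w
≈-sym p = mk≈ (λ y → sym (end≈ p y)) (from≈ p) (to≈ p)

≈-cons : ∀ (τ : Transp d) {w w′} → w ≈ w′ → τ ∷ w ≈ τ ∷ w′
≈-cons τ {w} {w′} p = ≈-intro (λ y → end≈ p (swap τ y))
  (All.head (comp-joined (τ ∷ w′)) ∷ All.map (comp-coarsen τ w′ ∘ to≈ p) (comp-joined w))
  (All.head (comp-joined (τ ∷ w)) ∷ All.map (comp-coarsen τ w ∘ from≈ p) (comp-joined w′))

≈-prefix : ∀ (v : Word d) {w w′} → w ≈ w′ → v ++ w ≈ v ++ w′
≈-prefix []      p = p
≈-prefix (τ ∷ v) p = ≈-cons τ (≈-prefix v p)

≈-flip : ∀ (a b : Fin d) w → (b , a) ∷ w ≈ (a , b) ∷ w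
≈-flip a b w = ≈-intro (λ y → cong (end w) (swap-sym b a y))
  (sym (All.head (comp-joined ((a , b) ∷ w))) ∷ All.tail (comp-joined ((a , b) ∷ w)))
  (sym (All.head (comp-joined ((b , a) ∷ w))) ∷ All.tail (comp-joined ((b , a) ∷ w)))

-- Conjugating (s a) by (t b) moves s only, as a is neither t nor b. The new partner lies in the
-- same component as s since t and b are joined.
≈-hurwitz : ∀ {a b t : Fin d} s w → a ≢ t → a ≢ b → (t , b) ∷ (s , a) ∷ w ≈ (swap (t , b) s , a) ∷ (t , b) ∷ w
≈-hurwitz {a = a} {b} {t} s w a≢t a≢b = ≈-intro
  (λ y → cong (end w) (trans (cong₂ (λ u v → swap (u , v) (swap (t , b) y)) (sym (swap-involutive (t , b) s)) (sym (swap-other a≢t a≢b)))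
      (sym (swap-conj (swap (t , b)) (swap-injective (t , b)) (swap (t , b) s) a y))))
  (tb ∷ trans (sym s′~s) sa ∷ All.tail (All.tail (comp-joined w₂)))
  (trans s′~s₁ sa₁ ∷ tb₁ ∷ All.tail (All.tail (comp-joined w₁)))
  where
  w₁ w₂ : Word _
  w₁ = (t , b) ∷ (s , a) ∷ w
  w₂ = (swap (t , b) s , a) ∷ (t , b) ∷ w
  swap-joined : ∀ (f : Fin _ → Fin _) → f t ≡ f b → f (swap (t , b) s) ≡ f s
  swap-joined f e with swap-cases t b s
  ... | inj₁ (refl , q)        = trans (cong f q) (sym e)
  ... | inj₂ (inj₁ (refl , q)) = trans (cong f q) e
  ... | inj₂ (inj₂ (_ , _ , q)) = cong f q
  sa   = All.head (comp-joined w₂)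
  tb   = All.head (All.tail (comp-joined w₂))
  s′~s = swap-joined (comp w₂) tb
  tb₁  = All.head (comp-joined w₁)
  sa₁  = All.head (All.tail (comp-joined w₁))
  s′~s₁ = swap-joined (comp w₁) tb₁

-- Conjugation by (a b) turns (t b) into (t a). This supplies the products in which the step (a b)
-- itself changes from colour a to colour b.
≈-triangle : ∀ {a b t : Fin d} w → t ≢ a → t ≢ b → (b , a) ∷ (t , b) ∷ w ≈ (t , a) ∷ (a , b) ∷ w
≈-triangle {a = a} {b} {t} w t≢a t≢b = ≈-intro
  (λ y → cong (end w) (trans (cong₂ (λ u v → swap (u , v) (swap (b , a) y)) (sym (swap-other t≢b t≢a)) (sym (swap-right b a)))
      (trans (sym (swap-conj (swap (b , a)) (swap-injective (b , a)) t a y)) (swap-sym b a (swap (t , a) y)))))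
  (sym ab ∷ trans ta ab ∷ All.tail (All.tail (comp-joined w₂)))
  (trans tb₁ ba₁ ∷ sym ba₁ ∷ All.tail (All.tail (comp-joined w₁)))
  where
  w₁ w₂ : Word _
  w₁ = (b , a) ∷ (t , b) ∷ w
  w₂ = (t , a) ∷ (a , b) ∷ w
  ta  = All.head (comp-joined w₂)
  ab  = All.head (All.tail (comp-joined w₂))
  ba₁ = All.head (comp-joined w₁)
  tb₁ = All.head (All.tail (comp-joined w₁))

-- Sums over monotone words as symmetric functions of Jucys-Murphy elements

step : List (Fin d) → Fin d → (Word d → ℕ) → Word d → ℕ
step L k f w = ∑ L (λ s → f ((s , k) ∷ w))

-- P L r f is the sum of f over the monotone words of length r whose colours lie in L,
-- for the order in which L is decreasing.
P : List (Fin d) → ℕ → (Word d → ℕ) → ℕ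
P []      zero    f = f []
P []      (suc r) f = 0
P (k ∷ L) zero    f = f []
P (k ∷ L) (suc r) f = P L (suc r) f + P (k ∷ L) r (step L k f)

P-zero-length : ∀ (L : List (Fin d)) f → P L 0 f ≡ f []
P-zero-length []      f = refl
P-zero-length (k ∷ L) f = refl

Within : (Fin d → Set) → Word d → Set
Within M = All (λ τ → M (proj₁ τ) × M (proj₂ τ))

P-congᴹ : ∀ (M : Fin d → Set) L → All M L → ∀ r {f g} → (∀ w → Within M w → f w ≡ g w) → P L r f ≡ P L r g
P-congᴹ M []      _        zero    e = e [] []
P-congᴹ M []      _        (suc r) e = refl
P-congᴹ M (k ∷ L) _        zero    e = e [] []
P-congᴹ M (k ∷ L) (m ∷ ms) (suc r) e = cong₂ _+_ (P-congᴹ M L ms (suc r) e)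
  (P-congᴹ M (k ∷ L) (m ∷ ms) r (λ w i → ∑-congᴬ (All.map (λ ms → e _ ((ms , m) ∷ i)) ms)))

P-monoᴹ : ∀ (M : Fin d → Set) L → All M L → ∀ r {f g} → (∀ w → Within M w → f w ≤ g w) → P L r f ≤ P L r g
P-monoᴹ M []      _        zero    e = e [] []
P-monoᴹ M []      _        (suc r) e = z≤n
P-monoᴹ M (k ∷ L) _        zero    e = e [] []
P-monoᴹ M (k ∷ L) (m ∷ ms) (suc r) e = +-mono-≤ (P-monoᴹ M L ms (suc r) e)
  (P-monoᴹ M (k ∷ L) (m ∷ ms) r (λ w i → ∑-monoᴬ (All.map (λ ms → e _ ((ms , m) ∷ i)) ms)))

P-cong : ∀ (L : List (Fin d)) r {f g} → (∀ w → f w ≡ g w) → P L r f ≡ P L r g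
P-cong L r e = P-congᴹ (λ _ → ⊤) L (All.tabulate (λ _ → tt)) r (λ w _ → e w)

P-+ : ∀ (L : List (Fin d)) r f g → P L r (λ w → f w + g w) ≡ P L r f + P L r g
P-+ []      zero    f g = refl
P-+ []      (suc r) f g = refl
P-+ (k ∷ L) zero    f g = refl
P-+ (k ∷ L) (suc r) f g = trans (cong₂ _+_ (P-+ L (suc r) f g)
  (trans (P-cong (k ∷ L) r (λ w → ∑-+ L _ _)) (P-+ (k ∷ L) r (step L k f) (step L k g))))
  (+-interchange (P L (suc r) f) _ _ _)

P-zero : ∀ (L : List (Fin d)) r → P L r (λ _ → 0) ≡ 0
P-zero []      zero    = refl
P-zero []      (suc r) = refl
P-zero (k ∷ L) zero    = refl
P-zero (k ∷ L) (suc r) = cong₂ _+_ (P-zero L (suc r)) (trans (P-cong (k ∷ L) r (λ w → ∑-zero L)) (P-zero (k ∷ L) r))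

P-∑ : ∀ (L : List (Fin d)) r (xs : List A) (f : A → Word d → ℕ) → P L r (λ w → ∑ xs (λ x → f x w)) ≡ ∑ xs (λ x → P L r (f x))
P-∑ L r []       f = P-zero L r
P-∑ L r (x ∷ xs) f = trans (P-+ L r (f x) _) (cong (P L r (f x) +_) (P-∑ L r xs f))

P-* : ∀ (L : List (Fin d)) r c f → P L r (λ w → c * f w) ≡ c * P L r f
P-* []      zero    c f = refl
P-* []      (suc r) c f = sym (*-zeroʳ c)
P-* (k ∷ L) zero    c f = refl
P-* (k ∷ L) (suc r) c f = trans (cong₂ _+_ (P-* L (suc r) c f)
  (trans (P-cong (k ∷ L) r (λ w → ∑-*ˡ L c _)) (P-* (k ∷ L) r c (step L k f)))) (sym (*-distribˡ-+ c (P L (suc r) f) _))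

Invariant : (Word d → ℕ) → Set
Invariant f = ∀ {w w′} → w ≈ w′ → f w ≡ f w′

step-invariant : ∀ (L : List (Fin d)) k {f} → Invariant f → Invariant (step L k f)
step-invariant L k inv p = ∑-cong L (λ s → inv (≈-cons (s , k) p))

∑-swap-fixed : ∀ {t b : Fin d} {L} → t ∉ L → b ∉ L → ∀ g → ∑ L (g ∘ swap (t , b)) ≡ ∑ L g
∑-swap-fixed {L = []}    t∉ b∉ g = refl
∑-swap-fixed {L = u ∷ L} t∉ b∉ g = cong₂ _+_ (cong g (swap-other (λ e → t∉ (here (sym e))) (λ e → b∉ (here (sym e)))))
  (∑-swap-fixed (t∉ ∘ there) (b∉ ∘ there) g)

∈-All≢ : ∀ {x : A} {xs} → All (x ≢_) xs → x ∉ xs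
∈-All≢ (x≢y ∷ a) (here e)  = x≢y e
∈-All≢ (x≢y ∷ a) (there m) = ∈-All≢ a m

∑-swap-half : ∀ {t b : Fin d} {L} → t ∈ L → b ∉ L → Unique L → ∀ g → ∑ L (g ∘ swap (t , b)) + g t ≡ ∑ L g + g b
∑-swap-half {t = t} {b} {t ∷ L} (here refl) b∉ (a ∷ u) g = trans
  (cong₂ (λ x y → g x + y + g t) (swap-left t b) (∑-swap-fixed (∈-All≢ a) (b∉ ∘ there) g)) (lem (g b) (∑ L g) (g t))
  where
  lem : ∀ x y z → x + y + z ≡ z + y + x
  lem = solve-∀
∑-swap-half {t = t} {b} {v ∷ L} (there t∈) b∉ (a ∷ u) g = begin
  g (swap (t , b) v) + ∑ L (g ∘ swap (t , b)) + g t ≡⟨ +-assoc (g (swap (t , b) v)) _ _ ⟩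
  g (swap (t , b) v) + (∑ L (g ∘ swap (t , b)) + g t)
    ≡⟨ cong₂ _+_ (cong g (swap-other (λ e → ∈-All≢ a (subst (_∈ L) (sym e) t∈)) (λ e → b∉ (here (sym e))))) (∑-swap-half t∈ (b∉ ∘ there) u g) ⟩
  g v + (∑ L g + g b) ≡⟨ +-assoc (g v) _ _ ⟨
  g v + ∑ L g + g b ∎
  where open ≡-Reasoning

∑-swap-reindex : ∀ {t b : Fin d} {L} → t ∈ L → b ∉ L → Unique L → ∀ g → ∑ (b ∷ L) (g ∘ swap (t , b)) ≡ ∑ (b ∷ L) g
∑-swap-reindex {t = t} {b} {L} t∈ b∉ u g = trans (cong (λ x → g x + ∑ L (g ∘ swap (t , b))) (swap-right t b))
  (trans (+-comm (g t) _) (trans (∑-swap-half t∈ b∉ u g) (+-comm _ (g b))))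

-- The complete symmetric functions h_r of two colours satisfy h_(r+2) + xy h_r = (x + y) h_(r+1).
P-two : ∀ (a b : Fin d) L r f →
  P (a ∷ b ∷ L) (2 + r) f + P (a ∷ b ∷ L) r (step (b ∷ L) a (step L b f))
  ≡ P L (2 + r) f + P (a ∷ b ∷ L) (suc r) (λ w → step L b f w + step (b ∷ L) a f w)
P-two a b L r f = begin
  (P L (2 + r) f + P (b ∷ L) (suc r) (step L b f) + P (a ∷ b ∷ L) (suc r) (step (b ∷ L) a f)) + P (a ∷ b ∷ L) r (step (b ∷ L) a (step L b f))
    ≡⟨ lem (P L (2 + r) f) _ _ _ ⟩
  P L (2 + r) f + (P (a ∷ b ∷ L) (suc r) (step L b f) + P (a ∷ b ∷ L) (suc r) (step (b ∷ L) a f))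
    ≡⟨ cong (P L (2 + r) f +_) (P-+ (a ∷ b ∷ L) (suc r) (step L b f) (step (b ∷ L) a f)) ⟨
  P L (2 + r) f + P (a ∷ b ∷ L) (suc r) (λ w → step L b f w + step (b ∷ L) a f w) ∎
  where
  open ≡-Reasoning
  lem : ∀ x y z t → (x + y + z) + t ≡ x + ((y + t) + z)
  lem = solve-∀

module _ {a b : Fin d} {L} (a≢b : a ≢ b) (a∉L : a ∉ L) (b∉L : b ∉ L) (uL : Unique L) where

  -- Only the transposition (a b) depends on the order: it belongs to the larger of its two points.
  linear-symmetric : ∀ {f} → Invariant f → ∀ w → step L b f w + step (b ∷ L) a f w ≡ step L a f w + step (a ∷ L) b f w
  linear-symmetric {f} inv w = trans (cong (λ z → step L b f w + (z + step L a f w)) (inv (≈-flip a b w)))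
                                     (lem (step L b f w) (f ((a , b) ∷ w)) (step L a f w))
    where
    lem : ∀ x y z → x + (y + z) ≡ z + (y + x)
    lem = solve-∀

  -- The commutation of Jucys-Murphy elements. A Hurwitz move past (t b) permutes the partners s in
  -- b ∷ L, so the sum over s can be reindexed; the term s = b is then handled by `≈-triangle`.
  quadratic-symmetric : ∀ {f} → Invariant f → ∀ w → step (b ∷ L) a (step L b f) w ≡ step (a ∷ L) b (step L a f) w
  quadratic-symmetric {f} inv w = begin
    ∑ (b ∷ L) (λ s → ∑ L (λ t → f ((t , b) ∷ (s , a) ∷ w)))
      ≡⟨ ∑-swap (b ∷ L) L _ ⟩
    ∑ L (λ t → ∑ (b ∷ L) (λ s → f ((t , b) ∷ (s , a) ∷ w)))
      ≡⟨ ∑-congᴬ (All.tabulate (λ {t} t∈ → trans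
           (∑-cong (b ∷ L) (λ s → inv (≈-hurwitz s w (λ e → a∉L (subst (_∈ L) (sym e) t∈)) a≢b)))
           (∑-swap-reindex t∈ b∉L uL (λ s → f ((s , a) ∷ (t , b) ∷ w))))) ⟩
    ∑ L (λ t → f ((b , a) ∷ (t , b) ∷ w) + ∑ L (λ s → f ((s , a) ∷ (t , b) ∷ w)))
      ≡⟨ ∑-+ L _ _ ⟩
    ∑ L (λ t → f ((b , a) ∷ (t , b) ∷ w)) + ∑ L (λ t → ∑ L (λ s → f ((s , a) ∷ (t , b) ∷ w)))
      ≡⟨ cong (_+ ∑ L (λ t → ∑ L (λ s → f ((s , a) ∷ (t , b) ∷ w))))
          (∑-congᴬ (All.tabulate (λ {t} t∈ → inv (≈-triangle w (λ e → a∉L (subst (_∈ L) e t∈)) (λ e → b∉L (subst (_∈ L) e t∈)))))) ⟩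
    ∑ L (λ t → f ((t , a) ∷ (a , b) ∷ w)) + ∑ L (λ t → ∑ L (λ s → f ((s , a) ∷ (t , b) ∷ w))) ∎
    where open ≡-Reasoning

-- By `P-two` the sum is determined by the sum and the product of the two adjacent elements, and
-- both are insensitive to the exchange. Induction on r applies because the `step` operators
-- preserve invariance.
P-transpose : ∀ {a b : Fin d} {L} → a ≢ b → a ∉ L → b ∉ L → Unique L → ∀ r {f} → Invariant f → P (a ∷ b ∷ L) r f ≡ P (b ∷ a ∷ L) r f
P-transpose a≢b a∉ b∉ u zero    inv = refl
P-transpose {a = a} {b} {L} a≢b a∉ b∉ u (suc zero) {f} inv = begin
  P L 1 f + P (b ∷ L) 0 (step L b f) + P (a ∷ b ∷ L) 0 (step (b ∷ L) a f) ≡⟨ +-assoc (P L 1 f) _ _ ⟩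
  P L 1 f + (step L b f [] + step (b ∷ L) a f [])  ≡⟨ cong (P L 1 f +_) (linear-symmetric a≢b a∉ b∉ u inv []) ⟩
  P L 1 f + (step L a f [] + step (a ∷ L) b f [])  ≡⟨ +-assoc (P L 1 f) _ _ ⟨
  P (b ∷ a ∷ L) 1 f ∎
  where open ≡-Reasoning
P-transpose {a = a} {b} {L} a≢b a∉ b∉ u (suc (suc r)) {f} inv =
  +-cancelʳ-≡ (P (a ∷ b ∷ L) r (step (b ∷ L) a (step L b f))) _ _ (begin
  P (a ∷ b ∷ L) (2 + r) f + P (a ∷ b ∷ L) r (step (b ∷ L) a (step L b f))
    ≡⟨ P-two a b L r f ⟩
  P L (2 + r) f + P (a ∷ b ∷ L) (suc r) (λ w → step L b f w + step (b ∷ L) a f w)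
    ≡⟨ cong (P L (2 + r) f +_) (trans
         (P-transpose a≢b a∉ b∉ u (suc r) (λ p → cong₂ _+_ (step-invariant L b inv p) (step-invariant (b ∷ L) a inv p)))
         (P-cong (b ∷ a ∷ L) (suc r) (linear-symmetric a≢b a∉ b∉ u inv))) ⟩
  P L (2 + r) f + P (b ∷ a ∷ L) (suc r) (λ w → step L a f w + step (a ∷ L) b f w)
    ≡⟨ P-two b a L r f ⟨
  P (b ∷ a ∷ L) (2 + r) f + P (b ∷ a ∷ L) r (step (a ∷ L) b (step L a f))
    ≡⟨ cong (P (b ∷ a ∷ L) (2 + r) f +_) (trans
         (P-cong (b ∷ a ∷ L) r (λ w → sym (quadratic-symmetric a≢b a∉ b∉ u inv w)))
         (P-transpose (a≢b ∘ sym) b∉ a∉ u r (step-invariant (b ∷ L) a (step-invariant L b inv)))) ⟩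
  P (b ∷ a ∷ L) (2 + r) f + P (a ∷ b ∷ L) r (step (b ∷ L) a (step L b f)) ∎)
  where open ≡-Reasoning

P-prep : ∀ (x : Fin d) {L L′} → L ↭ L′ → (∀ r {f} → Invariant f → P L r f ≡ P L′ r f) → ∀ r {f} → Invariant f → P (x ∷ L) r f ≡ P (x ∷ L′) r f
P-prep x p e zero    inv = refl
P-prep x {L} {L′} p e (suc r) {f} inv = cong₂ _+_ (e (suc r) inv)
  (trans (P-prep x p e r (step-invariant L x inv)) (P-cong (x ∷ L′) r (λ w → ∑-↭ p _)))

-- The conjugation invariance, corresponding to the centrality of symmetric functions of
-- Jucys-Murphy elements. It allows any label to be treated as the largest colour.
P-↭ : ∀ {L L′ : List (Fin d)} → L ↭ L′ → Unique L → ∀ r {f} → Invariant f → P L r f ≡ P L′ r f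
P-↭ ↭.refl         u       r inv = refl
P-↭ (↭.prep x p)   (a ∷ u) r inv = P-prep x p (P-↭ p u) r inv
P-↭ (↭.swap x y p) ((x≢y ∷ a) ∷ b ∷ u) r inv = trans (P-transpose x≢y (∈-All≢ a) (∈-All≢ b) u r inv)
  (P-prep y (↭.prep x p) (P-prep x p (P-↭ p u)) r inv)
P-↭ (↭.trans p q)  u       r inv = trans (P-↭ p u r inv) (P-↭ q (Unique-resp-↭ p u) r inv)

-- Steps joining M₁ to M₂ are killed by g, so a word contributing to the sum is a word on L₂ followed by one on L₁.
P-product : ∀ (M₁ M₂ : Fin d → Set) L₁ L₂ → All M₁ L₁ → All M₂ L₂ → ∀ r (g f₁ f₂ : Word d → ℕ) →
  (∀ w₁ w₂ → Within M₁ w₁ → Within M₂ w₂ → g (w₁ ++ w₂) ≡ f₁ w₁ * f₂ w₂) →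
  (∀ u s k v → M₂ s → M₁ k → g (u ++ (s , k) ∷ v) ≡ 0) →
  P (L₁ ++ L₂) r g ≡ conv r (λ r₁ r₂ → P L₁ r₁ f₁ * P L₂ r₂ f₂)
P-product M₁ M₂ [] L₂ ms₁ ms₂ r g f₁ f₂ e z = trans
  (trans (P-congᴹ M₂ L₂ ms₂ r (λ w i → e [] w [] i)) (P-* L₂ r (f₁ []) f₂)) (sym (lem r))
  where
  lem : ∀ r → conv r (λ r₁ r₂ → P [] r₁ f₁ * P L₂ r₂ f₂) ≡ f₁ [] * P L₂ r f₂
  lem zero    = refl
  lem (suc r) = trans (cong (f₁ [] * P L₂ (suc r) f₂ +_) (conv-zero r)) (+-identityʳ _)
P-product M₁ M₂ (k ∷ L₁) L₂ (m ∷ ms₁) ms₂ zero g f₁ f₂ e z = trans (e [] [] [] []) (cong (f₁ [] *_) (sym (P-zero-length L₂ f₂)))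
P-product M₁ M₂ (k ∷ L₁) L₂ (m ∷ ms₁) ms₂ (suc r) g f₁ f₂ e z = begin
  P (L₁ ++ L₂) (suc r) g + P (k ∷ L₁ ++ L₂) r (step (L₁ ++ L₂) k g)
    ≡⟨ cong₂ _+_ (P-product M₁ M₂ L₁ L₂ ms₁ ms₂ (suc r) g f₁ f₂ e z)
         (P-product M₁ M₂ (k ∷ L₁) L₂ (m ∷ ms₁) ms₂ r (step (L₁ ++ L₂) k g) (step L₁ k f₁) f₂
            (λ w₁ w₂ i₁ i₂ → trans (∑-++ L₁ L₂ _) (trans (cong₂ _+_
                (∑-congᴬ (All.map (λ {s} ms → e ((s , k) ∷ w₁) w₂ ((ms , m) ∷ i₁) i₂) ms₁))
                (trans (∑-congᴬ (All.map (λ {s} ms → z [] s k (w₁ ++ w₂) ms m) ms₂)) (∑-zero L₂)))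
              (trans (+-identityʳ _) (∑-*ʳ L₁ (f₂ w₂) _))))
            (λ u s k′ v ms mk → trans (∑-cong (L₁ ++ L₂) (λ s′ → z ((s′ , k) ∷ u) s k′ v ms mk)) (∑-zero (L₁ ++ L₂)))) ⟩
  conv (suc r) (λ r₁ r₂ → P L₁ r₁ f₁ * P L₂ r₂ f₂) + conv r (λ r₁ r₂ → P (k ∷ L₁) r₁ (step L₁ k f₁) * P L₂ r₂ f₂)
    ≡⟨ +-assoc (P L₁ 0 f₁ * P L₂ (suc r) f₂) _ _ ⟩
  P L₁ 0 f₁ * P L₂ (suc r) f₂ + (conv r (λ r₁ r₂ → P L₁ (suc r₁) f₁ * P L₂ r₂ f₂) + conv r (λ r₁ r₂ → P (k ∷ L₁) r₁ (step L₁ k f₁) * P L₂ r₂ f₂))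
    ≡⟨ cong₂ _+_ (cong (_* P L₂ (suc r) f₂) (P-zero-length L₁ f₁)) (sym (conv-+ r _ _)) ⟩
  f₁ [] * P L₂ (suc r) f₂ + conv r (λ r₁ r₂ → P L₁ (suc r₁) f₁ * P L₂ r₂ f₂ + P (k ∷ L₁) r₁ (step L₁ k f₁) * P L₂ r₂ f₂)
    ≡⟨ cong (f₁ [] * P L₂ (suc r) f₂ +_) (conv-cong r (λ r₁ r₂ → sym (*-distribʳ-+ (P L₂ r₂ f₂) (P L₁ (suc r₁) f₁) _))) ⟩
  conv (suc r) (λ r₁ r₂ → P (k ∷ L₁) r₁ f₁ * P L₂ r₂ f₂) ∎
  where open ≡-Reasoning

-- Cycles and connectedness

swap-joined : ∀ (f : Fin d → A) {s t} → f s ≡ f t → ∀ y → f (swap (s , t) y) ≡ f y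
swap-joined f {s} {t} e y with swap-cases s t y
... | inj₁ (refl , q)         = trans (cong f q) (sym e)
... | inj₂ (inj₁ (refl , q))  = trans (cong f q) e
... | inj₂ (inj₂ (_ , _ , q)) = cong f q

end-joined : ∀ (f : Fin d → A) w → Joined f w → ∀ y → f (end w y) ≡ f y
end-joined f []      []       y = refl
end-joined f (τ ∷ w) (j ∷ js) y = trans (end-joined f w js (swap τ y)) (swap-joined f j y)

comp-end : ∀ (w : Word d) y → comp w (end w y) ≡ comp w y
comp-end w = end-joined (comp w) w (comp-joined w)

end-++ : ∀ (v w : Word d) y → end (v ++ w) y ≡ end w (end v y)
end-++ []      w y = refl
end-++ (τ ∷ v) w y = end-++ v w (swap τ y)

-- A cycle x ↦ l₁ ↦ … ↦ lₙ ↦ x is stored as (x , l).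
Cycle : ℕ → Set
Cycle d = Fin d × List (Fin d)

elems : Cycle d → List (Fin d)
elems (x , l) = x ∷ l

labels : List (Cycle d) → List (Fin d)
labels = concatMap elems

Path : (Fin d → Fin d) → Fin d → List (Fin d) → Fin d → Set
Path σ x []      z = σ x ≡ z
Path σ x (y ∷ l) z = σ x ≡ y × Path σ y l z

IsCycle : (Fin d → Fin d) → Cycle d → Set
IsCycle σ (x , l) = Path σ x l x

Cycles : (Fin d → Fin d) → List (Cycle d) → Set
Cycles σ = All (IsCycle σ)

path? : ∀ (σ : Fin d → Fin d) x l z → Dec (Path σ x l z)
path? σ x []      z = σ x ≟ z
path? σ x (y ∷ l) z = (σ x ≟ y) ×-dec path? σ y l z

cycles? : ∀ (σ : Fin d → Fin d) cs → Dec (Cycles σ cs)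
cycles? σ = all? (λ { (x , l) → path? σ x l x })

Path-transfer : ∀ {σ σ′ : Fin d → Fin d} {u v} l {z} → All (λ y → σ′ y ≡ σ y) l → σ′ u ≡ σ v → Path σ′ u l z → Path σ v l z
Path-transfer []      _        e p       = trans (sym e) p
Path-transfer (y ∷ l) (e′ ∷ a) e (p , q) = trans (sym e) p , Path-transfer l a e′ q

Cycles-congᴸ : ∀ {σ σ′ : Fin d → Fin d} {cs} → All (λ y → σ′ y ≡ σ y) (labels cs) → Cycles σ′ cs → Cycles σ cs
Cycles-congᴸ {cs = []}     _       []       = []
Cycles-congᴸ {cs = c ∷ cs} (e ∷ a) (p ∷ ps) = Path-transfer (proj₂ c) (++⁻ˡ (proj₂ c) a) e p ∷ Cycles-congᴸ (++⁻ʳ (proj₂ c) a) ps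

Cycles-cong : ∀ {σ σ′ : Fin d → Fin d} → (∀ y → σ′ y ≡ σ y) → ∀ {cs} → Cycles σ′ cs → Cycles σ cs
Cycles-cong e = Cycles-congᴸ (All.tabulate (λ {y} _ → e y))

Path-++⁻ : ∀ {σ : Fin d → Fin d} u l₁ {s l₂ z} → Path σ u (l₁ ++ s ∷ l₂) z → Path σ u l₁ s × Path σ s l₂ z
Path-++⁻ u []       (p , q) = p , q
Path-++⁻ u (y ∷ l₁) (p , q) = (p , proj₁ (Path-++⁻ y l₁ q)) , proj₂ (Path-++⁻ y l₁ q)

Path-++⁺ : ∀ {σ : Fin d → Fin d} u l₁ {s l₂ z} → Path σ u l₁ s → Path σ s l₂ z → Path σ u (l₁ ++ s ∷ l₂) z
Path-++⁺ u []       p       q = p , q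
Path-++⁺ u (y ∷ l₁) (p , r) q = p , Path-++⁺ y l₁ r q

IsCycle-rotate : ∀ {σ : Fin d → Fin d} {y m} m₁ {s m₂} → y ∷ m ≡ m₁ ++ s ∷ m₂ → IsCycle σ (y , m) → IsCycle σ (s , m₂ ++ m₁)
IsCycle-rotate {σ = σ} {y} {m} []        {s} {m₂} refl p = subst (λ z → Path σ y z y) (sym (++-identityʳ m₂)) p
IsCycle-rotate {y = y}     (_ ∷ m₁) {s} {m₂} refl p = Path-++⁺ s m₂ (proj₂ q) (proj₁ q)
  where q = Path-++⁻ y m₁ p

IsCycle-unrotate : ∀ {σ : Fin d → Fin d} {y m} m₁ {s m₂} → y ∷ m ≡ m₁ ++ s ∷ m₂ → IsCycle σ (s , m₂ ++ m₁) → IsCycle σ (y , m)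
IsCycle-unrotate {σ = σ} {y} {m} []        {s} {m₂} refl p = subst (λ z → Path σ y z y) (++-identityʳ m₂) p
IsCycle-unrotate {y = y}     (_ ∷ m₁) {s} {m₂} refl p = Path-++⁺ y m₁ (proj₂ q) (proj₁ q)
  where q = Path-++⁻ s m₂ p

Avoids : Fin d → Fin d → Fin d → Set
Avoids x s y = y ≢ s × y ≢ x

module _ {σ σ′ : Fin d → Fin d} {x s : Fin d} {l₁ l₂} {cs : List (Cycle d)} (e : ∀ y → σ′ y ≡ σ (swap (s , x) y))
         (a₁ : All (Avoids x s) l₁) (a₂ : All (Avoids x s) l₂) (aR : All (Avoids x s) (labels cs)) where

  private
    agree : ∀ {y} → Avoids x s y → σ′ y ≡ σ y
    agree {y} (n , m) = trans (e y) (cong σ (swap-other n m))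
    at-x : σ′ x ≡ σ s
    at-x = trans (e x) (cong σ (swap-right s x))
    at-s : σ′ s ≡ σ x
    at-s = trans (e s) (cong σ (swap-left s x))

  -- Composition with (s x) exchanges the images of x and s and changes no other image: x continues
  -- with l₂ and s with l₁, and each path closes at its own start.
  Cycles-cut : Cycles σ′ ((x , l₁ ++ s ∷ l₂) ∷ cs) → Cycles σ ((x , l₂) ∷ (s , l₁) ∷ cs)
  Cycles-cut (p ∷ ps) = let q₁ , q₂ = Path-++⁻ x l₁ p in
    Path-transfer l₂ (All.map agree a₂) at-s q₂ ∷ Path-transfer l₁ (All.map agree a₁) at-x q₁ ∷ Cycles-congᴸ (All.map agree aR) ps

  Cycles-join : Cycles σ ((x , l₂) ∷ (s , l₁) ∷ cs) → Cycles σ′ ((x , l₁ ++ s ∷ l₂) ∷ cs)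
  Cycles-join (q₂ ∷ q₁ ∷ ps) =
    Path-++⁺ x l₁ (Path-transfer l₁ (All.map (sym ∘ agree) a₁) (sym at-x) q₁) (Path-transfer l₂ (All.map (sym ∘ agree) a₂) (sym at-s) q₂)
    ∷ Cycles-congᴸ (All.map (sym ∘ agree) aR) ps

path-joined : ∀ {σ : Fin d → Fin d} (f : Fin d → A) → (∀ y → f (σ y) ≡ f y) → ∀ x l {z} → Path σ x l z → All (λ y → f y ≡ f x) l
path-joined f e x []      p       = []
path-joined f e x (y ∷ l) (p , q) = y~x ∷ All.map (λ r → trans r y~x) (path-joined f e y l q)
  where y~x = trans (cong f (sym p)) (e x)

Connected : List (Fin d) → Word d → Set
Connected L w = All (λ y → All (λ z → comp w y ≡ comp w z) L) L

connected? : ∀ (L : List (Fin d)) w → Dec (Connected L w)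
connected? L w = all? (λ y → all? (λ z → comp w y ≟ comp w z) L) L

connected⁺ : ∀ {L : List (Fin d)} w x → All (λ y → comp w y ≡ comp w x) L → Connected L w
connected⁺ w x a = All.map (λ p → All.map (λ q → trans p (sym q)) a) a

connected⁻ : ∀ {L : List (Fin d)} w → Connected L w → ∀ {y z} → y ∈ L → z ∈ L → comp w y ≡ comp w z
connected⁻ w c y∈ z∈ = All.lookup (All.lookup c y∈) z∈

connected-map : ∀ {L L′ : List (Fin d)} w w′ → (∀ {y} → y ∈ L′ → y ∈ L) →
  (∀ {y z} → comp w y ≡ comp w z → comp w′ y ≡ comp w′ z) → Connected L w → Connected L′ w′
connected-map w w′ sub h c = All.tabulate (λ y∈ → All.tabulate (λ z∈ → h (connected⁻ w c (sub y∈) (sub z∈))))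

F? : ∀ (cs : List (Cycle d)) w → Dec (Connected (labels cs) w × Cycles (end w) cs)
F? cs w = connected? (labels cs) w ×-dec cycles? (end w) cs

F : List (Cycle d) → Word d → ℕ
F cs w = ⟦ F? cs w ⟧

F-invariant : ∀ (cs : List (Cycle d)) → Invariant (F cs)
F-invariant cs {w} {w′} p = ⟦⟧-cong (F? cs w) (F? cs w′)
  (λ (c , y) → connected-map w w′ id (to≈ p) c , Cycles-cong (end≈ p) y)
  (λ (c , y) → connected-map w′ w id (from≈ p) c , Cycles-cong (sym ∘ end≈ p) y)

-- The number of connected monotone r-step walks from the identity to the permutation with cycles cs.
W : List (Cycle d) → ℕ → ℕ
W cs r = P (labels cs) r (F cs)

∏ : List A → (A → ℕ) → ℕ
∏ []       f = 1
∏ (x ∷ xs) f = f x * ∏ xs f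

∑splits-∏ : ∀ (xs : List A) f g → ∑ (splits xs) (λ (B , C) → ∏ B f * ∏ C g) ≡ ∏ xs (λ x → f x + g x)
∑splits-∏ []       f g = refl
∑splits-∏ (x ∷ xs) f g = begin
  ∑ (splits (x ∷ xs)) (λ (B , C) → ∏ B f * ∏ C g) ≡⟨ ∑splits-∷ x xs _ ⟩
  ∑ (splits xs) (λ (B , C) → f x * ∏ B f * ∏ C g) + ∑ (splits xs) (λ (B , C) → ∏ B f * (g x * ∏ C g))
    ≡⟨ cong₂ _+_ (trans (∑-cong (splits xs) (λ (B , C) → *-assoc (f x) (∏ B f) _)) (∑-*ˡ (splits xs) (f x) _))
                 (trans (∑-cong (splits xs) (λ (B , C) → *-left-comm (∏ B f) (g x) (∏ C g))) (∑-*ˡ (splits xs) (g x) _)) ⟩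
  f x * S + g x * S ≡⟨ *-distribʳ-+ S (f x) (g x) ⟨
  (f x + g x) * S   ≡⟨ cong ((f x + g x) *_) (∑splits-∏ xs f g) ⟩
  (f x + g x) * ∏ xs (λ x → f x + g x) ∎
  where
  open ≡-Reasoning
  S = ∑ (splits xs) (λ (B , C) → ∏ B f * ∏ C g)

⟦all⟧ : ∀ {Q : A → Set} (Q? : ∀ x → Dec (Q x)) {f : A → ℕ} (xs : List A) → All (λ x → ⟦ Q? x ⟧ ≡ f x) xs → ⟦ all? Q? xs ⟧ ≡ ∏ xs f
⟦all⟧ Q? []       []       = refl
⟦all⟧ Q? (x ∷ xs) (e ∷ es) = trans
  (⟦⟧-cong (all? Q? (x ∷ xs)) (Q? x ×-dec all? Q? xs) (λ { (p ∷ ps) → p , ps }) (λ (p , ps) → p ∷ ps))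
  (trans (⟦⟧-× (Q? x) (all? Q? xs)) (cong₂ _*_ e (⟦all⟧ Q? xs es)))

splits-↭ : ∀ (xs : List A) → All (λ (B , C) → B ++ C ↭ xs) (splits xs)
splits-↭ []       = ↭-refl ∷ []
splits-↭ (x ∷ xs) = ++⁺ (map⁺ (All.map (↭.prep x) (splits-↭ xs)))
  (map⁺ (All.map (λ {p} q → ↭-trans (shift x (proj₁ p) (proj₂ p)) (↭.prep x q)) (splits-↭ xs)))

picks-↭ : ∀ (xs : List A) → All (λ (B , C) → B ∷ C ↭ xs) (picks xs)
picks-↭ []       = []
picks-↭ (x ∷ xs) = ↭-refl ∷ map⁺ (All.map (λ {p} q → ↭-trans (↭.swap (proj₁ p) x ↭-refl) (↭.prep x q)) (picks-↭ xs))

labels-↭ : ∀ {cs cs′ : List (Cycle d)} → cs ↭ cs′ → labels cs ↭ labels cs′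
labels-↭ ↭.refl          = ↭-refl
labels-↭ (↭.prep c p)    = ++⁺ˡ (elems c) (labels-↭ p)
labels-↭ (↭.swap {xs} {ys} c c′ p) = ↭-trans
  (↭-trans (↭.↭-reflexive (sym (++-assoc (elems c) (elems c′) (labels xs))))
    (↭-trans (++⁺ʳ (labels xs)
                (++-comm (elems c) (elems c′)))
             (↭.↭-reflexive (++-assoc (elems c′) (elems c) (labels xs)))))
  (++⁺ˡ (elems c′) (++⁺ˡ (elems c) (labels-↭ p)))
labels-↭ (↭.trans p q)   = ↭-trans (labels-↭ p) (labels-↭ q)

module _ {A : Set} where
  open import Algebra.Solver.CommutativeMonoid (++-commutativeMonoid {A = A}) using (solve; _⊜_; _⊕_) public

cut-↭ : ∀ (x s : A) l₁ l₂ R → x ∷ (l₁ ++ s ∷ l₂) ++ R ↭ (x ∷ l₂) ++ (s ∷ l₁) ++ R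
cut-↭ x s l₁ l₂ R = solve 5 (λ x s l₁ l₂ R → (x ⊕ (l₁ ⊕ (s ⊕ l₂)) ⊕ R) ⊜ ((x ⊕ l₂) ⊕ ((s ⊕ l₁) ⊕ R))) ↭-refl [ x ] [ s ] l₁ l₂ R

cut₂-↭ : ∀ (x s : A) l₁ l₂ R₁ R₂ → (x ∷ l₂) ++ (s ∷ l₁) ++ (R₁ ++ R₂) ↭ ((x ∷ l₂) ++ R₁) ++ ((s ∷ l₁) ++ R₂)
cut₂-↭ x s l₁ l₂ R₁ R₂ = solve 6 (λ x s l₁ l₂ R₁ R₂ → ((x ⊕ l₂) ⊕ ((s ⊕ l₁) ⊕ (R₁ ⊕ R₂))) ⊜ (((x ⊕ l₂) ⊕ R₁) ⊕ ((s ⊕ l₁) ⊕ R₂))) ↭-refl [ x ] [ s ] l₁ l₂ R₁ R₂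

join-↭ : ∀ (x s : A) l m₁ m₂ R → (x ∷ l) ++ ((m₁ ++ s ∷ m₂) ++ R) ↭ (x ∷ (m₂ ++ m₁) ++ s ∷ l) ++ R
join-↭ x s l m₁ m₂ R = solve 6 (λ x s l m₁ m₂ R → ((x ⊕ l) ⊕ ((m₁ ⊕ (s ⊕ m₂)) ⊕ R)) ⊜ ((x ⊕ ((m₂ ⊕ m₁) ⊕ (s ⊕ l))) ⊕ R)) ↭-refl [ x ] [ s ] l m₁ m₂ R

module _ {d : ℕ} where
  open DecMembership (_≟_ {d}) using (_∈?_) public

heads-All : ∀ {Q : Fin d → Set} (cs : List (Cycle d)) → All Q (labels cs) → All (Q ∘ proj₁) cs
heads-All []       a       = []
heads-All (c ∷ cs) (q ∷ a) = q ∷ heads-All cs (++⁻ʳ (proj₂ c) a)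

labels-All : ∀ {Q : Fin d → Set} {cs : List (Cycle d)} → All (λ c → All Q (elems c)) cs → All Q (labels cs)
labels-All []       = []
labels-All (a ∷ as) = ++⁺ a (labels-All as)

cycle-comp : ∀ (w : Word d) {c} → IsCycle (end w) c → All (λ y → comp w y ≡ comp w (proj₁ c)) (elems c)
cycle-comp w {x , l} p = refl ∷ path-joined (comp w) (comp-end w) x l p

-- A cycle of the end of w lies within one component of w, so it suffices to look at one point of
-- each cycle.
spread : ∀ {Q : Fin d → Set} (w : Word d) {cs} → Cycles (end w) cs → All (Q ∘ comp w ∘ proj₁) cs → All (Q ∘ comp w) (labels cs)
spread {Q = Q} w cy h = labels-All (All.zipWith (λ (p , q) → All.map (λ e → subst Q (sym e) q) (cycle-comp w p)) (cy , h))

⟦⊎⟧ : ∀ {P Q : Set} (p? : Dec P) (q? : Dec Q) → (P → ¬ Q) → ⟦ p? ⊎-dec q? ⟧ ≡ ⟦ p? ⟧ + ⟦ q? ⟧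
⟦⊎⟧ (yes p) (yes q) ex = ⊥-elim (ex p q)
⟦⊎⟧ (yes p) (no _)  ex = refl
⟦⊎⟧ (no _)  (yes q) ex = refl
⟦⊎⟧ (no _)  (no _)  ex = refl

Unique-++-disjoint : ∀ (xs : List A) {ys} → Unique (xs ++ ys) → ∀ {y} → y ∈ xs → y ∈ ys → ⊥
Unique-++-disjoint (x ∷ xs) (a ∷ u) (here refl) y∈ = ∈-All≢ (++⁻ʳ xs a) y∈
Unique-++-disjoint (x ∷ xs) (a ∷ u) (there m)   y∈ = Unique-++-disjoint xs u m y∈

Unique-++⁻ : ∀ (xs : List A) {ys} → Unique (xs ++ ys) → Unique xs × Unique ys
Unique-++⁻ []       u       = [] , u
Unique-++⁻ (x ∷ xs) (a ∷ u) = (++⁻ˡ xs a ∷ proj₁ (Unique-++⁻ xs u)) , proj₂ (Unique-++⁻ xs u)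

end-fixed : ∀ (w : Word d) {y} → All (λ τ → y ≢ proj₁ τ × y ≢ proj₂ τ) w → end w y ≡ y
end-fixed []      []             = refl
end-fixed (τ ∷ w) ((p , q) ∷ a) = trans (cong (end w) (swap-other p q)) (end-fixed w a)

end-within : ∀ {M : Fin d → Set} (w : Word d) → Within M w → ∀ {y} → M y → M (end w y)
end-within []            []            m = m
end-within {M = M} ((s , t) ∷ w) ((p , q) ∷ i) {y} m with swap-cases s t y
... | inj₁ (_ , e)               = end-within w i (subst M (sym e) q)
... | inj₂ (inj₁ (_ , e))        = end-within w i (subst M (sym e) p)
... | inj₂ (inj₂ (_ , _ , e))    = end-within w i (subst M (sym e) m)

-- The function sending points of M to their component in v, and all other points to `nothing`, is
-- constant along every step of w, so `comp-least` applies.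
comp-restrict : ∀ {M : Fin d → Set} (M? : ∀ y → Dec (M y)) v w →
  All (λ τ → (M (proj₁ τ) × M (proj₂ τ) × comp v (proj₁ τ) ≡ comp v (proj₂ τ)) ⊎ (¬ M (proj₁ τ) × ¬ M (proj₂ τ))) w →
  ∀ {y z} → M y → M z → comp w y ≡ comp w z → comp v y ≡ comp v z
comp-restrict {d = d} {M} M? v w a {y} {z} my mz e = just-injective (trans (sym (f-in my)) (trans (comp-least f w (All.map joined a) e) (f-in mz)))
  where
  f : Fin d → Maybe (Fin d)
  f y with M? y
  ... | yes _ = just (comp v y)
  ... | no  _ = nothing
  f-in : ∀ {y} → M y → f y ≡ just (comp v y)
  f-in {y} m with M? y
  ... | yes _ = refl
  ... | no  n = ⊥-elim (n m)
  f-out : ∀ {y} → ¬ M y → f y ≡ nothing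
  f-out {y} n with M? y
  ... | yes m = ⊥-elim (n m)
  ... | no  _ = refl
  joined : ∀ {τ : Transp d} → (M (proj₁ τ) × M (proj₂ τ) × comp v (proj₁ τ) ≡ comp v (proj₂ τ)) ⊎ (¬ M (proj₁ τ) × ¬ M (proj₂ τ)) → f (proj₁ τ) ≡ f (proj₂ τ)
  joined (inj₁ (p , q , e)) = trans (f-in p) (trans (cong just e) (sym (f-in q)))
  joined (inj₂ (p , q))     = trans (f-out p) (sym (f-out q))

-- The step (s x) closing a walk may merge two components; B and C are the cycles of the component of x and of s.
module Cut {d} (x s : Fin d) (l₁ l₂ : List (Fin d)) (cs : List (Cycle d))
           (unique : Unique (labels ((x , l₁ ++ s ∷ l₂) ∷ cs))) where

  cs₀ cs₁ : List (Cycle d)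
  cs₀ = (x , l₁ ++ s ∷ l₂) ∷ cs
  cs₁ = (x , l₂) ∷ (s , l₁) ∷ cs

  perm : labels cs₀ ↭ labels cs₁
  perm = cut-↭ x s l₁ l₂ (labels cs)

  unique₁ : Unique (labels cs₁)
  unique₁ = Unique-resp-↭ perm unique

  private
    perm′ : labels cs₁ ↭ x ∷ s ∷ (l₂ ++ l₁ ++ labels cs)
    perm′ = ↭.prep x (shift s l₂ (l₁ ++ labels cs))

    avoid : All (Avoids x s) (l₂ ++ l₁ ++ labels cs)
    avoid with Unique-resp-↭ perm′ unique₁
    ... | (_ ∷ ax) ∷ as ∷ _ = All.zipWith (λ (p , q) → p ∘ sym , q ∘ sym) (as , ax)

  avoid₂ : All (Avoids x s) l₂
  avoid₂ = ++⁻ˡ l₂ avoid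
  avoid₁ : All (Avoids x s) l₁
  avoid₁ = ++⁻ˡ l₁ (++⁻ʳ l₂ avoid)
  avoidR : All (Avoids x s) (labels cs)
  avoidR = ++⁻ʳ l₁ (++⁻ʳ l₂ avoid)

  cycles-cut : ∀ w → Cycles (end ((s , x) ∷ w)) cs₀ → Cycles (end w) cs₁
  cycles-cut w = Cycles-cut {l₁ = l₁} (λ y → refl) avoid₁ avoid₂ avoidR

  cycles-join : ∀ w → Cycles (end w) cs₁ → Cycles (end ((s , x) ∷ w)) cs₀
  cycles-join w = Cycles-join {l₁ = l₁} (λ y → refl) avoid₁ avoid₂ avoidR

  x∈ : x ∈ labels cs₁
  x∈ = here refl
  s∈ : s ∈ labels cs₁
  s∈ = there (∈-++⁺ʳ l₂ (here refl))

  G? : ∀ B C w → Dec ((Connected (labels ((x , l₂) ∷ B)) w × Cycles (end w) ((x , l₂) ∷ B))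
                     × ((Connected (labels ((s , l₁) ∷ C)) w × Cycles (end w) ((s , l₁) ∷ C)) × comp w x ≢ comp w s))
  G? B C w = F? ((x , l₂) ∷ B) w ×-dec (F? ((s , l₁) ∷ C) w ×-dec ¬? (comp w x ≟ comp w s))

  G : List (Cycle d) → List (Cycle d) → Word d → ℕ
  G B C w = ⟦ G? B C w ⟧

  ∑G-zero : ∀ w → (∀ p → proj₁ p ++ proj₂ p ↭ cs → G (proj₁ p) (proj₂ p) w ≡ 0) → ∑ (splits cs) (λ (B , C) → G B C w) ≡ 0
  ∑G-zero w z = trans (∑-congᴬ (All.map (λ {p} → z p) (splits-↭ cs))) (∑-zero (splits cs))

  pointwise : ∀ w → F cs₀ ((s , x) ∷ w) ≡ F cs₁ w + ∑ (splits cs) (λ (B , C) → G B C w)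
  pointwise w = pointwise-cases w (cycles? (end w) cs₁) (comp w x ≟ comp w s)
    where
    pointwise-cases : ∀ w → Dec (Cycles (end w) cs₁) → Dec (comp w x ≡ comp w s) → F cs₀ ((s , x) ∷ w) ≡ F cs₁ w + ∑ (splits cs) (λ (B , C) → G B C w)
    pointwise-cases w (no ncy) _ = trans (⟦⟧-no (F? cs₀ ((s , x) ∷ w)) (λ (_ , cy) → ncy (cycles-cut w cy)))
            (sym (cong₂ _+_ (⟦⟧-no (F? cs₁ w) (ncy ∘ proj₂))
               (∑G-zero w (λ p q → ⟦⟧-no (G? (proj₁ p) (proj₂ p) w) (λ { ((_ , c₁ ∷ b) , (_ , c₂ ∷ c) , _) → ncy (c₁ ∷ c₂ ∷ All-resp-↭ q (++⁺ b c)) })))))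
    -- Here x and s are joined before the step, so the step changes no component and no split
    -- contributes.
    pointwise-cases w (yes cy) (yes x~s) = trans
            (⟦⟧-cong (F? cs₀ ((s , x) ∷ w)) (F? cs₁ w)
              (λ (c , _) → connected-map ((s , x) ∷ w) w (∈-resp-↭ (↭-sym perm)) (comp-least (comp w) ((s , x) ∷ w) (sym x~s ∷ comp-joined w)) c , cy)
              (λ (c , _) → connected-map w ((s , x) ∷ w) (∈-resp-↭ perm) (comp-coarsen (s , x) w) c , cycles-join w cy))
            (sym (trans (cong (F cs₁ w +_) (∑G-zero w (λ p q → ⟦⟧-no (G? (proj₁ p) (proj₂ p) w) (λ (_ , _ , n) → n x~s)))) (+-identityʳ _)))
    -- The step merges exactly the components u of x and v of s, so every remaining cycle must lie
    -- in one of them. The product over the cycles of the sum of these two exclusive conditions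
    -- expands into the sum over the splits.
    pointwise-cases w (yes (c₁ ∷ c₂ ∷ cy)) (no x≁s) = begin
        F cs₀ ((s , x) ∷ w)
          ≡⟨ ⟦⟧-cong (F? cs₀ ((s , x) ∷ w)) (all? near? cs)
               (λ (c , _) → All.map (λ {c} e → split {c} (sym e)) (heads-All cs (++⁻ʳ (elems (x , l₁ ++ s ∷ l₂)) (All.map (λ a → All.head a) c))))
               (λ a → connected⁺ ((s , x) ∷ w) x (All-resp-↭ (↭-sym perm) (spread {Q = λ z → merge v u z ≡ merge v u u} w (c₁ ∷ c₂ ∷ cy)
                  (refl ∷ trans (merge-left v u) (sym (merge-right v u)) ∷ All.map (λ {c} → unsplit {c}) a)))
                 , cycles-join w (c₁ ∷ c₂ ∷ cy)) ⟩
        ⟦ all? near? cs ⟧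
          ≡⟨ ⟦all⟧ near? cs (All.tabulate (λ {c} _ → ⟦⊎⟧ (h c ≟ u) (h c ≟ v) (λ p q → x≁s (trans (sym p) q)))) ⟩
        ∏ cs (λ c → ⟦ h c ≟ u ⟧ + ⟦ h c ≟ v ⟧)
          ≡⟨ ∑splits-∏ cs _ _ ⟨
        ∑ (splits cs) (λ (B , C) → ∏ B (λ c → ⟦ h c ≟ u ⟧) * ∏ C (λ c → ⟦ h c ≟ v ⟧))
          ≡⟨ ∑-congᴬ (All.map (λ {p} q → trans
               (cong₂ _*_ (sym (⟦all⟧ (λ c → h c ≟ u) (proj₁ p) (All.tabulate (λ _ → refl)))) (sym (⟦all⟧ (λ c → h c ≟ v) (proj₂ p) (All.tabulate (λ _ → refl)))))
               (trans (sym (⟦⟧-× (all? (λ c → h c ≟ u) (proj₁ p)) (all? (λ c → h c ≟ v) (proj₂ p))))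
                 (sym (G-eq (proj₁ p) (proj₂ p) q)))) (splits-↭ cs)) ⟩
        ∑ (splits cs) (λ (B , C) → G B C w)
          ≡⟨ cong (_+ ∑ (splits cs) (λ (B , C) → G B C w)) (⟦⟧-no (F? cs₁ w) (λ (c , _) → x≁s (connected⁻ w c x∈ s∈))) ⟨
        F cs₁ w + ∑ (splits cs) (λ (B , C) → G B C w) ∎
        where
        open ≡-Reasoning
        u = comp w x
        v = comp w s
        h : Cycle d → Fin d
        h = comp w ∘ proj₁
        near? : ∀ c → Dec (h c ≡ u ⊎ h c ≡ v)
        near? c = (h c ≟ u) ⊎-dec (h c ≟ v)
        split : ∀ {c} → comp ((s , x) ∷ w) x ≡ comp ((s , x) ∷ w) (proj₁ c) → h c ≡ u ⊎ h c ≡ v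
        split {c} e with comp w (proj₁ c) ≟ comp w s
        ... | yes p = inj₂ p
        ... | no  _ = inj₁ (trans (sym e) (merge-right v u))
        unsplit : ∀ {c} → h c ≡ u ⊎ h c ≡ v → merge v u (h c) ≡ merge v u u
        unsplit (inj₁ e) = cong (merge v u) e
        unsplit (inj₂ e) = trans (cong (merge v u) e) (trans (merge-left v u) (sym (merge-right v u)))
        G-eq : ∀ B C → B ++ C ↭ cs → G B C w ≡ ⟦ all? (λ c → h c ≟ u) B ×-dec all? (λ c → h c ≟ v) C ⟧
        G-eq B C q = ⟦⟧-cong (G? B C w) (all? (λ c → h c ≟ u) B ×-dec all? (λ c → h c ≟ v) C)
          (λ ((cB , _) , (cC , _) , _) → All.map sym (heads-All B (++⁻ʳ (x ∷ l₂) (All.head cB))) , All.map sym (heads-All C (++⁻ʳ (s ∷ l₁) (All.head cC))))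
          (λ (aB , aC) → let cyBC = All-resp-↭ (↭-sym q) cy ; cyB = c₁ ∷ ++⁻ˡ B cyBC ; cyC = c₂ ∷ ++⁻ʳ B cyBC in
             (connected⁺ w x (spread {Q = _≡ u} w cyB (refl ∷ aB)) , cyB) , (connected⁺ w s (spread {Q = _≡ v} w cyC (refl ∷ aC)) , cyC) , x≁s)

  G-invariant : ∀ B C → Invariant (G B C)
  G-invariant B C {w} {w′} p = ⟦⟧-cong (G? B C w) (G? B C w′) (go p) (go (≈-sym p))
    where
    go : ∀ {w w′} → w ≈ w′ → _ → _
    go {w} {w′} p ((a , b) , (c , d) , e) = (connected-map w w′ id (to≈ p) a , Cycles-cong (end≈ p) b)
      , (connected-map w w′ id (to≈ p) c , Cycles-cong (end≈ p) d) , e ∘ from≈ p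

  -- `P-↭` brings the labels of the two components into consecutive blocks. A step between the
  -- blocks would join x to s, which `G` forbids, so `P-product` applies.
  P-G : ∀ B C → B ++ C ↭ cs → ∀ r → P (labels cs₀) r (G B C) ≡ conv r (λ r₁ r₂ → W ((x , l₂) ∷ B) r₁ * W ((s , l₁) ∷ C) r₂)
  P-G B C q r = trans (P-↭ perm₂ unique r (G-invariant B C))
    (P-product (_∈ L₁) (_∈ L₂) L₁ L₂ (All.tabulate id) (All.tabulate id) r (G B C) (F ((x , l₂) ∷ B)) (F ((s , l₁) ∷ C)) product cross)
    where
    L₁ = labels ((x , l₂) ∷ B)
    L₂ = labels ((s , l₁) ∷ C)
    perm₂ : labels cs₀ ↭ L₁ ++ L₂
    perm₂ = ↭-trans perm (↭-trans (++⁺ˡ (x ∷ l₂) (++⁺ˡ (s ∷ l₁) (↭-trans (labels-↭ (↭-sym q)) (↭.↭-reflexive (concatMap-++ elems B C)))))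
              (cut₂-↭ x s l₁ l₂ (labels B) (labels C)))
    disjoint : ∀ {y} → y ∈ L₁ → y ∈ L₂ → ⊥
    disjoint = Unique-++-disjoint L₁ (Unique-resp-↭ perm₂ unique)
    product : ∀ w₁ w₂ → Within (_∈ L₁) w₁ → Within (_∈ L₂) w₂ → G B C (w₁ ++ w₂) ≡ F ((x , l₂) ∷ B) w₁ * F ((s , l₁) ∷ C) w₂
    product w₁ w₂ i₁ i₂ = trans
      (⟦⟧-cong (G? B C (w₁ ++ w₂)) (F? ((x , l₂) ∷ B) w₁ ×-dec F? ((s , l₁) ∷ C) w₂)
        (λ ((a , b) , (c , e) , _) →
            (All.tabulate (λ y∈ → All.tabulate (λ z∈ → restrict₁ y∈ z∈ (connected⁻ (w₁ ++ w₂) a y∈ z∈)))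
              , Cycles-congᴸ end₁ b)
          , (All.tabulate (λ y∈ → All.tabulate (λ z∈ → restrict₂ y∈ z∈ (connected⁻ (w₁ ++ w₂) c y∈ z∈)))
              , Cycles-congᴸ end₂ e))
        (λ ((a , b) , (c , e)) →
            (connected-map w₁ (w₁ ++ w₂) id (comp-least (comp (w₁ ++ w₂)) w₁ (++⁻ˡ w₁ (comp-joined (w₁ ++ w₂)))) a
              , Cycles-congᴸ (All.map sym end₁) b)
          , (connected-map w₂ (w₁ ++ w₂) id (comp-least (comp (w₁ ++ w₂)) w₂ (++⁻ʳ w₁ (comp-joined (w₁ ++ w₂)))) c
              , Cycles-congᴸ (All.map sym end₂) e)
          , apart))
      (⟦⟧-× (F? ((x , l₂) ∷ B) w₁) (F? ((s , l₁) ∷ C) w₂))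
      where
      both₁ = ++⁺ (All.zipWith (λ { ((p , q) , e) → inj₁ (p , q , e) }) (i₁ , comp-joined w₁))
                  (All.map (λ { (p , q) → inj₂ ((λ m → disjoint m p) , (λ m → disjoint m q)) }) i₂)
      restrict₁ : ∀ {y z} → y ∈ L₁ → z ∈ L₁ → comp (w₁ ++ w₂) y ≡ comp (w₁ ++ w₂) z → comp w₁ y ≡ comp w₁ z
      restrict₁ = comp-restrict (_∈? L₁) w₁ (w₁ ++ w₂) both₁
      restrict₂ : ∀ {y z} → y ∈ L₂ → z ∈ L₂ → comp (w₁ ++ w₂) y ≡ comp (w₁ ++ w₂) z → comp w₂ y ≡ comp w₂ z
      restrict₂ = comp-restrict (_∈? L₂) w₂ (w₁ ++ w₂)
        (++⁺ (All.map (λ { (p , q) → inj₂ (disjoint p , disjoint q) }) i₁)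
             (All.zipWith (λ { ((p , q) , e) → inj₁ (p , q , e) }) (i₂ , comp-joined w₂)))
      end₁ : All (λ y → end (w₁ ++ w₂) y ≡ end w₁ y) L₁
      end₁ = All.tabulate (λ {y} y∈ → trans (end-++ w₁ w₂ y) (end-fixed w₂
               (All.map (λ { (p , q) → (λ e → disjoint (end-within w₁ i₁ y∈) (subst (_∈ L₂) (sym e) p)) , (λ e → disjoint (end-within w₁ i₁ y∈) (subst (_∈ L₂) (sym e) q)) }) i₂)))
      end₂ : All (λ y → end (w₁ ++ w₂) y ≡ end w₂ y) L₂
      end₂ = All.tabulate (λ {y} y∈ → trans (end-++ w₁ w₂ y) (cong (end w₂) (end-fixed w₁
               (All.map (λ { (p , q) → (λ e → disjoint (subst (_∈ L₁) (sym e) p) y∈) , (λ e → disjoint (subst (_∈ L₁) (sym e) q) y∈) }) i₁))))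
      apart : comp (w₁ ++ w₂) x ≢ comp (w₁ ++ w₂) s
      apart e with comp-least (λ y → does (y ∈? L₁)) (w₁ ++ w₂)
        (All.map (λ { {τ} (inj₁ (p , q , _)) → trans (dec-true (proj₁ τ ∈? L₁) p) (sym (dec-true (proj₂ τ ∈? L₁) q))
                    ; {τ} (inj₂ (p , q)) → trans (dec-false (proj₁ τ ∈? L₁) p) (sym (dec-false (proj₂ τ ∈? L₁) q)) }) both₁) e
      ... | e′ with () ← trans (sym (dec-true (x ∈? L₁) (here refl))) (trans e′ (dec-false (s ∈? L₁) (λ m → disjoint m (here refl))))
    cross : ∀ u t k v → t ∈ L₂ → k ∈ L₁ → G B C (u ++ (t , k) ∷ v) ≡ 0
    cross u t k v t∈ k∈ = ⟦⟧-no (G? B C (u ++ (t , k) ∷ v)) (λ ((a , _) , (c , _) , n) →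
      n (trans (connected⁻ (u ++ (t , k) ∷ v) a (here refl) k∈) (trans (sym (All.head (++⁻ʳ u (comp-joined (u ++ (t , k) ∷ v)))))
           (connected⁻ (u ++ (t , k) ∷ v) c t∈ (here refl)))))

  ∑-term : ∀ r → P (labels cs₀) r (λ w → F cs₀ ((s , x) ∷ w))
         ≡ W cs₁ r + ∑ (splits cs) (λ (B , C) → conv r (λ r₁ r₂ → W ((x , l₂) ∷ B) r₁ * W ((s , l₁) ∷ C) r₂))
  ∑-term r = begin
    P (labels cs₀) r (λ w → F cs₀ ((s , x) ∷ w)) ≡⟨ P-cong (labels cs₀) r pointwise ⟩
    P (labels cs₀) r (λ w → F cs₁ w + ∑ (splits cs) (λ (B , C) → G B C w)) ≡⟨ P-+ (labels cs₀) r _ _ ⟩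
    P (labels cs₀) r (F cs₁) + P (labels cs₀) r (λ w → ∑ (splits cs) (λ (B , C) → G B C w))
      ≡⟨ cong₂ _+_ (P-↭ perm unique r (F-invariant cs₁)) (trans (P-∑ (labels cs₀) r (splits cs) (λ (B , C) → G B C))
           (∑-congᴬ (All.map (λ {p} q → P-G (proj₁ p) (proj₂ p) q r) (splits-↭ cs)))) ⟩
    W cs₁ r + ∑ (splits cs) (λ (B , C) → conv r (λ r₁ r₂ → W ((x , l₂) ∷ B) r₁ * W ((s , l₁) ∷ C) r₂)) ∎
    where open ≡-Reasoning

  unique-split : ∀ B C → B ++ C ↭ cs → Unique (labels ((x , l₂) ∷ B)) × Unique (labels ((s , l₁) ∷ C))
  unique-split B C q = Unique-++⁻ (labels ((x , l₂) ∷ B)) (Unique-resp-↭ perm₂ unique₁)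
    where
    perm₂ : labels cs₁ ↭ labels ((x , l₂) ∷ B) ++ labels ((s , l₁) ∷ C)
    perm₂ = ↭-trans (++⁺ˡ (x ∷ l₂) (++⁺ˡ (s ∷ l₁) (↭-trans (labels-↭ (↭-sym q)) (↭.↭-reflexive (concatMap-++ elems B C)))))
              (cut₂-↭ x s l₁ l₂ (labels B) (labels C))

∑-positions : ∀ (l : List A) (g : A → ℕ) (Φ : ℕ → ℕ → ℕ) →
  (∀ l₁ s l₂ → l ≡ l₁ ++ s ∷ l₂ → g s ≡ Φ (length l₁) (length l₂)) → ∑ l g ≡ cut (length l) Φ
∑-positions []          g Φ e = refl
∑-positions (y ∷ [])    g Φ e = trans (+-identityʳ (g y)) (e [] y [] refl)
∑-positions (y ∷ z ∷ l) g Φ e = cong₂ _+_ (e [] y (z ∷ l) refl)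
  (∑-positions (z ∷ l) g (λ i j → Φ (suc i) j) (λ l₁ s l₂ q → e (y ∷ l₁) s l₂ (cong (y ∷_) q)))

cut-comm : ∀ a Φ → cut a Φ ≡ cut a (λ i j → Φ j i)
cut-comm zero    Φ = refl
cut-comm (suc a) Φ = conv-comm a Φ

∑-picks : ∀ (xs : List A) (h : A → ℕ) → ∑ xs h ≡ ∑ (picks xs) (h ∘ proj₁)
∑-picks []       h = refl
∑-picks (x ∷ xs) h = trans (cong (h x +_) (∑-picks xs h)) (sym (∑picks-∷ x xs (h ∘ proj₁)))

∑-const-positions : ∀ (l : List A) (g : A → ℕ) c → (∀ l₁ s l₂ → l ≡ l₁ ++ s ∷ l₂ → g s ≡ c) → ∑ l g ≡ length l * c
∑-const-positions []      g c e = refl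
∑-const-positions (y ∷ l) g c e = cong₂ _+_ (e [] y l refl) (∑-const-positions l g c (λ l₁ s l₂ q → e (y ∷ l₁) s l₂ (cong (y ∷_) q)))

-- Since s lies in another cycle than x, the step (s x) closing a walk has split the joined cycle.
module Join {d} (x y : Fin d) (l m m₁ m₂ : List (Fin d)) (s : Fin d) (cs cs′ : List (Cycle d)) (position : y ∷ m ≡ m₁ ++ s ∷ m₂)
            (picked : (y , m) ∷ cs′ ↭ cs) (unique : Unique (labels ((x , l) ∷ cs))) where

  cs₀ cs₁ : List (Cycle d)
  cs₀ = (x , l) ∷ cs
  cs₁ = (x , (m₂ ++ m₁) ++ s ∷ l) ∷ cs′

  perm : labels cs₀ ↭ labels cs₁
  perm = ↭-trans (++⁺ˡ (x ∷ l) (labels-↭ (↭-sym picked)))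
    (↭-trans (↭.↭-reflexive (cong (λ z → (x ∷ l) ++ (z ++ labels cs′)) position)) (join-↭ x s l m₁ m₂ (labels cs′)))

  unique₁ : Unique (labels cs₁)
  unique₁ = Unique-resp-↭ perm unique

  private module C = Cut x s (m₂ ++ m₁) l cs′ unique₁

  cycles→ : ∀ w → Cycles (end ((s , x) ∷ w)) cs₀ → Cycles (end w) cs₁
  cycles→ w (c ∷ cy) with All-resp-↭ (↭-sym picked) cy
  ... | c′ ∷ cy′ = Cycles-join {l₁ = m₂ ++ m₁} (λ z → cong (end w) (sym (swap-involutive (s , x) z))) C.avoid₁ C.avoid₂ C.avoidR
                     (c ∷ IsCycle-rotate m₁ position c′ ∷ cy′)

  cycles← : ∀ w → Cycles (end w) cs₁ → Cycles (end ((s , x) ∷ w)) cs₀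
  cycles← w cy with Cycles-cut {σ = end ((s , x) ∷ w)} {l₁ = m₂ ++ m₁} (λ z → cong (end w) (sym (swap-involutive (s , x) z))) C.avoid₁ C.avoid₂ C.avoidR cy
  ... | c ∷ c′ ∷ cy′ = c ∷ All-resp-↭ picked (IsCycle-unrotate m₁ position c′ ∷ cy′)

  pointwise : ∀ w → F cs₀ ((s , x) ∷ w) ≡ F cs₁ w
  pointwise w = ⟦⟧-cong (F? cs₀ ((s , x) ∷ w)) (F? cs₁ w)
    (λ (c , cy) → connected-map ((s , x) ∷ w) w (∈-resp-↭ (↭-sym perm))
        (comp-least (comp w) ((s , x) ∷ w) (s~x (cycles→ w cy) ∷ comp-joined w)) c , cycles→ w cy)
    (λ (c , cy) → connected-map w ((s , x) ∷ w) (∈-resp-↭ perm) (comp-coarsen (s , x) w) c , cycles← w cy)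
    where
    s~x : Cycles (end w) cs₁ → comp w s ≡ comp w x
    s~x (c ∷ _) = All.head (++⁻ʳ (x ∷ m₂ ++ m₁) (cycle-comp w c))

  P-term : ∀ r → P (labels cs₀) r (λ w → F cs₀ ((s , x) ∷ w)) ≡ W cs₁ r
  P-term r = trans (P-cong (labels cs₀) r pointwise) (P-↭ perm unique r (F-invariant cs₁))

  length₁ : length ((m₂ ++ m₁) ++ s ∷ l) ≡ suc (length l + length m)
  length₁ = begin
    length ((m₂ ++ m₁) ++ s ∷ l)              ≡⟨ length-++ (m₂ ++ m₁) ⟩
    length (m₂ ++ m₁) + suc (length l)        ≡⟨ cong (_+ suc (length l)) (length-++ m₂) ⟩
    (length m₂ + length m₁) + suc (length l)  ≡⟨ lem (length m₂) (length m₁) (length l) ⟩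
    length l + (length m₁ + suc (length m₂))  ≡⟨ cong (length l +_) (trans (sym (length-++ m₁)) (cong length (sym position))) ⟩
    length l + suc (length m)                 ≡⟨ +-suc (length l) (length m) ⟩
    suc (length l + length m)                 ∎
    where
    open ≡-Reasoning
    lem : ∀ a b c → (a + b) + suc c ≡ c + (b + suc a)
    lem = solve-∀

sizes : List (Cycle d) → List ℕ
sizes = map (length ∘ proj₂)

P-vanish : ∀ (M : Fin d → Set) L → All M L → ∀ r {f} → (∀ {z} → z ∈ L → ∀ w → Within M w → f w ≡ 0) → P L (suc r) f ≡ 0
P-vanish M []       _ r e = refl
P-vanish M (z ∷ zs) a r e = trans (P-congᴹ M (z ∷ zs) a (suc r) (e (here refl))) (P-zero (z ∷ zs) (suc r))

-- Without steps of the largest colour x, the point x stays isolated, whereas a positive number of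
-- steps needs other labels to which x would have to be connected.
P-unconnected : ∀ (x : Fin d) l cs → Unique (labels ((x , l) ∷ cs)) → ∀ r → P (l ++ labels cs) (suc r) (F ((x , l) ∷ cs)) ≡ 0
P-unconnected x l cs (a ∷ _) r = P-vanish (x ≢_) (l ++ labels cs) a r (λ z∈ w i → ⟦⟧-no (F? ((x , l) ∷ cs) w)
  (λ (c , _) → contra z∈ w i (connected⁻ w c (here refl) (there z∈))))
  where
  contra : ∀ {z} → z ∈ l ++ labels cs → ∀ w → Within (x ≢_) w → comp w x ≡ comp w z → ⊥
  contra {z} z∈ w i e with comp-least (λ y → does (x ≟ y)) w (All.map (λ {τ} (p , q) → trans (dec-false (x ≟ proj₁ τ) p) (sym (dec-false (x ≟ proj₂ τ) q))) i) e
  ... | e′ with () ← trans (sym (dec-true (x ≟ x) refl)) (trans e′ (dec-false (x ≟ z) (All.lookup a z∈)))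

W-base : ∀ (x : Fin d) l cs → Unique (labels ((x , l) ∷ cs)) → W ((x , l) ∷ cs) 0 ≡ base (length l) (sizes cs)
W-base x []      []             u             = ⟦⟧-yes (F? ((x , []) ∷ []) []) (((refl ∷ []) ∷ []) , refl ∷ [])
W-base x (z ∷ l) cs             ((n ∷ _) ∷ _) = ⟦⟧-no (F? ((x , z ∷ l) ∷ cs) []) (λ { (((_ ∷ e ∷ _) ∷ _) , _) → n e })
W-base x []      ((y , m) ∷ cs) ((n ∷ _) ∷ _) = ⟦⟧-no (F? ((x , []) ∷ (y , m) ∷ cs) []) (λ { (((_ ∷ e ∷ _) ∷ _) , _) → n e })

-- Connectedness forces the last step to have the largest colour x. Its other point s runs over the
-- rest of the cycle of x (`Cut`) and over the other cycles (`Join`). If the walk falls apart, s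
-- becomes the largest colour of its own component, which `P-↭` permits.
W≡Hf : ∀ n r → r < n → ∀ (x : Fin d) l cs → Unique (labels ((x , l) ∷ cs)) → W ((x , l) ∷ cs) r ≡ Hf n r (length l) (sizes cs)
W≡Hf (suc n) zero    p       x l cs u = W-base x l cs u
W≡Hf {d} (suc n) (suc r) (s≤s p) x l cs u = begin
  P (l ++ labels cs) (suc r) (F cs₀) + P (labels cs₀) r (step (l ++ labels cs) x (F cs₀))
    ≡⟨ cong₂ _+_ (P-unconnected x l cs u r) (trans (P-∑ (labels cs₀) r (l ++ labels cs) (λ s w → F cs₀ ((s , x) ∷ w))) (∑-++ l (labels cs) term)) ⟩
  ∑ l term + ∑ (labels cs) term
    ≡⟨ cong₂ _+_ cut-part join-part ⟩
  Hf (suc n) (suc r) (length l) (sizes cs) ∎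
  where
  open ≡-Reasoning
  cs₀ = (x , l) ∷ cs
  term : Fin d → ℕ
  term s = P (labels cs₀) r (λ w → F cs₀ ((s , x) ∷ w))
  IH : ∀ r′ → r′ ≤ r → ∀ x l cs → Unique (labels ((x , l) ∷ cs)) → W ((x , l) ∷ cs) r′ ≡ Hf n r′ (length l) (sizes cs)
  IH r′ q = W≡Hf n r′ (≤-trans (s≤s q) p)
  Φ : ℕ → ℕ → ℕ
  Φ i j = Hf n r i (j ∷ sizes cs) + ∑ (splits (sizes cs)) (λ (B , C) → conv r (λ r₁ r₂ → Hf n r₁ i B * Hf n r₂ j C))
  cut-term : ∀ l₁ s l₂ → l ≡ l₁ ++ s ∷ l₂ → term s ≡ Φ (length l₂) (length l₁)
  cut-term l₁ s l₂ refl = trans (C.∑-term r) (cong₂ _+_ (IH r ≤-refl x l₂ ((s , l₁) ∷ cs) C.unique₁)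
    (trans (∑-congᴬ (All.map (λ {p} q → conv-congᴺ r (λ r₁ r₂ e → cong₂ _*_
        (IH r₁ (≤-trans (m≤m+n r₁ r₂) (≤-reflexive e)) x l₂ (proj₁ p) (proj₁ (C.unique-split (proj₁ p) (proj₂ p) q)))
        (IH r₂ (≤-trans (m≤n+m r₂ r₁) (≤-reflexive e)) s l₁ (proj₂ p) (proj₂ (C.unique-split (proj₁ p) (proj₂ p) q))))) (splits-↭ cs)))
      (sym (∑splits-map (length ∘ proj₂) cs _))))
    where module C = Cut x s l₁ l₂ cs u
  cut-part : ∑ l term ≡ cut (length l) Φ
  cut-part = trans (∑-positions l term (λ i j → Φ j i) cut-term) (sym (cut-comm (length l) Φ))
  join-term : ∀ c cs′ → c ∷ cs′ ↭ cs → ∑ (elems c) term ≡ suc (length (proj₂ c)) * Hf n r (suc (length l + length (proj₂ c))) (sizes cs′)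
  join-term (y , m) cs′ q = ∑-const-positions (y ∷ m) term _ (λ m₁ s m₂ pos →
    let module J = Join x y l m m₁ m₂ s cs cs′ pos q u in
    trans (J.P-term r) (trans (IH r ≤-refl x _ cs′ J.unique₁) (cong (λ z → Hf n r z (sizes cs′)) J.length₁)))
  join-part : ∑ (labels cs) term ≡ ∑ (picks (sizes cs)) (λ (b , C) → suc b * Hf n r (suc (length l + b)) C)
  join-part = begin
    ∑ (labels cs) term ≡⟨ ∑-concatMap elems cs term ⟩
    ∑ cs (λ c → ∑ (elems c) term) ≡⟨ ∑-picks cs _ ⟩
    ∑ (picks cs) (λ (B , C) → ∑ (elems B) term) ≡⟨ ∑-congᴬ (All.map (λ {p} → join-term (proj₁ p) (proj₂ p)) (picks-↭ cs)) ⟩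
    ∑ (picks cs) (λ (B , C) → suc (length (proj₂ B)) * Hf n r (suc (length l + length (proj₂ B))) (sizes C))
      ≡⟨ ∑picks-map (length ∘ proj₂) cs _ ⟨
    _ ∎

-- Strictly monotone words

-- Words with strictly increasing colours: each permutation is the end of exactly one.
SW : List (Fin d) → List (Word d)
SW []      = [] ∷ []
SW (k ∷ L) = SW L ++ concatMap (λ s → map ((s , k) ∷_) (SW L)) L

∑SW-∷ : ∀ (k : Fin d) L f → ∑ (SW (k ∷ L)) f ≡ ∑ (SW L) f + ∑ L (λ s → ∑ (SW L) (λ v → f ((s , k) ∷ v)))
∑SW-∷ k L f = trans (∑-++ (SW L) _ f) (cong (∑ (SW L) f +_) (trans (∑-concatMap _ L f) (∑-cong L (λ s → ∑-map _ (SW L) f))))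

SW-within : ∀ (M : Fin d → Set) L → All M L → All (Within M) (SW L)
SW-within M []      _       = [] ∷ []
SW-within M (k ∷ L) (m ∷ a) = ++⁺ (SW-within M L a)
  (concat⁺ (map⁺ (All.map (λ {s} ms → map⁺ (All.map ((ms , m) ∷_) (SW-within M L a))) a)))

∈⇒↭ : ∀ {x : A} {xs} → x ∈ xs → ∃ λ ys → xs ↭ x ∷ ys
∈⇒↭ x∈ with ∈-∃++ x∈
... | ys , zs , refl = ys ++ zs , shift _ ys zs

∑-swap-closed : ∀ {t b : Fin d} {L} → t ∈ L → b ∈ L → Unique L → ∀ g → ∑ L (g ∘ swap (t , b)) ≡ ∑ L g
∑-swap-closed {t = t} {b} {L} t∈ b∈ u g with t ≟ b
... | yes refl = ∑-cong L (λ y → cong g (swap-joined id refl y))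
... | no t≢b with ∈⇒↭ b∈
...   | L₀ , p with Unique-resp-↭ p u | ∈-resp-↭ p t∈
...     | a ∷ u₀ | here e    = ⊥-elim (t≢b e)
...     | a ∷ u₀ | there t∈₀ = trans (∑-↭ p _) (trans (∑-swap-reindex t∈₀ (∈-All≢ a) u₀ g) (sym (∑-↭ p g)))

cons-invariant : ∀ (τ : Transp d) {f} → Invariant f → Invariant (λ w → f (τ ∷ w))
cons-invariant τ inv p = inv (≈-cons τ p)

prefix-invariant : ∀ (v : Word d) {f} → Invariant f → Invariant (λ w → f (v ++ w))
prefix-invariant v inv p = inv (≈-prefix v p)

-- A Jucys-Murphy element commutes with permutations of the smaller labels: each Hurwitz move
-- permutes the partners s within L, over all of which the sum extends.
step-commute : ∀ {L} {k : Fin d} → Unique L → k ∉ L → ∀ v → Within (_∈ L) v → ∀ {f} → Invariant f → ∀ w →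
  ∑ L (λ s → f (v ++ (s , k) ∷ w)) ≡ ∑ L (λ s → f ((s , k) ∷ v ++ w))
step-commute u k∉ []            []             inv w = refl
step-commute {L = L} {k} u k∉ ((t , b) ∷ v) ((t∈ , b∈) ∷ i) {f} inv w = begin
  ∑ L (λ s → f ((t , b) ∷ v ++ (s , k) ∷ w))          ≡⟨ step-commute u k∉ v i (cons-invariant (t , b) inv) w ⟩
  ∑ L (λ s → f ((t , b) ∷ (s , k) ∷ v ++ w))
    ≡⟨ ∑-cong L (λ s → inv (≈-hurwitz s (v ++ w) (λ e → k∉ (subst (_∈ L) (sym e) t∈)) (λ e → k∉ (subst (_∈ L) (sym e) b∈)))) ⟩
  ∑ L (λ s → f ((swap (t , b) s , k) ∷ (t , b) ∷ v ++ w)) ≡⟨ ∑-swap-closed t∈ b∈ u (λ s → f ((s , k) ∷ (t , b) ∷ v ++ w)) ⟩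
  ∑ L (λ s → f ((s , k) ∷ (t , b) ∷ v ++ w)) ∎
  where open ≡-Reasoning

-- P L (R - m), or 0 if m > R.
P⁻ : List (Fin d) → ℕ → ℕ → (Word d → ℕ) → ℕ
P⁻ L R       zero    f = P L R f
P⁻ L zero    (suc m) f = 0
P⁻ L (suc R) (suc m) f = P⁻ L R m f

P⁻-cong : ∀ (L : List (Fin d)) R m {f g} → (∀ w → f w ≡ g w) → P⁻ L R m f ≡ P⁻ L R m g
P⁻-cong L R       zero    e = P-cong L R e
P⁻-cong L zero    (suc m) e = refl
P⁻-cong L (suc R) (suc m) e = P⁻-cong L R m e

P⁻-∑ : ∀ (L : List (Fin d)) R m (xs : List A) (f : A → Word d → ℕ) → P⁻ L R m (λ w → ∑ xs (λ x → f x w)) ≡ ∑ xs (λ x → P⁻ L R m (f x))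
P⁻-∑ L R       zero    xs f = P-∑ L R xs f
P⁻-∑ L zero    (suc m) xs f = sym (∑-zero xs)
P⁻-∑ L (suc R) (suc m) xs f = P⁻-∑ L R m xs f

P⁻-zero : ∀ (k : Fin d) L m f → P⁻ (k ∷ L) 0 m f ≡ P⁻ L 0 m f
P⁻-zero k L zero    f = sym (P-zero-length L f)
P⁻-zero k L (suc m) f = refl

P⁻-suc : ∀ (k : Fin d) L R m f → P⁻ (k ∷ L) (suc R) m f ≡ P⁻ L (suc R) m f + P⁻ (k ∷ L) R m (step L k f)
P⁻-suc k L R       zero    f = refl
P⁻-suc k L zero    (suc m) f = trans (P⁻-zero k L m f) (sym (+-identityʳ _))
P⁻-suc k L (suc R) (suc m) f = P⁻-suc k L R m f

-- The strict word of ρ enters a loop as it stands, that of σ inverted, hence reversed. `place-∷` is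
-- the common property that absorption uses: after summation over s, the step of the largest colour
-- can be brought to the front.
record Placement (d : ℕ) : Set₁ where
  field
    place        : Word d → Word d
    place-[]     : place [] ≡ []
    place-within : ∀ {M} v → Within M v → Within M (place v)
    place-∷      : ∀ {L} {k : Fin d} → Unique L → k ∉ L → ∀ v → Within (_∈ L) v → ∀ {f} → Invariant f → ∀ w →
                   ∑ L (λ s → f (place ((s , k) ∷ v) ++ w)) ≡ ∑ L (λ s → f ((s , k) ∷ place v ++ w))

forward : Placement d
forward = record { place = id ; place-[] = refl ; place-within = λ v i → i ; place-∷ = λ _ _ v _ inv w → refl }

backward : Placement d
backward = record
  { place        = reverse
  ; place-[]     = refl
  ; place-within = λ v → All-resp-↭ (↭-sym (↭-reverse v))
  ; place-∷      = λ {L} {k} u k∉ v i {f} inv w → trans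
      (∑-cong L (λ s → cong f (trans (cong (_++ w) (unfold-reverse (s , k) v)) (++-assoc (reverse v) [ (s , k) ] w))))
      (step-commute u k∉ (reverse v) (All-resp-↭ (↭-sym (↭-reverse v)) i) inv w)
  }

module Absorb {d} (pl : Placement d) where
  open Placement pl

  -- Multiplication by 1 + x + … commutes with the colours below, and each monomial of e_m h_(R-m) is one of h_R,
  -- met at most once for every subset of the colours.
  absorb : ∀ (L : List (Fin d)) → Unique L → ∀ R {f} → Invariant f →
           ∑ (SW L) (λ v → P⁻ L R (length v) (λ w → f (place v ++ w))) ≤ 2 ^ length L * P L R f
  absorb []      _       R {f} inv = ≤-reflexive (cong (_+ 0) (P-cong [] R (λ w → cong (λ z → f (z ++ w)) place-[])))
  absorb (k ∷ L) (a ∷ u) R {f} inv = begin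
    ∑ (SW (k ∷ L)) (λ v → P⁻ (k ∷ L) R (length v) (λ w → f (place v ++ w))) ≡⟨ ∑SW-∷ k L _ ⟩
    below R f + ∑ L (λ s → ∑ (SW L) (λ v → P⁻ (k ∷ L) R (suc (length v)) (λ w → f (place ((s , k) ∷ v) ++ w))))
      ≤⟨ +-mono-≤ (below-bound R inv) (with-k R) ⟩
    2 ^ length L * P (k ∷ L) R f + 2 ^ length L * P (k ∷ L) R f ≡⟨ lem (2 ^ length L) (P (k ∷ L) R f) ⟩
    2 ^ suc (length L) * P (k ∷ L) R f ∎
    where
    open ≤-Reasoning
    lem : ∀ x y → x * y + x * y ≡ 2 * x * y
    lem = solve-∀
    below : ℕ → (Word d → ℕ) → ℕ
    below R f = ∑ (SW L) (λ v → P⁻ (k ∷ L) R (length v) (λ w → f (place v ++ w)))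
    k∉ = ∈-All≢ a
    within = SW-within (_∈ L) L (All.tabulate id)
    below-bound : ∀ R {f} → Invariant f → below R f ≤ 2 ^ length L * P (k ∷ L) R f
    below-bound zero    {f} inv = begin
      below 0 f ≡⟨ ∑-cong (SW L) (λ v → P⁻-zero k L (length v) _) ⟩
      ∑ (SW L) (λ v → P⁻ L 0 (length v) (λ w → f (place v ++ w))) ≤⟨ absorb L u 0 inv ⟩
      2 ^ length L * P L 0 f ≡⟨ cong (2 ^ length L *_) (P-zero-length L f) ⟩
      2 ^ length L * f [] ∎
    below-bound (suc R) {f} inv = begin
      below (suc R) f ≡⟨ trans (∑-cong (SW L) (λ v → P⁻-suc k L R (length v) _)) (∑-+ (SW L) _ _) ⟩
      ∑ (SW L) (λ v → P⁻ L (suc R) (length v) (λ w → f (place v ++ w)))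
        + ∑ (SW L) (λ v → P⁻ (k ∷ L) R (length v) (λ w → ∑ L (λ s → f (place v ++ (s , k) ∷ w))))
        ≡⟨ cong (∑ (SW L) (λ v → P⁻ L (suc R) (length v) (λ w → f (place v ++ w))) +_)
             (∑-congᴬ (All.map (λ {v} i → P⁻-cong (k ∷ L) R (length v) (step-commute u k∉ (place v) (place-within v i) inv)) within)) ⟩
      ∑ (SW L) (λ v → P⁻ L (suc R) (length v) (λ w → f (place v ++ w))) + below R (step L k f)
        ≤⟨ +-mono-≤ (absorb L u (suc R) inv) (below-bound R (step-invariant L k inv)) ⟩
      2 ^ length L * P L (suc R) f + 2 ^ length L * P (k ∷ L) R (step L k f) ≡⟨ *-distribˡ-+ (2 ^ length L) _ _ ⟨
      2 ^ length L * P (k ∷ L) (suc R) f ∎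
    -- Brought to the front, the step of colour k counts as one of the R monotone steps. So this
    -- half is the half without k for R - 1 steps, with `step L k f` in place of f.
    with-k : ∀ R → ∑ L (λ s → ∑ (SW L) (λ v → P⁻ (k ∷ L) R (suc (length v)) (λ w → f (place ((s , k) ∷ v) ++ w)))) ≤ 2 ^ length L * P (k ∷ L) R f
    with-k zero    = ≤-trans (≤-reflexive (trans (∑-cong L (λ s → ∑-zero (SW L))) (∑-zero L))) z≤n
    with-k (suc R) = begin
      ∑ L (λ s → ∑ (SW L) (λ v → P⁻ (k ∷ L) R (length v) (λ w → f (place ((s , k) ∷ v) ++ w))))
        ≡⟨ ∑-swap L (SW L) _ ⟩
      ∑ (SW L) (λ v → ∑ L (λ s → P⁻ (k ∷ L) R (length v) (λ w → f (place ((s , k) ∷ v) ++ w))))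
        ≡⟨ ∑-congᴬ (All.map (λ {v} i → trans (sym (P⁻-∑ (k ∷ L) R (length v) L _))
             (P⁻-cong (k ∷ L) R (length v) (place-∷ u k∉ v i inv))) within) ⟩
      below R (step L k f) ≤⟨ below-bound R (step-invariant L k inv) ⟩
      2 ^ length L * P (k ∷ L) R (step L k f) ≤⟨ *-monoʳ-≤ (2 ^ length L) (m≤n+m _ (P L (suc R) f)) ⟩
      2 ^ length L * P (k ∷ L) (suc R) f ∎

  absorb⁻ : ∀ (L : List (Fin d)) → Unique L → ∀ R m {f} → Invariant f →
            ∑ (SW L) (λ v → P⁻ L R (m + length v) (λ w → f (place v ++ w))) ≤ 2 ^ length L * P⁻ L R m f
  absorb⁻ L u R       zero    inv = absorb L u R inv
  absorb⁻ L u zero    (suc m) inv = ≤-trans (≤-reflexive (∑-zero (SW L))) z≤n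
  absorb⁻ L u (suc R) (suc m) inv = absorb⁻ L u R m inv

-- One factor 2^d for each end: the inner sum absorbs the reversed word v behind the prefix u, the
-- outer sum then absorbs u.
absorb₂ : ∀ (L : List (Fin d)) → Unique L → ∀ R {f} → Invariant f →
  ∑ (SW L) (λ u → ∑ (SW L) (λ v → P⁻ L R (length u + length v) (λ w → f (u ++ reverse v ++ w)))) ≤ 4 ^ length L * P L R f
absorb₂ L un R {f} inv = begin
  ∑ (SW L) (λ u → ∑ (SW L) (λ v → P⁻ L R (length u + length v) (λ w → f (u ++ reverse v ++ w))))
    ≤⟨ ∑-mono (SW L) (λ u → Absorb.absorb⁻ backward L un R (length u) (prefix-invariant u inv)) ⟩
  ∑ (SW L) (λ u → 2 ^ length L * P⁻ L R (length u) (λ w → f (u ++ w))) ≡⟨ ∑-*ˡ (SW L) (2 ^ length L) _ ⟩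
  2 ^ length L * ∑ (SW L) (λ u → P⁻ L R (length u) (λ w → f (u ++ w)))
    ≤⟨ *-monoʳ-≤ (2 ^ length L) (Absorb.absorb forward L un R inv) ⟩
  2 ^ length L * (2 ^ length L * P L R f) ≡⟨ *-assoc (2 ^ length L) (2 ^ length L) _ ⟨
  2 ^ length L * 2 ^ length L * P L R f ≡⟨ cong (_* P L R f) (^-distribʳ-* (length L) 2 2) ⟨
  4 ^ length L * P L R f ∎
  where
  open ≤-Reasoning

-- The enumerations of walks and permutations

Unique⇒↭ : ∀ {xs ys : List A} → Unique xs → Unique ys → (∀ {x} → x ∈ xs → x ∈ ys) → (∀ {x} → x ∈ ys → x ∈ xs) → xs ↭ ys
Unique⇒↭ {xs = []}     {[]}     _ _ _ _ = ↭-refl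
Unique⇒↭ {xs = []}     {y ∷ ys} _ _ _ g with () ← g (here refl)
Unique⇒↭ {xs = x ∷ xs} {ys} (a ∷ u) v f g with ∈⇒↭ (f (here refl))
... | ys′ , p with Unique-resp-↭ p v
...   | b ∷ v′ = ↭-trans (↭.prep x (Unique⇒↭ u v′ f′ g′)) (↭-sym p)
  where
  f′ : ∀ {z} → z ∈ xs → z ∈ ys′
  f′ m with ∈-resp-↭ p (f (there m))
  ... | here refl = ⊥-elim (∈-All≢ a m)
  ... | there m′  = m′
  g′ : ∀ {z} → z ∈ ys′ → z ∈ xs
  g′ m with g (∈-resp-↭ (↭-sym p) (there m))
  ... | here refl = ⊥-elim (∈-All≢ b m)
  ... | there m′  = m′

∑-⊆ : ∀ {xs ys : List A} → Unique xs → (∀ {x} → x ∈ xs → x ∈ ys) → ∀ f → ∑ xs f ≤ ∑ ys f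
∑-⊆ {xs = []}     _       s f = z≤n
∑-⊆ {xs = x ∷ xs} {ys} (a ∷ u) s f with ∈⇒↭ (s (here refl))
... | ys′ , p = ≤-trans (+-monoʳ-≤ (f x) (∑-⊆ u s′ f)) (≤-reflexive (sym (∑-↭ p f)))
  where
  s′ : ∀ {z} → z ∈ xs → z ∈ ys′
  s′ m with ∈-resp-↭ p (s (there m))
  ... | here refl = ⊥-elim (∈-All≢ a m)
  ... | there m′  = m′

∑-∈ : ∀ {xs : List A} {x} → x ∈ xs → ∀ f → f x ≤ ∑ xs f
∑-∈ (here refl) f = m≤m+n _ _
∑-∈ {xs = y ∷ xs} (there m)   f = ≤-trans (∑-∈ m f) (m≤n+m _ (f y))

∑-filter : ∀ {Q : A → Set} (Q? : ∀ x → Dec (Q x)) xs f → ∑ xs (λ x → ⟦ Q? x ⟧ * f x) ≡ ∑ (filter Q? xs) f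
∑-filter Q? []       f = refl
∑-filter Q? (x ∷ xs) f with Q? x
... | yes _ = cong₂ _+_ (+-identityʳ (f x)) (∑-filter Q? xs f)
... | no  _ = ∑-filter Q? xs f

∑-single : ∀ {xs : List A} {z} → (_≟′_ : ∀ x y → Dec (x ≡ y)) → Unique xs → z ∈ xs → ∀ f → ∑ xs (λ x → ⟦ x ≟′ z ⟧ * f x) ≡ f z
∑-single {xs = xs} {z} _≟′_ u m f = trans (∑-filter (_≟′ z) xs f)
  (trans (∑-↭ (Unique⇒↭ (Unique.filter⁺ (_≟′ z) u) ([] ∷ []) (λ q → here (proj₂ (∈-filter⁻ (_≟′ z) {xs = xs} q)))
     (λ { (here refl) → ∈-filter⁺ (_≟′ z) m refl })) f) (+-identityʳ (f z)))

sum≡∑ : ∀ (f : A → ℕ) xs → sum (map f xs) ≡ ∑ xs f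
sum≡∑ f []       = refl
sum≡∑ f (x ∷ xs) = cong (f x +_) (sum≡∑ f xs)

indicator : Bool → ℕ
indicator b = if b then 1 else 0

countB≡∑ : ∀ (p : A → Bool) xs → countB p xs ≡ ∑ xs (λ x → indicator (p x))
countB≡∑ p []       = refl
countB≡∑ p (x ∷ xs) with p x
... | true  = cong suc (countB≡∑ p xs)
... | false = countB≡∑ p xs

indicator-mono : ∀ b {Q : Set} (Q? : Dec Q) → (b ≡ true → Q) → indicator b ≤ ⟦ Q? ⟧
indicator-mono true  Q? f = ≤-reflexive (sym (⟦⟧-yes Q? (f refl)))
indicator-mono false Q? f = z≤n

indicator-mono′ : ∀ {Q : Set} (Q? : Dec Q) b → (Q → b ≡ true) → ⟦ Q? ⟧ ≤ indicator b
indicator-mono′ (yes q) b f rewrite f q = ≤-refl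
indicator-mono′ (no _)  b f = z≤n

∧-true : ∀ {a b} → a ∧ b ≡ true → a ≡ true × b ≡ true
∧-true {true} {true} refl = refl , refl

≤ᵇ-true : ∀ {m n} → (m ≤ᵇ n) ≡ true → m ≤ n
≤ᵇ-true {m} {n} e = ≤ᵇ⇒≤ m n (subst Bool.T (sym e) tt)

true-≤ᵇ : ∀ {m n} → m ≤ n → (m ≤ᵇ n) ≡ true
true-≤ᵇ {m} {n} p with m ≤ᵇ n | ≤⇒≤ᵇ p
... | true | _ = refl

all-true : ∀ (p : A → Bool) xs → all p xs ≡ true → All (λ x → p x ≡ true) xs
all-true p []       e = []
all-true p (x ∷ xs) e = proj₁ (∧-true e) ∷ all-true p xs (proj₂ (∧-true {p x} e))

true-all : ∀ (p : A → Bool) {xs} → All (λ x → p x ≡ true) xs → all p xs ≡ true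
true-all p []       = refl
true-all p (e ∷ es) rewrite e = true-all p es

-- Walks as monotone words

desc : ∀ k → k ≤ d → List (Fin d)
desc zero    p = []
desc (suc k) p = fromℕ< p ∷ desc k (<⇒≤ p)

desc-< : ∀ k (p : k ≤ d) → All (λ y → toℕ y < k) (desc k p)
desc-< zero    p = []
desc-< (suc k) p = ≤-reflexive (cong suc (toℕ-fromℕ< p)) ∷ All.map m≤n⇒m≤1+n (desc-< k (<⇒≤ p))

desc-∈ : ∀ k (p : k ≤ d) {y} → toℕ y < k → y ∈ desc k p
desc-∈ (suc k) p {y} (s≤s q) with toℕ y ℕ.≟ k
... | yes e = here (toℕ-injective (trans e (sym (toℕ-fromℕ< p))))
... | no  n = there (desc-∈ k (<⇒≤ p) (≤∧≢⇒< q n))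

desc-unique : ∀ k (p : k ≤ d) → Unique (desc k p)
desc-unique zero    p = []
desc-unique (suc k) p = All.map (λ q e → <-irrefl (trans (cong toℕ (sym e)) (toℕ-fromℕ< p)) q) (desc-< k (<⇒≤ p)) ∷ desc-unique k (<⇒≤ p)

desc-length : ∀ k (p : k ≤ d) → length (desc k p) ≡ k
desc-length zero    p = refl
desc-length (suc k) p = cong suc (desc-length k (<⇒≤ p))

∑-desc : ∀ k (p : k ≤ d) (f : Fin d → ℕ) → ∑ (allFin d) (λ s → ⟦ toℕ s <? k ⟧ * f s) ≡ ∑ (desc k p) f
∑-desc {d} k p f = trans (∑-filter (λ s → toℕ s <? k) (allFin d) f)
  (∑-↭ (Unique⇒↭ (Unique.filter⁺ (λ s → toℕ s <? k) (Unique.allFin⁺ d)) (desc-unique k p)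
     (λ m → desc-∈ k p (proj₂ (∈-filter⁻ (λ s → toℕ s <? k) {xs = allFin d} m)))
     (λ m → ∈-filter⁺ (λ s → toℕ s <? k) (∈-allFin _) (All.lookup (desc-< k p) m))) f)

∑-if : ∀ b (x : A) f → ∑ (if b then x ∷ [] else []) f ≡ indicator b * f x
∑-if true  x f = refl
∑-if false x f = refl

indicator-≤ᵇ : ∀ m n → indicator (m ≤ᵇ n) ≡ ⟦ m ≤? n ⟧
indicator-≤ᵇ m n with m ≤? n
... | yes p rewrite true-≤ᵇ p = refl
... | no ¬p with m ≤ᵇ n in eq
...   | true  = ⊥-elim (¬p (≤ᵇ-true eq))
...   | false = refl

∑-allTransp : ∀ d (f : Transp d → ℕ) → ∑ (allTransp d) f ≡ ∑ (allFin d) (λ s → ∑ (allFin d) (λ t → ⟦ toℕ s <? toℕ t ⟧ * f (s , t)))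
∑-allTransp d f = trans (∑-concatMap _ (allFin d) f) (∑-cong (allFin d) (λ s → trans (∑-concatMap _ (allFin d) f)
  (∑-cong (allFin d) (λ t → trans (∑-if (suc (toℕ s) ≤ᵇ toℕ t) (s , t) f) (cong (_* f (s , t)) (indicator-≤ᵇ (suc (toℕ s)) (toℕ t)))))))

∑-colour : ∀ k (p : suc k ≤ d) (f : Transp d → ℕ) → ∑ (allTransp d) (λ τ → ⟦ toℕ (proj₂ τ) ℕ.≟ k ⟧ * f τ) ≡ ∑ (desc k (<⇒≤ p)) (λ s → f (s , fromℕ< p))
∑-colour {d} k p f = begin
  ∑ (allTransp d) (λ τ → ⟦ toℕ (proj₂ τ) ℕ.≟ k ⟧ * f τ) ≡⟨ ∑-allTransp d _ ⟩
  ∑ (allFin d) (λ s → ∑ (allFin d) (λ t → ⟦ toℕ s <? toℕ t ⟧ * (⟦ toℕ t ℕ.≟ k ⟧ * f (s , t))))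
    ≡⟨ ∑-cong (allFin d) (λ s → trans (∑-cong (allFin d) (λ t → trans (*-left-comm ⟦ toℕ s <? toℕ t ⟧ ⟦ toℕ t ℕ.≟ k ⟧ (f (s , t)))
         (cong (_* (⟦ toℕ s <? toℕ t ⟧ * f (s , t))) (⟦⟧-cong (toℕ t ℕ.≟ k) (t ≟ κ) (λ e → toℕ-injective (trans e (sym (toℕ-fromℕ< p)))) (λ e → trans (cong toℕ e) (toℕ-fromℕ< p))))))
         (∑-single _≟_ (Unique.allFin⁺ d) (∈-allFin κ) (λ t → ⟦ toℕ s <? toℕ t ⟧ * f (s , t)))) ⟩
  ∑ (allFin d) (λ s → ⟦ toℕ s <? toℕ κ ⟧ * f (s , κ))
    ≡⟨ ∑-cong (allFin d) (λ s → cong (λ z → ⟦ toℕ s <? z ⟧ * f (s , κ)) (toℕ-fromℕ< p)) ⟩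
  ∑ (allFin d) (λ s → ⟦ toℕ s <? k ⟧ * f (s , κ)) ≡⟨ ∑-desc k (<⇒≤ p) (λ s → f (s , κ)) ⟩
  ∑ (desc k (<⇒≤ p)) (λ s → f (s , κ)) ∎
  where
  open ≡-Reasoning
  κ = fromℕ< p

∑-walks-suc : ∀ d r (f : List (Transp d) → ℕ) → ∑ (walks d (suc r)) f ≡ ∑ (allTransp d) (λ τ → ∑ (walks d r) (λ w → f (τ ∷ w)))
∑-walks-suc d r f = trans (∑-concatMap _ (allTransp d) f) (∑-cong (allTransp d) (λ τ → ∑-map _ (walks d r) f))

∑-walks-∷ʳ : ∀ d r (f : List (Transp d) → ℕ) → ∑ (walks d (suc r)) f ≡ ∑ (walks d r) (λ w → ∑ (allTransp d) (λ τ → f (w ∷ʳ τ)))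
∑-walks-∷ʳ d zero    f = trans (∑-walks-suc d 0 f) (trans (∑-cong (allTransp d) (λ τ → +-identityʳ _)) (sym (+-identityʳ _)))
∑-walks-∷ʳ d (suc r) f = begin
  ∑ (walks d (2 + r)) f ≡⟨ ∑-walks-suc d (suc r) f ⟩
  ∑ (allTransp d) (λ τ → ∑ (walks d (suc r)) (λ w → f (τ ∷ w))) ≡⟨ ∑-cong (allTransp d) (λ τ → ∑-walks-∷ʳ d r (λ w → f (τ ∷ w))) ⟩
  ∑ (allTransp d) (λ τ → ∑ (walks d r) (λ w → ∑ (allTransp d) (λ τ′ → f (τ ∷ w ∷ʳ τ′)))) ≡⟨ ∑-walks-suc d r _ ⟨
  ∑ (walks d (suc r)) (λ w → ∑ (allTransp d) (λ τ → f (w ∷ʳ τ))) ∎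
  where open ≡-Reasoning

colour : Transp d → ℕ
colour τ = toℕ (proj₂ τ)

monotone-∷ʳ : ∀ (w : List (Transp d)) τ → monotone (w ∷ʳ τ) ≡ true → monotone w ≡ true × All (λ τ′ → colour τ′ ≤ colour τ) w
monotone-∷ʳ []            τ e = refl , []
monotone-∷ʳ (τ₁ ∷ [])     τ e = refl , ≤ᵇ-true (proj₁ (∧-true {colour τ₁ ≤ᵇ colour τ} e)) ∷ []
monotone-∷ʳ (τ₁ ∷ τ₂ ∷ w) τ e =
  let p , q = ∧-true {colour τ₁ ≤ᵇ colour τ₂} e
      m , a = monotone-∷ʳ (τ₂ ∷ w) τ q
  in cong₂ _∧_ p m , ≤-trans (≤ᵇ-true p) (All.head a) ∷ a

∷ʳ-monotone : ∀ (w : List (Transp d)) τ → monotone w ≡ true → All (λ τ′ → colour τ′ ≤ colour τ) w → monotone (w ∷ʳ τ) ≡ true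
∷ʳ-monotone []            τ m a = refl
∷ʳ-monotone (τ₁ ∷ [])     τ m (a ∷ []) rewrite true-≤ᵇ a = refl
∷ʳ-monotone (τ₁ ∷ τ₂ ∷ w) τ m (a ∷ as) =
  let p , q = ∧-true {colour τ₁ ≤ᵇ colour τ₂} m
  in cong₂ _∧_ p (∷ʳ-monotone (τ₂ ∷ w) τ q as)

MonotoneBelow : ℕ → List (Transp d) → Set
MonotoneBelow k w = monotone w ≡ true × All (λ τ → colour τ < k) w

monotoneBelow? : ∀ k (w : List (Transp d)) → Dec (MonotoneBelow k w)
monotoneBelow? k w = (monotone w Bool.≟ true) ×-dec all? (λ τ → colour τ <? k) w

All-∷ʳ⁻ : ∀ {Q : A → Set} xs {x} → All Q (xs ∷ʳ x) → All Q xs × Q x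
All-∷ʳ⁻ xs a = ++⁻ˡ xs a , All.head (++⁻ʳ xs a)

monotoneBelow-∷ʳ : ∀ k (w : List (Transp d)) τ →
  ⟦ monotoneBelow? (suc k) (w ∷ʳ τ) ⟧ ≡ ⟦ monotoneBelow? k (w ∷ʳ τ) ⟧ + ⟦ monotoneBelow? (suc k) w ⟧ * ⟦ colour τ ℕ.≟ k ⟧
monotoneBelow-∷ʳ k w τ = trans
  (⟦⟧-cong (monotoneBelow? (suc k) (w ∷ʳ τ)) (monotoneBelow? k (w ∷ʳ τ) ⊎-dec (monotoneBelow? (suc k) w ×-dec (colour τ ℕ.≟ k))) to from)
  (trans (⟦⊎⟧ (monotoneBelow? k (w ∷ʳ τ)) _ (λ (_ , a) (_ , e) → <-irrefl e (proj₂ (All-∷ʳ⁻ w a))))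
    (cong (⟦ monotoneBelow? k (w ∷ʳ τ) ⟧ +_) (⟦⟧-× (monotoneBelow? (suc k) w) (colour τ ℕ.≟ k))))
  where
  to : MonotoneBelow (suc k) (w ∷ʳ τ) → MonotoneBelow k (w ∷ʳ τ) ⊎ (MonotoneBelow (suc k) w × colour τ ≡ k)
  to (m , a) with monotone-∷ʳ w τ m | All-∷ʳ⁻ w a
  ... | m′ , le | a′ , s≤s c with colour τ ℕ.≟ k
  ...   | yes e = inj₂ ((m′ , a′) , e)
  ...   | no  n = inj₁ (m , ++⁺ (All.map (λ l → ≤-<-trans l (≤∧≢⇒< c n)) le) (≤∧≢⇒< c n ∷ []))
  from : MonotoneBelow k (w ∷ʳ τ) ⊎ (MonotoneBelow (suc k) w × colour τ ≡ k) → MonotoneBelow (suc k) (w ∷ʳ τ)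
  from (inj₁ (m , a))          = m , All.map m≤n⇒m≤1+n a
  from (inj₂ ((m , a) , refl)) = ∷ʳ-monotone w τ m (All.map s≤s⁻¹ a) , ++⁺ a (≤-refl ∷ [])

-- Both sides split according to whether the last step has the largest admissible colour. The
-- reversal appears because words list the last step first.
walks-P : ∀ k (p : k ≤ d) r f → ∑ (walks d r) (λ w → ⟦ monotoneBelow? k w ⟧ * f w) ≡ P (desc k p) r (f ∘ reverse)
walks-P zero    p zero    f = trans (+-identityʳ _) (+-identityʳ _)
walks-P {d} zero p (suc r) f = trans (∑-walks-∷ʳ d r _) (trans (∑-cong (walks d r) (λ w → trans (∑-cong (allTransp d)
  (λ τ → cong (_* f (w ∷ʳ τ)) (⟦⟧-no (monotoneBelow? 0 (w ∷ʳ τ)) (λ (_ , a) → n≮0 (proj₂ (All-∷ʳ⁻ w a)))))) (∑-zero (allTransp d)))) (∑-zero (walks d r)))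
walks-P (suc k) p zero    f = trans (+-identityʳ _) (+-identityʳ _)
walks-P {d} (suc k) p (suc r) f = begin
  ∑ (walks d (suc r)) (λ w → ⟦ monotoneBelow? (suc k) w ⟧ * f w) ≡⟨ ∑-walks-∷ʳ d r _ ⟩
  ∑ (walks d r) (λ w → ∑ (allTransp d) (λ τ → ⟦ monotoneBelow? (suc k) (w ∷ʳ τ) ⟧ * f (w ∷ʳ τ)))
    ≡⟨ ∑-cong (walks d r) (λ w → trans (∑-cong (allTransp d) (λ τ → trans (cong (_* f (w ∷ʳ τ)) (monotoneBelow-∷ʳ k w τ))
         (lem ⟦ monotoneBelow? k (w ∷ʳ τ) ⟧ ⟦ monotoneBelow? (suc k) w ⟧ ⟦ colour τ ℕ.≟ k ⟧ (f (w ∷ʳ τ)))))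
         (trans (∑-+ (allTransp d) _ _) (cong (∑ (allTransp d) (λ τ → ⟦ monotoneBelow? k (w ∷ʳ τ) ⟧ * f (w ∷ʳ τ)) +_)
           (trans (∑-*ˡ (allTransp d) ⟦ monotoneBelow? (suc k) w ⟧ _) (cong (⟦ monotoneBelow? (suc k) w ⟧ *_) (∑-colour k p (λ τ → f (w ∷ʳ τ)))))))) ⟩
  ∑ (walks d r) (λ w → ∑ (allTransp d) (λ τ → ⟦ monotoneBelow? k (w ∷ʳ τ) ⟧ * f (w ∷ʳ τ)) + ⟦ monotoneBelow? (suc k) w ⟧ * ∑ L (λ s → f (w ∷ʳ (s , κ))))
    ≡⟨ ∑-+ (walks d r) _ _ ⟩
  ∑ (walks d r) (λ w → ∑ (allTransp d) (λ τ → ⟦ monotoneBelow? k (w ∷ʳ τ) ⟧ * f (w ∷ʳ τ))) + ∑ (walks d r) (λ w → ⟦ monotoneBelow? (suc k) w ⟧ * ∑ L (λ s → f (w ∷ʳ (s , κ))))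
    ≡⟨ cong₂ _+_ (trans (sym (∑-walks-∷ʳ d r (λ w → ⟦ monotoneBelow? k w ⟧ * f w))) (walks-P k (<⇒≤ p) (suc r) f)) (walks-P (suc k) p r (λ w → ∑ L (λ s → f (w ∷ʳ (s , κ))))) ⟩
  P L (suc r) (f ∘ reverse) + P (κ ∷ L) r (λ w → ∑ L (λ s → f (reverse w ∷ʳ (s , κ))))
    ≡⟨ cong (P L (suc r) (f ∘ reverse) +_) (P-cong (κ ∷ L) r (λ w → ∑-cong L (λ s → cong f (sym (unfold-reverse (s , κ) w))))) ⟩
  P (desc (suc k) p) (suc r) (f ∘ reverse) ∎
  where
  open ≡-Reasoning
  κ = fromℕ< p
  L = desc k (<⇒≤ p)
  lem : ∀ a b c f → (a + b * c) * f ≡ a * f + b * (c * f)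
  lem = solve-∀

-- Permutations as strict words

Injective : (Fin d → Fin d) → Set
Injective f = ∀ {y z} → f y ≡ f z → y ≡ z

true-≟ : ∀ {i j : Fin d} → eqF i j ≡ true → i ≡ j
true-≟ {i = i} {j} e with i ≟ j
... | yes p = p

≟-true : ∀ {i j : Fin d} → i ≡ j → eqF i j ≡ true
≟-true {i = i} {j} p with i ≟ j
... | yes _ = refl
... | no ¬p = ⊥-elim (¬p p)

not-true : ∀ {b} → not b ≡ true → b ≢ true
not-true {false} _ ()

∨-true : ∀ a {b} → a ∨ b ≡ true → a ≡ true ⊎ b ≡ true
∨-true true  e = inj₁ refl
∨-true false e = inj₂ e

isInj⇒injective : ∀ (v : Vec (Fin d) d) → isInjVec v ≡ true → Injective (lookup v)
isInj⇒injective {d} v e {y} {z} q with ∨-true (not (eqF (lookup v y) (lookup v z))) (All.lookup (all-true _ (allFin d) (All.lookup (all-true _ (allFin d) e) (∈-allFin y))) (∈-allFin z))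
... | inj₁ n = ⊥-elim (not-true n (≟-true q))
... | inj₂ p = true-≟ p

injective⇒isInj : ∀ (v : Vec (Fin d) d) → Injective (lookup v) → isInjVec v ≡ true
injective⇒isInj {d} v inj = true-all _ (All.tabulate {xs = allFin d} (λ {i} _ → true-all _ (All.tabulate {xs = allFin d} (λ {j} _ → pair i j))))
  where
  pair : ∀ i j → not (eqF (lookup v i) (lookup v j)) ∨ eqF i j ≡ true
  pair i j with lookup v i ≟ lookup v j
  ... | yes p = ≟-true (inj p)
  ... | no  _ = refl

-- The definition of perms filters with a local function. The type of perms-filter, which mentions it, is
-- inferred from perms≡.
mutual
  perms≡ : ∀ d → perms d ≡ map lookup (filterᵇ isInjVec (vecsOver (allFin d) d))
  perms≡ d with vecsOver (allFin d) d
  ... | vs = perms-filter d vs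

  perms-filter : ∀ d vs → _
  perms-filter d []       = refl
  perms-filter d (v ∷ vs) with isInjVec v
  ... | true  = cong (lookup v ∷_) (perms-filter d vs)
  ... | false = perms-filter d vs

permVecs : ∀ d → List (Vec (Fin d) d)
permVecs d = filterᵇ isInjVec (vecsOver (allFin d) d)

vecsOver-suc : ∀ (xs : List A) n → vecsOver xs (suc n) ≡ cartesianProductWith Vec._∷_ xs (vecsOver xs n)
vecsOver-suc {A} xs n = go xs
  where
  go : ∀ ys → concatMap (λ x → map (x Vec.∷_) (vecsOver xs n)) ys ≡ cartesianProductWith Vec._∷_ ys (vecsOver xs n)
  go []       = refl
  go (y ∷ ys) = cong (map (y Vec.∷_) (vecsOver xs n) ++_) (go ys)

vecsOver-unique : ∀ {xs : List A} → Unique xs → ∀ n → Unique (vecsOver xs n)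
vecsOver-unique u zero    = [] ∷ []
vecsOver-unique {xs = xs} u (suc n) rewrite vecsOver-suc xs n = Unique.cartesianProductWith⁺ Vec._∷_ ∷-injectiveᵛ u (vecsOver-unique u n)

vecsOver-∈ : ∀ {xs : List A} → (∀ x → x ∈ xs) → ∀ n (v : Vec A n) → v ∈ vecsOver xs n
vecsOver-∈ a zero    Vec.[]       = here refl
vecsOver-∈ {xs = xs} a (suc n) (x Vec.∷ v) rewrite vecsOver-suc xs n = ∈-cartesianProductWith⁺ Vec._∷_ (a x) (vecsOver-∈ a n v)

permVecs-unique : ∀ d → Unique (permVecs d)
permVecs-unique d = Unique.filter⁺ (T? ∘ isInjVec) (vecsOver-unique (Unique.allFin⁺ d) d)

permVecs-injective : ∀ {v} → v ∈ permVecs d → Injective (lookup v)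
permVecs-injective {d} {v} m = isInj⇒injective v (T⇒true (isInjVec v) (proj₂ (∈-filter⁻ (T? ∘ isInjVec) {xs = vecsOver (allFin d) d} m)))
  where
  T⇒true : ∀ b → Bool.T b → b ≡ true
  T⇒true true _ = refl

injective-permVecs : ∀ {v} → Injective (lookup v) → v ∈ permVecs d
injective-permVecs {d} {v} inj = ∈-filter⁺ (T? ∘ isInjVec) (vecsOver-∈ ∈-allFin d v) (subst Bool.T (sym (injective⇒isInj v inj)) tt)

∑-perms : ∀ d f → ∑ (perms d) f ≡ ∑ (permVecs d) (f ∘ lookup)
∑-perms d f = trans (cong (λ z → ∑ z f) (perms≡ d)) (∑-map lookup (permVecs d) f)

injective⇒surjective : ∀ (ρ : Fin d → Fin d) → Injective ρ → ∀ z → ∃ λ y → ρ y ≡ z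
injective⇒surjective {suc n} ρ inj z with any? (λ y → ρ y ≟ z)
... | yes r = r
... | no ¬r = ⊥-elim (1+n≰n (injective⇒≤ {f = λ y → punchOut (λ e → ¬r (y , sym e))} (λ {y} {y′} e → inj (punchOut-injective (λ e → ¬r (y , sym e)) (λ e → ¬r (y′ , sym e)) e))))

SW-∷⁺ : ∀ {L} {k s : Fin d} {u} → s ∈ L → u ∈ SW L → (s , k) ∷ u ∈ SW (k ∷ L)
SW-∷⁺ {L = L} {k} {s} s∈ u∈ = ∈-++⁺ʳ (SW L) (∈-concat⁺′ (∈-map⁺ ((s , k) ∷_) u∈) (∈-map⁺ (λ s → map ((s , k) ∷_) (SW L)) s∈))

SW-∷⁻ : ∀ L (k : Fin d) {u} → u ∈ SW (k ∷ L) → u ∈ SW L ⊎ (∃ λ s → ∃ λ u′ → s ∈ L × u′ ∈ SW L × u ≡ (s , k) ∷ u′)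
SW-∷⁻ L k u∈ with ∈-++⁻ (SW L) u∈
... | inj₁ m = inj₁ m
... | inj₂ m with ∈-concat⁻′ (map (λ s → map ((s , k) ∷_) (SW L)) L) m
...   | _ , u∈′ , l∈ with ∈-map⁻ _ l∈
...     | s , s∈ , refl with ∈-map⁻ _ u∈′
...       | u′ , u′∈ , e = inj₂ (s , u′ , s∈ , u′∈ , e)

-- If s is the preimage of the largest point κ that may move, then ρ ∘ (s κ) fixes κ, which leaves a
-- smaller case; no step is spent when s = κ.
SW-cover : ∀ k (p : k ≤ d) (ρ : Fin d → Fin d) → Injective ρ → (∀ y → k ≤ toℕ y → ρ y ≡ y) → ∃ λ u → u ∈ SW (desc k p) × (∀ y → end u y ≡ ρ y)
SW-cover zero    p ρ inj fix = [] , here refl , λ y → sym (fix y z≤n)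
SW-cover {d} (suc k) p ρ inj fix with injective⇒surjective ρ inj (fromℕ< p)
... | s , ρs with s ≟ fromℕ< p
...   | yes refl = let u , u∈ , e = SW-cover k (<⇒≤ p) ρ inj fix′ in u , ∈-++⁺ˡ u∈ , e
  where
  fix′ : ∀ y → k ≤ toℕ y → ρ y ≡ y
  fix′ y q with toℕ y ℕ.≟ k
  ... | yes e = subst (λ z → ρ z ≡ z) (toℕ-injective (trans (toℕ-fromℕ< p) (sym e))) ρs
  ... | no  n = fix y (≤∧≢⇒< q (n ∘ sym))
...   | no s≢κ = (s , κ) ∷ u , SW-∷⁺ (desc-∈ k (<⇒≤ p) s<k) u∈ , λ y → trans (e (swap (s , κ) y)) (cong ρ (swap-involutive (s , κ) y))
  where
  κ = fromℕ< p
  ρ′ = ρ ∘ swap (s , κ)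
  s<k : toℕ s < k
  s<k with <-cmp (toℕ s) k

  ... | tri< l _ _ = l
  ... | tri≈ _ e _ = ⊥-elim (s≢κ (toℕ-injective (trans e (sym (toℕ-fromℕ< p)))))
  ... | tri> _ _ g = ⊥-elim (s≢κ (trans (sym (fix s g)) ρs))
  fix′ : ∀ y → k ≤ toℕ y → ρ′ y ≡ y
  fix′ y q with swap-cases s κ y
  ... | inj₁ (y≡s , _)               = ⊥-elim (<⇒≱ s<k (subst (λ z → k ≤ toℕ z) y≡s q))
  ... | inj₂ (inj₁ (y≡κ , e))        = trans (cong ρ e) (trans ρs (sym y≡κ))
  ... | inj₂ (inj₂ (_ , y≢κ , e))  = trans (cong ρ e)
    (fix y (≤∧≢⇒< q (λ k≡ → y≢κ (toℕ-injective (trans (sym k≡) (sym (toℕ-fromℕ< p)))))))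
  rec = SW-cover k (<⇒≤ p) ρ′ (swap-injective (s , κ) ∘ inj) fix′
  u  = proj₁ rec
  u∈ = proj₁ (proj₂ rec)
  e  = proj₂ (proj₂ rec)

-- Cycle decompositions and the number of cycles

singletons : List (Fin d) → List (Cycle d)
singletons = map (_, [])

labels-singletons : ∀ (xs : List (Fin d)) → labels (singletons xs) ≡ xs
labels-singletons []       = refl
labels-singletons (x ∷ xs) = cong (x ∷_) (labels-singletons xs)

record CycleDecomposition (d : ℕ) (σ : Fin d → Fin d) (m : ℕ) : Set where
  field
    cycles  : List (Cycle d)
    isCycles : Cycles σ cycles
    total   : labels cycles ↭ allFin d
    count   : length cycles + m ≡ d

-- Each step of a strict word joins the fixed point given by its colour to another cycle.
SW-cycles : ∀ k (p : k ≤ d) u → u ∈ SW (desc k p) →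
  Σ (CycleDecomposition d (end u) (length u)) λ D → ∀ y → k ≤ toℕ y → (y , []) ∈ CycleDecomposition.cycles D
SW-cycles {d} zero p u (here refl) = record
  { cycles   = singletons (allFin d)
  ; isCycles = map⁺ (All.tabulate (λ _ → refl))
  ; total    = ↭.↭-reflexive (labels-singletons (allFin d))
  ; count    = trans (+-identityʳ _) (trans (length-map (_, []) (allFin d)) (length-tabulate {n = d} id))
  } , λ y _ → ∈-map⁺ (_, []) (∈-allFin y)
SW-cycles {d} (suc k) p u u∈ with SW-∷⁻ (desc k (<⇒≤ p)) (fromℕ< p) u∈
... | inj₁ u∈′ = let D , f = SW-cycles k (<⇒≤ p) u u∈′ in D , λ y q → f y (<⇒≤ q)
... | inj₂ (s , u′ , s∈ , u∈′ , refl) with SW-cycles k (<⇒≤ p) u′ u∈′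
...   | D , single with ∈⇒↭ (single (fromℕ< p) (≤-reflexive (sym (toℕ-fromℕ< p))))
...     | cs , κ↭ with ∈-resp-↭ (labels-↭ κ↭) (∈-resp-↭ (↭-sym (CycleDecomposition.total D)) (∈-allFin s))
...       | here s≡κ = ⊥-elim (<-irrefl (trans (cong toℕ s≡κ) (toℕ-fromℕ< p)) (All.lookup (desc-< k (<⇒≤ p)) s∈))
...       | there s∈cs with ∈-concat⁻′ (map elems cs) s∈cs
...         | _ , s∈c , c∈ with ∈-map⁻ elems c∈
...           | (y , m) , c∈cs , refl with ∈-∃++ s∈c | ∈⇒↭ c∈cs
...             | m₁ , m₂ , pos | cs′ , c↭ = record
  { cycles   = J.cs₁
  ; isCycles = C.cycles-join u′ (joinable (All-resp-↭ κ↭ isCycles))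
  ; total    = ↭-trans (↭-sym J.perm) (↭-trans (labels-↭ (↭-sym κ↭)) total)
  ; count    = trans (+-suc (suc (length cs′)) (length u′)) (trans (cong (_+ length u′) (sym (trans (↭-length κ↭) (cong suc (↭-length c↭))))) count)
  } , single′
  where
  open CycleDecomposition D
  κ = fromℕ< p
  module J = Join κ y [] m m₁ m₂ s cs cs′ pos (↭-sym c↭) (Unique-resp-↭ (↭-trans (↭-sym total) (labels-↭ κ↭)) (Unique.allFin⁺ d))
  module C = Cut κ s (m₂ ++ m₁) [] cs′ J.unique₁
  joinable : Cycles (end u′) ((κ , []) ∷ cs) → Cycles (end u′) ((κ , []) ∷ (s , m₂ ++ m₁) ∷ cs′)
  joinable (κc ∷ a) with All-resp-↭ c↭ a
  ... | c ∷ a′ = κc ∷ IsCycle-rotate m₁ pos c ∷ a′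
  s<k = All.lookup (desc-< k (<⇒≤ p)) s∈
  single′ : ∀ z → suc k ≤ toℕ z → (z , []) ∈ J.cs₁
  single′ z q with ∈-resp-↭ κ↭ (single z (<⇒≤ q))
  ... | here refl = ⊥-elim (<-irrefl (sym (toℕ-fromℕ< p)) q)
  ... | there z∈ with ∈-resp-↭ c↭ z∈
  ...   | there z∈′ = there z∈′
  ...   | here e with subst (λ c → s ∈ elems c) (sym e) s∈c
  ...     | here refl = ⊥-elim (<⇒≱ s<k (<⇒≤ q))

iter-shift : ∀ j (f : A → A) x → iter j f (f x) ≡ iter (suc j) f x
iter-shift zero    f x = refl
iter-shift (suc j) f x = cong f (iter-shift j f x)

Path-reach : ∀ {σ : Fin d → Fin d} x l {z} → Path σ x l z → ∀ {y} → y ∈ x ∷ l → ∃ λ j → j ≤ length l × iter j σ x ≡ y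
Path-reach x l       p       (here refl) = 0 , z≤n , refl
Path-reach {σ = σ} x (v ∷ l) (p , q) (there m) with Path-reach v l q m
... | j , j≤ , e = suc j , s≤s j≤ , trans (sym (iter-shift j σ x)) (trans (cong (iter j σ) p) e)

Path-closed : ∀ {σ : Fin d → Fin d} x l {z} → Path σ x l z → ∀ {y} → y ∈ x ∷ l → σ y ∈ l ⊎ σ y ≡ z
Path-closed x []      p       (here refl) = inj₂ p
Path-closed x (v ∷ l) (p , q) (here refl) = inj₁ (here p)
Path-closed x (v ∷ l) (p , q) (there m) with Path-closed v l q m
... | inj₁ r = inj₁ (there r)
... | inj₂ r = inj₂ r

IsCycle-iter : ∀ {σ : Fin d → Fin d} {c} → IsCycle σ c → ∀ {y} → y ∈ elems c → ∀ j → iter j σ y ∈ elems c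
IsCycle-iter c m zero    = m
IsCycle-iter {c = x , l} c m (suc j) with Path-closed x l c (IsCycle-iter c m j)
... | inj₁ r = there r
... | inj₂ r = here r

IsCycle-reach : ∀ {σ : Fin d → Fin d} {c} → IsCycle σ c → ∀ {x y} → x ∈ elems c → y ∈ elems c → ∃ λ j → j < length (elems c) × iter j σ x ≡ y
IsCycle-reach {c = z , l} c {x} {y} x∈ y∈ with ∈-∃++ x∈
... | m₁ , m₂ , pos with Path-reach x (m₂ ++ m₁) (IsCycle-rotate m₁ pos c) (∈-resp-↭ perm y∈)
  where
  perm : z ∷ l ↭ x ∷ m₂ ++ m₁
  perm = ↭-trans (↭.↭-reflexive pos) (++-comm m₁ (x ∷ m₂))
... | j , j≤ , e = j , ≤-trans (s≤s j≤) (≤-reflexive (trans (cong suc (trans (length-++ m₂) (+-comm (length m₂) _)))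
      (trans (sym (+-suc (length m₁) (length m₂))) (trans (sym (length-++ m₁)) (cong length (sym pos)))))) , e

minimum : ∀ (x : Fin d) l → ∃ λ z → z ∈ x ∷ l × All (λ y → toℕ z ≤ toℕ y) (x ∷ l)
minimum x []      = x , here refl , ≤-refl ∷ []
minimum x (y ∷ l) with minimum y l
... | z , m , a with ≤-total (toℕ x) (toℕ z)
...   | inj₁ q = x , here refl , ≤-refl ∷ All.map (≤-trans q) a
...   | inj₂ q = z , there m , q ∷ a

isMinimal : (Fin d → Fin d) → Fin d → Bool
isMinimal {d} f x = all (λ k → toℕ x ≤ᵇ toℕ (iter k f x)) (upTo (suc d))

module _ {d} {σ : Fin d → Fin d} {m} (D : CycleDecomposition d σ m) where
  open CycleDecomposition D

  private
    unique : Unique (labels cycles)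
    unique = Unique-resp-↭ (↭-sym total) (Unique.allFin⁺ d)

    one-minimum : ∀ {c} → c ∈ cycles → ∑ (elems c) (indicator ∘ isMinimal σ) ≡ 1
    one-minimum {x , l} c∈ = trans (∑-congᴬ (All.tabulate at)) (∑-single {xs = x ∷ l} _≟_ uniqueᶜ z∈ (λ _ → 1))
      where
      c = All.lookup isCycles c∈
      labels∈ = ∈⇒↭ c∈
      perm : labels cycles ↭ (x ∷ l) ++ labels (proj₁ labels∈)
      perm = labels-↭ (proj₂ labels∈)
      uniqueᶜ : Unique (x ∷ l)
      uniqueᶜ = proj₁ (Unique-++⁻ (x ∷ l) (Unique-resp-↭ perm unique))
      -- `numCycles` inspects the iterates 0 to d only; they exhaust a cycle because its length is
      -- at most d.
      length≤ : length (x ∷ l) ≤ d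
      length≤ = ≤-trans (≤-trans (m≤m+n _ _) (≤-reflexive (sym (length-++ (x ∷ l) {labels (proj₁ labels∈)}))))
        (≤-reflexive (trans (sym (↭-length perm)) (trans (↭-length total) (length-tabulate {n = d} id))))
      mn = minimum x l
      z = proj₁ mn
      z∈ = proj₁ (proj₂ mn)
      z-min = proj₂ (proj₂ mn)
      to : ∀ {y} → y ∈ x ∷ l → isMinimal σ y ≡ true → y ≡ z
      to {y} y∈ e with IsCycle-reach c y∈ z∈
      ... | j , j< , r = toℕ-injective (≤-antisym
        (subst (λ v → toℕ y ≤ toℕ v) r (≤ᵇ-true (All.lookup (all-true _ (upTo (suc d)) e) (∈-upTo⁺ (≤-trans j< (≤-trans length≤ (n≤1+n d)))))))
        (All.lookup z-min y∈))
      from : ∀ {y} → y ∈ x ∷ l → y ≡ z → isMinimal σ y ≡ true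
      from {y} y∈ y≡z = true-all _ (All.tabulate {xs = upTo (suc d)} (λ {j} _ → true-≤ᵇ (subst (λ v → toℕ v ≤ toℕ (iter j σ y)) (sym y≡z) (All.lookup z-min (IsCycle-iter c y∈ j)))))
      at : ∀ {y} → y ∈ x ∷ l → indicator (isMinimal σ y) ≡ ⟦ y ≟ z ⟧ * 1
      at {y} y∈ = trans (≤-antisym (indicator-mono _ (y ≟ z) (to y∈)) (indicator-mono′ (y ≟ z) _ (from y∈))) (sym (*-identityʳ _))

  numCycles≡ : numCycles σ ≡ length cycles
  numCycles≡ = begin
    numCycles σ                                                ≡⟨ countB≡∑ (isMinimal σ) (allFin d) ⟩
    ∑ (allFin d) (indicator ∘ isMinimal σ)                     ≡⟨ ∑-↭ total _ ⟨
    ∑ (labels cycles) (indicator ∘ isMinimal σ)                ≡⟨ ∑-concatMap elems cycles _ ⟩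
    ∑ cycles (λ c → ∑ (elems c) (indicator ∘ isMinimal σ))     ≡⟨ ∑-congᴬ (All.tabulate one-minimum) ⟩
    ∑ cycles (λ _ → 1)                                         ≡⟨ ∑-const cycles 1 ⟩
    length cycles * 1                                          ≡⟨ *-identityʳ _ ⟩
    length cycles                                              ∎
    where open ≡-Reasoning

decomposition-cong : ∀ {σ σ′ : Fin d → Fin d} {m} → (∀ y → σ y ≡ σ′ y) → CycleDecomposition d σ m → CycleDecomposition d σ′ m
decomposition-cong e D = record { cycles = cycles ; isCycles = Cycles-cong e isCycles ; total = total ; count = count }
  where open CycleDecomposition D

-- The length d - ℓ(ρ) is what gives all closed loops the same number of steps, whatever the cycle
-- types of the ends.
strict-word : ∀ (ρ : Fin d → Fin d) → Injective ρ → ∃ λ u → u ∈ SW (desc d ≤-refl) × (∀ y → end u y ≡ ρ y) × numCycles ρ + length u ≡ d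
strict-word {d} ρ inj with SW-cover d ≤-refl ρ inj (λ y q → ⊥-elim (<⇒≱ (toℕ<n y) q))
... | u , u∈ , e = u , u∈ , e , trans (cong (_+ length u) (numCycles≡ D)) (CycleDecomposition.count D)
  where D = decomposition-cong e (proj₁ (SW-cycles d ≤-refl u u∈))

-- Transitivity and connectedness

any-true : ∀ (p : A → Bool) xs → any p xs ≡ true → ∃ λ x → x ∈ xs × p x ≡ true
any-true p (x ∷ xs) e with ∨-true (p x) e
... | inj₁ q = x , here refl , q
... | inj₂ q = let y , m , r = any-true p xs q in y , there m , r

true-any : ∀ (p : A → Bool) {xs x} → x ∈ xs → p x ≡ true → any p xs ≡ true
true-any p {x ∷ xs} (here refl) e rewrite e = refl
true-any p {y ∷ xs} (there m)   e rewrite true-any p m e = ∨-zeroʳ (p y)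

closure-sound : ∀ (gs : List (Fin d → Fin d)) (f : Fin d → Fin d) → All (λ g → ∀ y → f (g y) ≡ f y) gs →
  ∀ n {x y} → iter n (closeStep gs) (eqF x) y ≡ true → f x ≡ f y
closure-sound gs f a zero    e = cong f (true-≟ e)
closure-sound {d} gs f a (suc n) {x} {y} e with ∨-true (iter n (closeStep gs) (eqF x) y) e
... | inj₁ q = closure-sound gs f a n q
... | inj₂ q with any-true _ gs q
...   | g , g∈ , r with any-true _ (allFin d) r
...     | z , _ , t = trans (closure-sound gs f a n (proj₁ (∧-true t)))
  (trans (sym (All.lookup a g∈ z)) (cong f (true-≟ (proj₂ (∧-true {iter n (closeStep gs) (eqF x) z} t)))))

transitive-sound : ∀ (gs : List (Fin d → Fin d)) → transitiveB gs ≡ true → ∀ (f : Fin d → Fin d) →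
  All (λ g → ∀ y → f (g y) ≡ f y) gs → ∀ x y → f x ≡ f y
transitive-sound {d} gs e f a x y = closure-sound gs f a d
  (All.lookup (all-true _ (allFin d) (All.lookup (all-true _ (allFin d) e) (∈-allFin x))) (∈-allFin y))

-- The closure either is stable or has grown at each step, and the latter is impossible for d steps.
module Closure {d} (gs : List (Fin d → Fin d)) (x : Fin d) where

  S : ℕ → Fin d → Bool
  S n = iter n (closeStep gs) (eqF x)

  Stable : ℕ → Set
  Stable n = ∀ {g} → g ∈ gs → ∀ {y} → S n y ≡ true → S n (g y) ≡ true

  S-grow : ∀ n {y} → S n y ≡ true → S (suc n) y ≡ true
  S-grow n e rewrite e = refl

  S-start : ∀ n → S n x ≡ true
  S-start zero    = ≟-true {i = x} refl
  S-start (suc n) = S-grow n (S-start n)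

  S-step : ∀ n {g} → g ∈ gs → ∀ {y} → S n y ≡ true → S (suc n) (g y) ≡ true
  S-step n {g} g∈ {y} e = trans (cong (S n (g y) ∨_) (true-any _ g∈ (true-any _ (∈-allFin y) (cong₂ _∧_ e (≟-true {i = g y} refl))))) (∨-zeroʳ (S n (g y)))

  reached : ℕ → ℕ
  reached n = ∑ (allFin d) (indicator ∘ S n)

  stable-suc : ∀ n → (∀ y → S (suc n) y ≡ S n y) → Stable n
  stable-suc n e g∈ {y} q = trans (sym (e _)) (S-step n g∈ q)

  stable-next : ∀ n → Stable n → Stable (suc n)
  stable-next n st {g} g∈ {y} q = S-grow n (st g∈ (back q))
    where
    back : ∀ {y} → S (suc n) y ≡ true → S n y ≡ true
    back {y} q with ∨-true (S n y) q
    ... | inj₁ r = r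
    ... | inj₂ r with any-true _ gs r
    ...   | g , g∈ , t with any-true _ (allFin d) t
    ...     | z , _ , v = subst (λ w → S n w ≡ true) (true-≟ (proj₂ (∧-true {S n z} v))) (st g∈ (proj₁ (∧-true v)))

  grow-or-stable : ∀ n → n < reached n ⊎ Stable n
  grow-or-stable zero    = inj₁ (≤-trans (≤-reflexive (cong indicator (sym (S-start 0)))) (∑-∈ (∈-allFin x) (indicator ∘ S 0)))
  grow-or-stable (suc n) with grow-or-stable n
  ... | inj₂ st = inj₂ (stable-next n st)
  ... | inj₁ lt with any? (λ y → ¬? (S (suc n) y Bool.≟ S n y))
  ...   | no ¬new = inj₂ (stable-next n (stable-suc n (λ y → decidable-stable (S (suc n) y Bool.≟ S n y) (λ ne → ¬new (y , ne)))))
  ...   | yes (y , ne) = inj₁ (≤-trans (s≤s lt) (∑-strict (∈-allFin y) mono (strict (S n y) refl)))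
    where
    mono : ∀ z → indicator (S n z) ≤ indicator (S (suc n) z)
    mono z with S n z
    ... | true  = ≤-refl
    ... | false = z≤n
    strict : ∀ b → S n y ≡ b → indicator (S n y) < indicator (S (suc n) y)
    strict true  e = ⊥-elim (ne (trans (S-grow n e) (sym e)))
    strict false e with S (suc n) y in eq
    ... | true  rewrite e = ≤-refl
    ... | false = ⊥-elim (ne (sym e))
    ∑-strict : ∀ {xs : List (Fin d)} {y} {f g : Fin d → ℕ} → y ∈ xs → (∀ z → f z ≤ g z) → f y < g y → ∑ xs f < ∑ xs g
    ∑-strict {xs = z ∷ xs} (here refl) le lt = +-mono-<-≤ lt (∑-mono xs le)
    ∑-strict {xs = z ∷ xs} (there m)   le lt = +-mono-≤-< (le z) (∑-strict m le lt)

  reached≤ : ∀ n → reached n ≤ d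
  reached≤ n = ≤-trans (∑-mono (allFin d) {g = λ _ → 1} (λ y → bound (S n y)))
    (≤-reflexive (trans (∑-const (allFin d) 1) (trans (*-identityʳ _) (length-tabulate {n = d} id))))
    where
    bound : ∀ b → indicator b ≤ 1
    bound true  = ≤-refl
    bound false = z≤n

  stable : Stable d
  stable with grow-or-stable d
  ... | inj₁ lt = ⊥-elim (<⇒≱ lt (reached≤ d))
  ... | inj₂ st = st

-- The closure reached after d rounds is stable under the generators, so its characteristic function
-- is constant along the steps of w, and `comp-least` spreads it from x to every point.
connected⇒transitive : ∀ (w : Word d) gs → All (λ τ → swap τ ∈ gs) w → (∀ x y → comp w x ≡ comp w y) → transitiveB gs ≡ true
connected⇒transitive {d} w gs a c = true-all _ (All.tabulate {xs = allFin d} (λ {x} _ → true-all _ (All.tabulate {xs = allFin d} (λ {y} _ → reach x y))))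
  where
  reach : ∀ x y → iter d (closeStep gs) (eqF x) y ≡ true
  reach x y = trans (sym (comp-least (S d) w (All.map joined a) (c x y))) (S-start d)
    where
    open Closure gs x
    bool-antisym : ∀ {a b} → (a ≡ true → b ≡ true) → (b ≡ true → a ≡ true) → a ≡ b
    bool-antisym {true}  {b}     f g = sym (f refl)
    bool-antisym {false} {true}  f g = g refl
    bool-antisym {false} {false} f g = refl
    joined : ∀ {τ : Transp d} → swap τ ∈ gs → S d (proj₁ τ) ≡ S d (proj₂ τ)
    joined {s , t} m = bool-antisym (λ e → subst (λ z → S d z ≡ true) (swap-left s t) (stable m e))
                                    (λ e → subst (λ z → S d z ≡ true) (swap-right s t) (stable m e))

-- Comparison with loops

end-injective : ∀ (w : Word d) → Injective (end w)
end-injective []      e = e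
end-injective (τ ∷ w) e = swap-injective τ (end-injective w e)

end-reverse : ∀ (v : Word d) y → end v (end (reverse v) y) ≡ y
end-reverse []      y = refl
end-reverse (τ ∷ v) y = begin
  end v (swap τ (end (reverse (τ ∷ v)) y))        ≡⟨ cong (λ z → end v (swap τ (end z y))) (unfold-reverse τ v) ⟩
  end v (swap τ (end (reverse v ∷ʳ τ) y))         ≡⟨ cong (end v ∘ swap τ) (end-++ (reverse v) [ τ ] y) ⟩
  end v (swap τ (swap τ (end (reverse v) y)))     ≡⟨ cong (end v) (swap-involutive τ _) ⟩
  end v (end (reverse v) y)                       ≡⟨ end-reverse v y ⟩
  y                                               ∎
  where open ≡-Reasoning

walkEnd-end : ∀ (ρ : Fin d → Fin d) w y → walkEnd ρ w y ≡ ρ (end (reverse w) y)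
walkEnd-end ρ []      y = refl
walkEnd-end ρ (τ ∷ w) y = trans (walkEnd-end (ρ ∘ swap τ) w y) (cong ρ (sym (trans
  (cong (λ z → end z y) (unfold-reverse τ w)) (end-++ (reverse w) [ τ ] y))))

[]∈SW : ∀ (L : List (Fin d)) → [] ∈ SW L
[]∈SW []      = here refl
[]∈SW (k ∷ L) = ∈-++⁺ˡ ([]∈SW L)

numCycles-id : ∀ {σ : Fin d → Fin d} → (∀ y → σ y ≡ y) → numCycles σ ≡ d
numCycles-id {d} e = trans (numCycles≡ D) (trans (sym (+-identityʳ _)) (CycleDecomposition.count D))
  where D = decomposition-cong (sym ∘ e) (proj₁ (SW-cycles d ≤-refl [] ([]∈SW (desc d ≤-refl))))

true-≡ᵇ : ∀ {m n} → m ≡ n → (m ≡ᵇ n) ≡ true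
true-≡ᵇ {m} {n} p with m ≡ᵇ n | ≡⇒≡ᵇ m n p
... | true | _ = refl

≡ᵇ-true : ∀ {m n} → (m ≡ᵇ n) ≡ true → m ≡ n
≡ᵇ-true {m} {n} e = ≡ᵇ⇒≡ m n (subst Bool.T (sym e) tt)

labelsᵈ : ∀ d → List (Fin d)
labelsᵈ d = desc d ≤-refl

∈-labelsᵈ : ∀ (y : Fin d) → y ∈ labelsᵈ d
∈-labelsᵈ {d} y = desc-∈ d ≤-refl (toℕ<n y)

loops : ∀ d → List (Cycle d)
loops d = singletons (labelsᵈ d)

loops-id : ∀ {σ : Fin d → Fin d} → Cycles σ (loops d) → ∀ y → σ y ≡ y
loops-id c y = All.lookup c (∈-map⁺ (_, []) (∈-labelsᵈ y))

id-loops : ∀ {σ : Fin d → Fin d} → (∀ y → σ y ≡ y) → Cycles σ (loops d)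
id-loops e = map⁺ (All.tabulate (λ {y} _ → e y))

loopCount : ℕ → ℕ → ℕ
loopCount d r = P (labelsᵈ d) r (F (loops d))

counted : ∀ g d → (Fin d → Fin d) → ℕ → List (Transp d) → Bool
counted g d ρ r w = monotone w ∧ isTransitiveWalk ρ w ∧ ((r + 2) ≡ᵇ (2 * g + numCycles ρ + numCycles (walkEnd ρ w)))

walkCount : ∀ g d → (Fin d → Fin d) → ℕ
walkCount g d ρ = ∑ (upTo (2 * g + 2 * d)) (λ r → ∑ (walks d r) (indicator ∘ counted g d ρ r))

sumH≡ : ∀ g d → sumH g d ≡ ∑ (permVecs d) (walkCount g d ∘ lookup)
sumH≡ g d = trans (sum≡∑ _ (perms d)) (trans (∑-perms d _) (∑-cong (permVecs d) (λ v →
  trans (sum≡∑ _ (upTo (2 * g + 2 * d))) (∑-cong (upTo (2 * g + 2 * d)) (λ r → countB≡∑ _ (walks d r))))))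

walks-P′ : ∀ d r f → ∑ (walks d r) (λ w → ⟦ monotoneBelow? d w ⟧ * f (reverse w)) ≡ P (labelsᵈ d) r f
walks-P′ d r f = trans (walks-P d ≤-refl r (f ∘ reverse)) (P-cong (labelsᵈ d) r (λ w → cong f (reverse-involutive w)))

-- A loop at the identity is itself one of the counted walks: for ρ = σ = id both numbers of cycles
-- are d = k + 1, and the number of steps is 2g - 2 + 2d.
loopCount≤sumH : ∀ g k → loopCount (suc k) (2 * g + 2 * k) ≤ sumH g (suc k)
loopCount≤sumH g k = begin
  loopCount n R                                                        ≡⟨ walks-P′ n R (F (loops n)) ⟨
  ∑ (walks n R) (λ w → ⟦ monotoneBelow? n w ⟧ * F (loops n) (reverse w)) ≤⟨ ∑-mono (walks n R) pointwise ⟩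
  ∑ (walks n R) (indicator ∘ counted g n (lookup v) R)                  ≤⟨ ∑-∈ (∈-upTo⁺ R<) (λ r → ∑ (walks n r) (indicator ∘ counted g n (lookup v) r)) ⟩
  walkCount g n (lookup v)
    ≤⟨ ∑-∈ v∈ (walkCount g n ∘ lookup) ⟩
  ∑ (permVecs n) (walkCount g n ∘ lookup) ≡⟨ sumH≡ g n ⟨
  sumH g n ∎
  where
  open ≤-Reasoning
  n = suc k
  R = 2 * g + 2 * k
  v = tabulate {n = suc k} id
  v-id : ∀ y → lookup v y ≡ y
  v-id = lookup∘tabulate id
  v∈ : v ∈ permVecs n
  v∈ = injective-permVecs (λ {y} {z} e → trans (sym (v-id y)) (trans e (v-id z)))
  R< : R < 2 * g + 2 * n
  R< = +-monoʳ-< (2 * g) (*-monoʳ-< 2 ≤-refl)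
  R+2 : ∀ g k → 2 * g + 2 * k + 2 ≡ 2 * g + suc k + suc k
  R+2 = solve-∀
  pointwise : ∀ w → ⟦ monotoneBelow? n w ⟧ * F (loops n) (reverse w) ≤ indicator (counted g n (lookup v) R w)
  pointwise w = ≤-trans (≤-reflexive (sym (⟦⟧-× (monotoneBelow? n w) (F? (loops n) (reverse w)))))
    (indicator-mono′ (monotoneBelow? n w ×-dec F? (loops n) (reverse w)) (counted g n (lookup v) R w)
      (λ ((m , _) , (c , cy)) → cong₂ _∧_ m (cong₂ _∧_
        (connected⇒transitive (reverse w) (lookup v ∷ walkEnd (lookup v) w ∷ map swap w)
          (All-resp-↭ (↭-sym (↭-reverse w)) (All.tabulate (λ τ∈ → there (there (∈-map⁺ swap τ∈)))))
          (λ y z → connected⁻ (reverse w) c (label y) (label z)))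
        (true-≡ᵇ (trans (R+2 g k) (sym (cong₂ (λ a b → 2 * g + a + b) (numCycles-id v-id)
          (numCycles-id (λ y → trans (walkEnd-end (lookup v) w y) (trans (v-id _) (loops-id cy y)))))))))))
    where
    label : ∀ y → y ∈ labels (loops n)
    label y = subst (y ∈_) (sym (labels-singletons (labelsᵈ n))) (∈-labelsᵈ y)

-- The key recovers x from the chosen u, so different x choose different entries of us and no term
-- is charged twice.
∑-inject : ∀ {xs : List A} {us : List B} (key : B → A) f Θ → Unique xs →
  All (λ x → ∃ λ u → u ∈ us × key u ≡ x × f x ≤ Θ u) xs → ∑ xs f ≤ ∑ us Θ
∑-inject key f Θ []      []                            = z≤n
∑-inject {xs = x ∷ xs} key f Θ (a ∷ un) ((u , u∈ , e , le) ∷ h) with ∈⇒↭ u∈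
... | us′ , p = ≤-trans (+-mono-≤ le (∑-inject key f Θ un (All.zipWith move (a , h)))) (≤-reflexive (sym (∑-↭ p Θ)))
  where
  move : ∀ {x′} → x ≢ x′ × (∃ λ u → u ∈ _ × key u ≡ x′ × f x′ ≤ Θ u) → ∃ λ u → u ∈ us′ × key u ≡ x′ × f x′ ≤ Θ u
  move (ne , u′ , u′∈ , e′ , le′) with ∈-resp-↭ p u′∈
  ... | here refl = ⊥-elim (ne (trans (sym e) e′))
  ... | there m   = u′ , m , e′ , le′

∑-single-≤ : ∀ {xs : List ℕ} → Unique xs → ∀ z f → ∑ xs (λ x → ⟦ x ℕ.≟ z ⟧ * f x) ≤ f z
∑-single-≤ {xs} u z f = ≤-trans (≤-reflexive (∑-filter (ℕ._≟ z) xs f))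
  (≤-trans (∑-⊆ {ys = [ z ]} (Unique.filter⁺ (ℕ._≟ z) u) (λ m → here (proj₂ (∈-filter⁻ (ℕ._≟ z) {xs = xs} m))) f) (≤-reflexive (+-identityʳ (f z))))

P⁻-+ : ∀ (L : List (Fin d)) m z f → P⁻ L (m + z) m f ≡ P L z f
P⁻-+ L zero    z f = refl
P⁻-+ L (suc m) z f = P⁻-+ L m z f

-- At most one r solves m + r = R. This removes the sum over all lengths of walks.
∑-P⁻ : ∀ (L : List (Fin d)) N R m f → ∑ (upTo N) (λ r → ⟦ m + r ℕ.≟ R ⟧ * P L r f) ≤ P⁻ L R m f
∑-P⁻ L N R m f with m ≤? R
... | no m≰R = ≤-trans (≤-reflexive (trans (∑-cong (upTo N) (λ r → cong (_* P L r f) (⟦⟧-no (m + r ℕ.≟ R) (λ e → m≰R (≤-trans (m≤m+n m r) (≤-reflexive e)))))) (∑-zero (upTo N)))) z≤n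
... | yes m≤R = begin
  ∑ (upTo N) (λ r → ⟦ m + r ℕ.≟ R ⟧ * P L r f)
    ≡⟨ ∑-cong (upTo N) (λ r → cong (_* P L r f) (⟦⟧-cong (m + r ℕ.≟ R) (r ℕ.≟ R ∸ m) (λ e → trans (sym (m+n∸m≡n m r)) (cong (_∸ m) e)) (λ e → trans (cong (m +_) e) (m+[n∸m]≡n m≤R)))) ⟩
  ∑ (upTo N) (λ r → ⟦ r ℕ.≟ R ∸ m ⟧ * P L r f) ≤⟨ ∑-single-≤ (Unique.upTo⁺ N) (R ∸ m) (λ r → P L r f) ⟩
  P L (R ∸ m) f ≡⟨ P⁻-+ L m (R ∸ m) f ⟨
  P⁻ L (m + (R ∸ m)) m f ≡⟨ cong (λ z → P⁻ L z m f) (m+[n∸m]≡n m≤R) ⟩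
  P⁻ L R m f ∎
  where open ≤-Reasoning

-- A walk from ρ to σ, with ρ written as a strict word u and σ as a strict word v, closes up to the loop u w v⁻¹.
module Close (g k : ℕ) (ρ : Fin (suc k) → Fin (suc k)) (inj : Injective ρ) (u : Word (suc k))
             (end-u : ∀ y → end u y ≡ ρ y) (count-u : numCycles ρ + length u ≡ suc k) where

  private
    n = suc k
    L = labelsᵈ n
    R = 2 * g + 2 * k
    N = 2 * g + 2 * n

  closed : Word n → Word n → ℕ
  closed v w = F (loops n) (u ++ reverse v ++ w)

  term : ℕ → Word n → Word n → ℕ
  term r w v = ⟦ (length u + length v) + r ℕ.≟ R ⟧ * closed v w

  -- The witness v is the strict word of the endpoint σ. The cycle counts in r cancel against the
  -- lengths of u and v. As σ is ρ after the steps of w, both ρ and σ preserve the components of the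
  -- loop, so transitivity of the walk makes the loop connected.
  closes : ∀ r w → counted g n ρ r w ≡ true → 1 ≤ ∑ (SW L) (term r (reverse w))
  closes r w e = ≤-trans (≤-reflexive (sym (cong₂ _*_ (⟦⟧-yes (_ ℕ.≟ R) len) (⟦⟧-yes (F? (loops n) word) (connected , id-loops loop)))))
      (∑-∈ v∈ (term r (reverse w)))
    where
    σ = walkEnd ρ w
    w′ = reverse w
    e₁ = ∧-true {monotone w} e
    e₂ = ∧-true {isTransitiveWalk ρ w} (proj₂ e₁)
    σ-ρ : ∀ y → σ y ≡ ρ (end w′ y)
    σ-ρ = walkEnd-end ρ w
    sw = strict-word σ (λ {y} {z} q → end-injective w′ (inj (trans (sym (σ-ρ y)) (trans q (σ-ρ z)))))
    v = proj₁ sw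
    v∈ = proj₁ (proj₂ sw)
    end-v = proj₁ (proj₂ (proj₂ sw))
    count-v = proj₂ (proj₂ (proj₂ sw))
    word = u ++ reverse v ++ w′
    len : (length u + length v) + r ≡ R
    len = +-cancelʳ-≡ 2 _ _ (begin
      (length u + length v) + r + 2                                   ≡⟨ +-assoc (length u + length v) r 2 ⟩
      (length u + length v) + (r + 2)                                 ≡⟨ cong ((length u + length v) +_) (≡ᵇ-true (proj₂ e₂)) ⟩
      (length u + length v) + (2 * g + numCycles ρ + numCycles σ)     ≡⟨ lem₁ (length u) (length v) g (numCycles ρ) (numCycles σ) ⟩
      2 * g + (numCycles ρ + length u) + (numCycles σ + length v)     ≡⟨ cong₂ (λ a b → 2 * g + a + b) count-u count-v ⟩
      2 * g + suc k + suc k                                           ≡⟨ lem₂ g k ⟩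
      R + 2                                                           ∎)
      where
      open ≡-Reasoning
      lem₁ : ∀ a b g m n → (a + b) + (2 * g + m + n) ≡ 2 * g + (m + a) + (n + b)
      lem₁ = solve-∀
      lem₂ : ∀ g k → 2 * g + suc k + suc k ≡ 2 * g + 2 * k + 2
      lem₂ = solve-∀
    loop : ∀ y → end word y ≡ y
    loop y = inj (begin
      ρ (end word y)                                  ≡⟨ cong ρ (trans (end-++ u _ y) (end-++ (reverse v) w′ _)) ⟩
      ρ (end w′ (end (reverse v) (end u y)))          ≡⟨ σ-ρ _ ⟨
      σ (end (reverse v) (end u y))                   ≡⟨ end-v _ ⟨
      end v (end (reverse v) (end u y))               ≡⟨ end-reverse v _ ⟩
      end u y                                         ≡⟨ end-u y ⟩
      ρ y                                             ∎)
      where open ≡-Reasoning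
    joined-u = ++⁻ˡ u (comp-joined word)
    joined-w = ++⁻ʳ (reverse v) (++⁻ʳ u (comp-joined word))
    ρ-comp : ∀ y → comp word (ρ y) ≡ comp word y
    ρ-comp y = trans (cong (comp word) (sym (end-u y))) (end-joined (comp word) u joined-u y)
    σ-comp : ∀ y → comp word (σ y) ≡ comp word y
    σ-comp y = trans (cong (comp word) (σ-ρ y)) (trans (ρ-comp _) (end-joined (comp word) w′ joined-w y))
    steps-comp : All (λ g → ∀ y → comp word (g y) ≡ comp word y) (map swap w)
    steps-comp = map⁺ (All-resp-↭ (↭-reverse w) (All.map (swap-joined (comp word)) joined-w))
    connected : Connected (labels (loops n)) word
    connected = All.tabulate (λ {y} _ → All.tabulate (λ {z} _ →
      transitive-sound (ρ ∷ σ ∷ map swap w) (proj₁ e₂) (comp word) (ρ-comp ∷ σ-comp ∷ steps-comp) y z))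

  pointwise : ∀ r w → indicator (counted g n ρ r w) ≤ ⟦ monotoneBelow? n w ⟧ * ∑ (SW L) (term r (reverse w))
  pointwise r w = go (counted g n ρ r w) refl
    where
    go : ∀ b → counted g n ρ r w ≡ b → indicator b ≤ ⟦ monotoneBelow? n w ⟧ * ∑ (SW L) (term r (reverse w))
    go false _ = z≤n
    go true  e = ≤-trans (closes r w e) (≤-reflexive (sym (trans (cong (_* ∑ (SW L) (term r (reverse w)))
      (⟦⟧-yes (monotoneBelow? n w) (proj₁ (∧-true {monotone w} e) , All.tabulate (λ {τ} _ → toℕ<n (proj₂ τ))))) (*-identityˡ _))))

  bound : walkCount g n ρ ≤ ∑ (SW L) (λ v → P⁻ L R (length u + length v) (λ w → F (loops n) (u ++ reverse v ++ w)))
  bound = begin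
    walkCount g n ρ
      ≤⟨ ∑-mono (upTo N) (λ r → ∑-mono (walks n r) (pointwise r)) ⟩
    ∑ (upTo N) (λ r → ∑ (walks n r) (λ w → ⟦ monotoneBelow? n w ⟧ * ∑ (SW L) (term r (reverse w))))
      ≡⟨ ∑-cong (upTo N) (λ r → trans (walks-P′ n r (λ w → ∑ (SW L) (term r w))) (trans (P-∑ L r (SW L) (λ v w → term r w v))
           (∑-cong (SW L) (λ v → P-* L r ⟦ (length u + length v) + r ℕ.≟ R ⟧ (closed v))))) ⟩
    ∑ (upTo N) (λ r → ∑ (SW L) (λ v → ⟦ (length u + length v) + r ℕ.≟ R ⟧ * P L r (closed v)))
      ≡⟨ ∑-swap (upTo N) (SW L) _ ⟩
    ∑ (SW L) (λ v → ∑ (upTo N) (λ r → ⟦ (length u + length v) + r ℕ.≟ R ⟧ * P L r (closed v)))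
      ≤⟨ ∑-mono (SW L) (λ v → ∑-P⁻ L N R (length u + length v) (closed v)) ⟩
    ∑ (SW L) (λ v → P⁻ L R (length u + length v) (closed v)) ∎
    where open ≤-Reasoning

-- Each starting permutation is charged to its strict word u; then both ends are absorbed at once.
sumH≤loopCount : ∀ g k → sumH g (suc k) ≤ 4 ^ suc k * loopCount (suc k) (2 * g + 2 * k)
sumH≤loopCount g k = begin
  sumH g n ≡⟨ sumH≡ g n ⟩
  ∑ (permVecs n) (walkCount g n ∘ lookup) ≤⟨ ∑-inject (tabulate ∘ end) (walkCount g n ∘ lookup) Θ (permVecs-unique n) (All.tabulate (λ {v} v∈ →
      let u , u∈ , e , c = strict-word (lookup v) (permVecs-injective v∈)
      in u , u∈ , trans (tabulate-cong e) (tabulate∘lookup v) , Close.bound g k (lookup v) (permVecs-injective v∈) u e c)) ⟩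
  ∑ (SW L) Θ ≤⟨ absorb₂ L (desc-unique n ≤-refl) R (F-invariant (loops n)) ⟩
  4 ^ length L * P L R (F (loops n)) ≡⟨ cong (λ z → 4 ^ z * loopCount n R) (desc-length n ≤-refl) ⟩
  4 ^ n * loopCount n R ∎
  where
  open ≤-Reasoning
  n = suc k
  R = 2 * g + 2 * k
  L = labelsᵈ n
  Θ : Word n → ℕ
  Θ u = ∑ (SW L) (λ v → P⁻ L R (length u + length v) (λ w → F (loops n) (u ++ reverse v ++ w)))

-- Coefficients against genus zero counts

sizes-singletons : ∀ (xs : List (Fin d)) → sizes (singletons xs) ≡ replicate (length xs) 0
sizes-singletons []       = refl
sizes-singletons (x ∷ xs) = cong (0 ∷_) (sizes-singletons xs)

loopCount≡Hf : ∀ k n r → r < n → loopCount (suc k) r ≡ Hf n r 0 (replicate k 0)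
loopCount≡Hf k n r r<n = begin
  P (labelsᵈ (suc k)) r (F (loops (suc k))) ≡⟨ cong (λ z → P z r (F (loops (suc k)))) (labels-singletons (labelsᵈ (suc k))) ⟨
  W (loops (suc k)) r ≡⟨ W≡Hf n r r<n _ [] (singletons (desc k _)) (subst Unique (sym (labels-singletons (labelsᵈ (suc k)))) (desc-unique (suc k) ≤-refl)) ⟩
  Hf n r 0 (sizes (singletons (desc k _))) ≡⟨ cong (Hf n r 0) (trans (sizes-singletons (desc k (<⇒≤ ≤-refl))) (cong (λ z → replicate z 0) (desc-length k _))) ⟩
  Hf n r 0 (replicate k 0) ∎
  where open ≡-Reasoning

∑-replicate : ∀ n (z : A) f → ∑ (replicate n z) f ≡ n * f z
∑-replicate zero    z f = refl
∑-replicate (suc n) z f = cong (f z +_) (∑-replicate n z f)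

wt-replicate : ∀ k → wt 0 (replicate k 0) ≡ 2 * k
wt-replicate k = trans (∑-replicate k 0 (2 +_)) (*-comm k 2)

double : ∀ g → 2 * g ≡ g + g
double g = cong (g +_) (+-identityʳ g)

-- The degree is j + 2 because the padding by repeated steps needs two fixed points.
ξ≤coeffF : ∀ g j → ξ 0 (suc j) ≤ coeffF g (suc (suc j))
ξ≤coeffF g j = begin
  X 0 ones                               ≤⟨ X≤Hf (suc (2 * suc j)) (2 * suc j) 0 ones (wt-replicate (suc j)) ≤-refl ⟩
  Hf (suc (2 * suc j)) (2 * suc j) 0 ones ≤⟨ Hf-genus g (suc (2 * suc j)) (2 * suc j) (replicate j 0) ⟩
  Hf (g + g + suc (2 * suc j)) (g + g + 2 * suc j) 0 ones ≡⟨ loopCount≡Hf (suc j) (g + g + suc (2 * suc j)) (g + g + 2 * suc j) (+-monoʳ-< (g + g) ≤-refl) ⟨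
  loopCount (suc (suc j)) (g + g + 2 * suc j) ≡⟨ cong (λ z → loopCount (suc (suc j)) (z + 2 * suc j)) (double g) ⟨
  loopCount (suc (suc j)) (2 * g + 2 * suc j) ≤⟨ loopCount≤sumH g (suc j) ⟩
  coeffF g (suc (suc j)) ∎
  where
  open ≤-Reasoning
  ones = replicate (suc j) 0

coeffF≤ξ : ∀ g k → coeffF g (suc k) ≤ 4 ^ suc k * ((suc k * (suc k * (2 * suc k))) ^ g * (2 * k + g) ^ g * ξ 0 k)
coeffF≤ξ g k = ≤-trans (sumH≤loopCount g k) (*-monoʳ-≤ (4 ^ suc k) (begin
  loopCount (suc k) (2 * g + 2 * k) ≡⟨ loopCount≡Hf k (suc (2 * g + 2 * k)) (2 * g + 2 * k) ≤-refl ⟩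
  Hf (suc (2 * g + 2 * k)) (2 * g + 2 * k) 0 ones ≤⟨ Hf≤φX (suc k) (suc (2 * g + 2 * k)) (2 * g + 2 * k) 0 ones
     (≤-reflexive (cong suc (trans (∑-replicate k 0 suc) (*-identityʳ k)))) ⟩
  φ Pd (2 * g + 2 * k) (wt 0 ones) * ξ 0 k ≡⟨ cong₂ (λ a b → φ Pd (a + 2 * k) b * ξ 0 k) (double g) (wt-replicate k) ⟩
  φ Pd (g + g + 2 * k) (2 * k) * ξ 0 k ≤⟨ *-monoˡ-≤ (ξ 0 k) (φ-bound Pd g (2 * k)) ⟩
  Pd ^ g * (2 * k + g) ^ g * ξ 0 k ∎))
  where
  open ≤-Reasoning
  ones = replicate k 0
  Pd = suc k * (suc k * (2 * suc k))

-- The radius of convergence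

bernoulli : ∀ Q n → Q ^ n * (Q + n) ≤ Q * suc Q ^ n
bernoulli Q zero    = ≤-reflexive (lem Q)
  where
  lem : ∀ Q → 1 * (Q + 0) ≡ Q * 1
  lem = solve-∀
bernoulli Q (suc n) = begin
  Q * Q ^ n * (Q + suc n)                   ≡⟨ lem₁ Q (Q ^ n) n ⟩
  Q * (Q ^ n * (Q + n)) + Q ^ n * Q         ≤⟨ +-monoʳ-≤ (Q * (Q ^ n * (Q + n))) (*-monoʳ-≤ (Q ^ n) (m≤m+n Q n)) ⟩
  Q * (Q ^ n * (Q + n)) + Q ^ n * (Q + n)   ≡⟨ +-comm (Q * (Q ^ n * (Q + n))) _ ⟩
  suc Q * (Q ^ n * (Q + n))                 ≤⟨ *-monoʳ-≤ (suc Q) (bernoulli Q n) ⟩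
  suc Q * (Q * suc Q ^ n)                   ≡⟨ *-left-comm (suc Q) Q (suc Q ^ n) ⟩
  Q * suc Q ^ suc n                         ∎
  where
  open ≤-Reasoning
  lem₁ : ∀ Q x n → Q * x * (Q + suc n) ≡ Q * (x * (Q + n)) + x * Q
  lem₁ = solve-∀

rising : ℕ → ℕ → ℕ
rising zero    k = 1
rising (suc m) k = suc (k + m) * rising m k

rising-front : ∀ m k → rising (suc m) k ≡ suc k * rising m (suc k)
rising-front zero    k = cong (λ z → suc z * 1) (+-identityʳ k)
rising-front (suc m) k = begin
  suc (k + suc m) * rising (suc m) k                ≡⟨ cong₂ (λ a b → suc a * b) (+-suc k m) (rising-front m k) ⟩
  suc (suc k + m) * (suc k * rising m (suc k))      ≡⟨ *-left-comm (suc (suc k + m)) (suc k) (rising m (suc k)) ⟩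
  suc k * (suc (suc k + m) * rising m (suc k))      ∎
  where
  open ≡-Reasoning

rising-zero : ∀ m → rising m 0 ≡ m !
rising-zero zero    = refl
rising-zero (suc m) = cong (suc m *_) (rising-zero m)

^≤rising : ∀ m k → suc k ^ m ≤ rising m k
^≤rising zero    k = ≤-refl
^≤rising (suc m) k = *-mono-≤ (s≤s (m≤m+n k m)) (^≤rising m k)

-- Since `rising m k` is m! times the binomial coefficient (k + m choose m), the left side is m!
-- times one term of the expansion of (Q + 1)^(k+m). The induction is Pascal's rule.
rising-exp : ∀ Q m k → rising m k * Q ^ k ≤ m ! * suc Q ^ (k + m)
rising-exp Q zero    k       = *-monoʳ-≤ 1 (≤-trans (^-monoˡ-≤ k (n≤1+n Q)) (≤-reflexive (cong (suc Q ^_) (sym (+-identityʳ k)))))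
rising-exp Q (suc m) zero    = *-mono-≤ (≤-reflexive (rising-zero (suc m))) (m^n>0 (suc Q) (suc m))
rising-exp Q (suc m) (suc k) = begin
  suc (suc k + m) * rising m (suc k) * (Q * Q ^ k)
    ≡⟨ lem₁ k m (rising m (suc k)) Q (Q ^ k) ⟩
  Q * (suc k * rising m (suc k) * Q ^ k) + suc m * (rising m (suc k) * (Q * Q ^ k))
    ≡⟨ cong (λ z → Q * (z * Q ^ k) + suc m * (rising m (suc k) * (Q * Q ^ k))) (rising-front m k) ⟨
  Q * (rising (suc m) k * Q ^ k) + suc m * (rising m (suc k) * Q ^ suc k)
    ≤⟨ +-mono-≤ (*-monoʳ-≤ Q (rising-exp Q (suc m) k)) (*-monoʳ-≤ (suc m) (rising-exp Q m (suc k))) ⟩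
  Q * (suc m ! * suc Q ^ (k + suc m)) + suc m * (m ! * suc Q ^ (suc k + m))
    ≡⟨ cong (λ z → Q * (suc m ! * suc Q ^ (k + suc m)) + suc m * (m ! * suc Q ^ z)) (sym (+-suc k m)) ⟩
  Q * (suc m * m ! * suc Q ^ (k + suc m)) + suc m * (m ! * suc Q ^ (k + suc m))
    ≡⟨ lem₂ Q (suc m) (m !) (suc Q ^ (k + suc m)) ⟩
  suc m ! * suc Q ^ (suc k + suc m) ∎
  where
  open ≤-Reasoning
  lem₁ : ∀ k m x Q y → suc (suc k + m) * x * (Q * y) ≡ Q * (suc k * x * y) + suc m * (x * (Q * y))
  lem₁ = solve-∀
  lem₂ : ∀ Q s f x → Q * (s * f * x) + s * (f * x) ≡ s * f * (suc Q * x)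
  lem₂ = solve-∀

four-powers : ∀ k → 4 ^ suc k * ξ 0 k ≤ 6 * 54 ^ k * k !
four-powers k = begin
  4 * 4 ^ k * ξ 0 k                 ≡⟨ cong (λ z → 4 * z * ξ 0 k) (^-distribʳ-* k 2 2) ⟩
  4 * (2 ^ k * 2 ^ k) * ξ 0 k       ≡⟨ lem₁ (2 ^ k) (ξ 0 k) ⟩
  2 * 2 ^ k * (ξ 0 k * 2 ^ k * 2)   ≤⟨ *-monoʳ-≤ (2 * 2 ^ k) (ξ-upper k) ⟩
  2 * 2 ^ k * (k ! * (27 ^ k * 3))  ≡⟨ lem₂ (2 ^ k) (k !) (27 ^ k) ⟩
  6 * (2 ^ k * 27 ^ k) * k !        ≡⟨ cong (λ z → 6 * z * k !) (^-distribʳ-* k 2 27) ⟨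
  6 * 54 ^ k * k !                  ∎
  where
  open ≤-Reasoning
  lem₁ : ∀ a x → 4 * (a * a) * x ≡ 2 * a * (x * a * 2)
  lem₁ = solve-∀
  lem₂ : ∀ a f b → 2 * a * (f * (b * 3)) ≡ 6 * (a * b) * f
  lem₂ = solve-∀

-- Each of the g handles costs degree four: three from `handle-bound` and one from the lattice
-- paths.
poly-bound : ∀ g k → (suc k * (suc k * (2 * suc k))) ^ g * (2 * k + g) ^ g ≤ (2 * (2 + g)) ^ g * suc k ^ (4 * g)
poly-bound g k = begin
  (n * (n * (2 * n))) ^ g * (2 * k + g) ^ g    ≤⟨ *-monoʳ-≤ ((n * (n * (2 * n))) ^ g) (^-monoˡ-≤ g 2k+g≤) ⟩
  (n * (n * (2 * n))) ^ g * ((2 + g) * n) ^ g  ≡⟨ ^-distribʳ-* g (n * (n * (2 * n))) ((2 + g) * n) ⟨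
  (n * (n * (2 * n)) * ((2 + g) * n)) ^ g      ≡⟨ cong (_^ g) (lem n (2 + g)) ⟩
  (2 * (2 + g) * n ^ 4) ^ g                    ≡⟨ ^-distribʳ-* g (2 * (2 + g)) (n ^ 4) ⟩
  (2 * (2 + g)) ^ g * (n ^ 4) ^ g              ≡⟨ cong ((2 * (2 + g)) ^ g *_) (^-*-assoc n 4 g) ⟩
  (2 * (2 + g)) ^ g * n ^ (4 * g)              ∎
  where
  open ≤-Reasoning
  n = suc k
  lem : ∀ n c → n * (n * (2 * n)) * (c * n) ≡ 2 * c * (n * (n * (n * (n * 1))))
  lem = solve-∀
  lem′ : ∀ g k → 2 * k + g + (2 + g * k) ≡ (2 + g) * suc k
  lem′ = solve-∀
  2k+g≤ : 2 * k + g ≤ (2 + g) * n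
  2k+g≤ = ≤-trans (m≤m+n _ _) (≤-reflexive (lem′ g k))

-- Integrality gives 54p + 1 ≤ q. Passing from Q^k with Q = 54p to (Q + 1)^(k+m) absorbs the
-- polynomial (k + 1)^m of degree m = 4g, at the price of the constant m! q^m.
radius-at-least : ∀ g → RadiusAtLeast (coeffF g) 1 54
radius-at-least g p zero    () _
radius-at-least g p (suc q′) _ p54<q = Bnd , bound
  where
  open ≤-Reasoning
  q = suc q′
  m = 4 * g
  c = (2 * (2 + g)) ^ g
  Q = p * 54
  Q<q : suc Q ≤ q
  Q<q = ≤-trans p54<q (≤-reflexive (*-identityˡ q))
  Bnd = c * (6 * (m ! * q ^ m))
  lem₁ : ∀ a c y x p e → a * (c * y * x) * (p * e) ≡ c * (y * (a * x)) * (p * e)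
  lem₁ = solve-∀
  lem₂ : ∀ c y t f p e → c * (y * (6 * t * f)) * (p * e) ≡ c * (6 * (y * (e * t))) * (p * f)
  lem₂ = solve-∀
  lem₃ : ∀ c f x y p h → c * (6 * (f * (x * y))) * (p * h) ≡ c * (6 * (f * y)) * h * (p * x)
  lem₃ = solve-∀
  bound : ∀ d → coeffF g d * p ^ d ≤ Bnd * d ! * q ^ d
  bound zero    = z≤n
  bound (suc k) = begin
    coeffF g (suc k) * p ^ suc k
      ≤⟨ *-monoˡ-≤ (p ^ suc k) (≤-trans (coeffF≤ξ g k) (*-monoʳ-≤ (4 ^ suc k) (*-monoˡ-≤ (ξ 0 k) (poly-bound g k)))) ⟩
    4 ^ suc k * (c * suc k ^ m * ξ 0 k) * (p * p ^ k)
      ≡⟨ lem₁ (4 ^ suc k) c (suc k ^ m) (ξ 0 k) p (p ^ k) ⟩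
    c * (suc k ^ m * (4 ^ suc k * ξ 0 k)) * (p * p ^ k)
      ≤⟨ *-monoˡ-≤ (p * p ^ k) (*-monoʳ-≤ c (*-monoʳ-≤ (suc k ^ m) (four-powers k))) ⟩
    c * (suc k ^ m * (6 * 54 ^ k * k !)) * (p * p ^ k)
      ≡⟨ lem₂ c (suc k ^ m) (54 ^ k) (k !) p (p ^ k) ⟩
    c * (6 * (suc k ^ m * (p ^ k * 54 ^ k))) * (p * k !)
      ≡⟨ cong (λ z → c * (6 * (suc k ^ m * z)) * (p * k !)) (^-distribʳ-* k p 54) ⟨
    c * (6 * (suc k ^ m * Q ^ k)) * (p * k !)
      ≤⟨ *-mono-≤ (*-monoʳ-≤ c (*-monoʳ-≤ 6 (≤-trans (*-monoˡ-≤ (Q ^ k) (^≤rising m k)) (rising-exp Q m k)))) (*-monoʳ-≤ p (m≤n*m (k !) (suc k))) ⟩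
    c * (6 * (m ! * suc Q ^ (k + m))) * (p * suc k !)
      ≤⟨ *-mono-≤ (*-monoʳ-≤ c (*-monoʳ-≤ 6 (*-monoʳ-≤ (m !) (^-monoˡ-≤ (k + m) Q<q)))) (*-monoˡ-≤ (suc k !) p≤q) ⟩
    c * (6 * (m ! * q ^ (k + m))) * (q * suc k !)
      ≡⟨ cong (λ z → c * (6 * (m ! * z)) * (q * suc k !)) (^-distribˡ-+-* q k m) ⟩
    c * (6 * (m ! * (q ^ k * q ^ m))) * (q * suc k !)
      ≡⟨ lem₃ c (m !) (q ^ k) (q ^ m) q (suc k !) ⟩
    Bnd * suc k ! * q ^ suc k ∎
    where
    p≤q : p ≤ q
    p≤q = ≤-trans (≤-trans (m≤m*n p 54) (n≤1+n Q)) Q<q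

-- With Q = 2q < 27p and j = 5n, (1 + 1/Q)^j ≥ (1 + n/Q)^5 beats the fourth power of j.
radius-at-most : ∀ g → RadiusAtMost (coeffF g) 2 27
radius-at-most g p zero     () _ B
radius-at-most g p (suc q′) _ 2q<27p B = suc (suc j) , *-cancelʳ-< (2 ^ j * cube (suc j)) _ _ (begin-strict
  B * suc (suc j) ! * q ^ suc (suc j) * (2 ^ j * cube (suc j))
    ≡⟨ lem₁ B j (suc j !) q (q ^ j) (2 ^ j) (cube (suc j)) ⟩
  suc j ! * (B * ((2 + j) * cube (suc j)) * (q * q) * (2 ^ j * q ^ j))
    ≡⟨ cong (λ z → suc j ! * (B * ((2 + j) * cube (suc j)) * (q * q) * z)) (^-distribʳ-* j 2 q) ⟨
  suc j ! * (B * ((2 + j) * cube (suc j)) * (q * q) * Q ^ j)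
    <⟨ *-monoʳ-< (suc j !) {{suc j !≢0}} growth ⟩
  suc j ! * suc Q ^ j
    ≤⟨ *-monoʳ-≤ (suc j !) (^-monoˡ-≤ j 2q<27p) ⟩
  suc j ! * (p * 27) ^ j
    ≡⟨ cong (suc j ! *_) (^-distribʳ-* j p 27) ⟩
  suc j ! * (p ^ j * 27 ^ j)
    ≡⟨ lem₂ (suc j !) (p ^ j) (27 ^ j) ⟩
  (27 ^ j * suc j !) * p ^ j
    ≤⟨ *-mono-≤ (≤-trans (ξ-lower j) (*-monoˡ-≤ (cube (suc j)) (*-monoˡ-≤ (2 ^ j) (ξ≤coeffF g j)))) p^j≤ ⟩
  coeffF g (suc (suc j)) * 2 ^ j * cube (suc j) * p ^ suc (suc j)
    ≡⟨ lem₃ (coeffF g (suc (suc j))) (2 ^ j) (cube (suc j)) (p ^ suc (suc j)) ⟩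
  coeffF g (suc (suc j)) * p ^ suc (suc j) * (2 ^ j * cube (suc j)) ∎)
  where
  open ≤-Reasoning
  q = suc q′
  Q = 2 * q
  -- The four fives come from bounding j + 2 and the cube of j + 1 by powers of 5Z, and `Q ^ 5` from
  -- the fifth power of Bernoulli's inequality. Taking n = K makes K < Q + n = Z, so the fifth
  -- factor Z beats all constants.
  K = B * (q * q) * (5 * (5 * (5 * 5))) * Q ^ 5
  n = K
  j = n * 5
  Z = Q + n
  positive : ∀ p → Q < p * 27 → 1 ≤ p
  positive (suc _) _ = s≤s z≤n
  p≥1 : 1 ≤ p
  p≥1 = positive p 2q<27p
  p^j≤ : p ^ j ≤ p * (p * p ^ j)
  p^j≤ = ≤-trans (≤-reflexive (sym (trans (*-identityˡ _) (*-identityˡ _)))) (*-mono-≤ p≥1 (*-monoˡ-≤ (p ^ j) p≥1))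
  lem₁ : ∀ B j f q e t c → B * (suc (suc j) * f) * (q * (q * e)) * (t * c) ≡ f * (B * ((2 + j) * c) * (q * q) * (t * e))
  lem₁ = solve-∀
  lem₂ : ∀ f a b → f * (a * b) ≡ (b * f) * a
  lem₂ = solve-∀
  lem₃ : ∀ a t c e → a * t * c * e ≡ a * e * (t * c)
  lem₃ = solve-∀
  j+2≤ : 2 + j ≤ 5 * Z
  j+2≤ = ≤-trans (+-mono-≤ (≤-trans (m≤m*n 2 q) (m≤n*m Q 5)) (≤-reflexive (*-comm n 5))) (≤-reflexive (sym (*-distribˡ-+ 5 Q n)))
  j+1≤ : suc j ≤ 5 * Z
  j+1≤ = ≤-trans (n≤1+n (suc j)) j+2≤
  quartic : (2 + j) * cube (suc j) ≤ 5 * Z * cube (5 * Z)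
  quartic = *-mono-≤ j+2≤ (*-mono-≤ j+1≤ (*-mono-≤ j+1≤ j+1≤))
  K<Z : K < Z
  K<Z = +-monoˡ-≤ n (≤-trans (s≤s z≤n) (m≤n*m q 2))
  lem₄ : ∀ B Z r R s → B * (5 * Z * (5 * Z * (5 * Z * (5 * Z)))) * r * s * R ≡ s * (B * r * (5 * (5 * (5 * 5))) * R * (Z * (Z * (Z * Z))))
  lem₄ = solve-∀
  fifth : ∀ a b → a ^ 5 * (b * (b * (b * (b * b)))) ≡ (a * b) ^ 5
  fifth = solve-∀′
    where
    solve-∀′ : ∀ a b → a * (a * (a * (a * (a * 1)))) * (b * (b * (b * (b * b)))) ≡ a * b * (a * b * (a * b * (a * b * (a * b * 1))))
    solve-∀′ = solve-∀
  growth : B * ((2 + j) * cube (suc j)) * (q * q) * Q ^ j < suc Q ^ j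
  growth = *-cancelʳ-< (Q ^ 5) _ _ (begin-strict
    B * ((2 + j) * cube (suc j)) * (q * q) * Q ^ j * Q ^ 5
      ≤⟨ *-monoˡ-≤ (Q ^ 5) (*-monoˡ-≤ (Q ^ j) (*-monoˡ-≤ (q * q) (*-monoʳ-≤ B quartic))) ⟩
    B * (5 * Z * cube (5 * Z)) * (q * q) * Q ^ j * Q ^ 5
      ≡⟨ lem₄ B Z (q * q) (Q ^ 5) (Q ^ j) ⟩
    Q ^ j * (K * (Z * (Z * (Z * Z))))
      <⟨ *-monoʳ-< (Q ^ j) {{m^n≢0 Q j}} (*-monoˡ-< (Z * (Z * (Z * Z))) {{Z⁴≢0}} K<Z) ⟩
    Q ^ j * (Z * (Z * (Z * (Z * Z))))
      ≡⟨ cong (_* (Z * (Z * (Z * (Z * Z))))) (^-*-assoc Q n 5) ⟨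
    (Q ^ n) ^ 5 * (Z * (Z * (Z * (Z * Z)))) ≡⟨ fifth (Q ^ n) Z ⟩
    (Q ^ n * Z) ^ 5                         ≤⟨ ^-monoˡ-≤ 5 (bernoulli Q n) ⟩
    (Q * suc Q ^ n) ^ 5                     ≡⟨ ^-distribʳ-* 5 Q (suc Q ^ n) ⟩
    Q ^ 5 * (suc Q ^ n) ^ 5                 ≡⟨ cong (Q ^ 5 *_) (^-*-assoc (suc Q) n 5) ⟩
    Q ^ 5 * suc Q ^ j                       ≡⟨ *-comm (Q ^ 5) (suc Q ^ j) ⟩
    suc Q ^ j * Q ^ 5                       ∎)
    where
    Z⁴≢0 : NonZero (Z * (Z * (Z * Z)))
    Z⁴≢0 = m*n≢0 Z (Z * (Z * Z)) {{_}} {{m*n≢0 Z (Z * Z) {{_}} {{m*n≢0 Z Z}}}}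

theorem1p1 : ∀ (g : ℕ) → RadiusAtLeast (coeffF g) 1 54 × RadiusAtMost (coeffF g) 2 27
theorem1p1 g = radius-at-least g , radius-at-most g
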